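{- Let $k \ge 2$ be an integer and let $G$ be a graph on $n$ vertices such that $nk$ is even. If $\beta^k(G) \ge 1$, then $G$ contains a $k$-factor. Moreover, the lower bound $1$ is sharp: for every integer $k\ge 2$ and every $\varepsilon>0$ there exists a graph $G$ on $n$ vertices with $nk$ even and $1-\varepsilon < \beta^k(G) < 1$ that contains no $k$-factor.
   Context: All graphs are finite and simple. For a graph $G$, a vertex set $S\subseteq V(G)$ and a positive integer $k$, the $k$-th neighborhood $\Lambda^k_G(S)$ is the set of vertices of $G$ having at least $k$ neighbors in $S$. The $k$-th binding number is $\beta^k(G)=\min\{|\Lambda^k_G(S)|/|S| : S\subseteq V(G),\ |S|\ge k,\ \Lambda^k_G(S)\ne V(G)\}$, with the convention $\beta^k(G)=0$ if $|V(G)|<k$. A $k$-factor is a $k$-regular spanning subgraph. -}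

module Defs where

open import Data.Bool using (Bool; true; false; if_then_else_)
open import Data.Nat using (ℕ; zero; suc; _≤ᵇ_)
open import Data.Integer using (+_)
open import Data.Fin using (Fin)
open import Data.Fin.Subset using (Subset; inside; outside; ∣_∣; _∩_; ⊤)
open import Data.Vec using (Vec; []; _∷_; tabulate)
open import Data.List using (List; []; _∷_; map; _++_; filter)
open import Data.Maybe using (Maybe; just; nothing)
open import Data.Rational using (ℚ; _/_; _⊓_; 0ℚ)
open import Relation.Binary.PropositionalEquality using (_≡_)
open import Relation.Nullary using (¬_)
open import Relation.Nullary.Decidable using (⌊_⌋)
open import Data.Product using (_×_)
import Data.Vec.Properties as VP

record Graph (n : ℕ) : Set where
  field
    adj   : Fin n → Fin n → Bool
    sym   : ∀ u v → adj u v ≡ adj v u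
    loopless : ∀ v → adj v v ≡ false
open Graph public

N : ∀ {n} → Graph n → Fin n → Subset n
N G v = tabulate (adj G v)

degree : ∀ {n} → Graph n → Fin n → ℕ
degree G v = ∣ N G v ∣

Λ : ∀ {n} → ℕ → Graph n → Subset n → Subset n
Λ k G S = tabulate (λ v → k ≤ᵇ ∣ S ∩ N G v ∣)

allSubsets : (n : ℕ) → List (Subset n)
allSubsets zero = [] ∷ []
allSubsets (suc n) = map (inside ∷_) (allSubsets n) ++ map (outside ∷_) (allSubsets n)

-- the ratio a / b as a rational (only used with b ≥ k ≥ 1; value 0 if b = 0)
ratio : ℕ → ℕ → ℚ
ratio a zero = 0ℚ
ratio a (suc b) = (+ a) / suc b

admissible : ∀ {n} → ℕ → Graph n → Subset n → Bool
admissible {n} k G S = (k ≤ᵇ ∣ S ∣) Data.Bool.∧ Data.Bool.not ⌊ VP.≡-dec Data.Bool._≟_ (Λ k G S) ⊤ ⌋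

minimum : List ℚ → Maybe ℚ
minimum [] = nothing
minimum (x ∷ xs) with minimum xs
... | nothing = just x
... | just m = just (x ⊓ m)

-- k-th binding number β^k(G) = min |Λ^k(S)|/|S| over admissible S;
-- equals 0 when there is no admissible S (in particular when n < k).
β : ∀ {n} → ℕ → Graph n → ℚ
β k G with minimum (map (λ S → ratio ∣ Λ k G S ∣ ∣ S ∣)
                        (filter (λ S → Data.Bool._≟_ (admissible k G S) true) (allSubsets _)))
... | nothing = 0ℚ
... | just m = m

_⊆G_ : ∀ {n} → Graph n → Graph n → Set
H ⊆G G = ∀ u v → adj H u v ≡ true → adj G u v ≡ true

HasFactor : ∀ {n} → ℕ → Graph n → Set
HasFactor {n} k G = Data.Product.Σ (Graph n) (λ H → (H ⊆G G) × (∀ v → degree H v ≡ k))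

{-# OPTIONS --safe #-}

-- Write x F v for the degree of v in a subgraph F minus k, and minimise the total defect ∑ |x F v|
-- over all subgraphs; the minimum m is even, so it is at least 2 when there is no k-factor.
-- Degree vectors satisfy an exchange axiom (walk alternately along F ∖ F′ and F′ ∖ F), which makes
-- separable convex costs behave as on a jump system.  It allows |x| to be replaced by the linear
-- cost -x on a set T of vertices that are never over-saturated and by x on a set S of vertices that
-- are never under-saturated, without changing m, until every other vertex is either defective with
-- both signs or never defective in optimal subgraphs.  On the former vertices "no optimal subgraph
-- is defective at both u and v" is transitive and contains adjacency (as in Gallai's lemma), so they
-- split into pairwise non-adjacent blocks.  With q the number of defective blocks this gives Tutte's
-- identity  k|T| + q = m + k|S| + ∑_{w ∉ S} |N(w) ∩ T|.  Adding to T one vertex without neighbours in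
-- T from each defective block in which all vertices have 0 or k neighbours in T yields a set X with
-- |X| > |Λ(X)|, contradicting β ≥ 1 if |X| ≥ k.  If |X| < k, the common neighbours of k-sets that
-- contain T contradict the identity.
--
-- For sharpness, join a complete graph on s vertices to s + 2 independent vertices.

module Submission where

-- Whether an optimal subgraph with a given defect exists is a question about all subgraphs,
-- represented by functions, and is never decided. The argument therefore runs under double
-- negations and aims at a contradiction; an exhaustive search for a factor removes the negations at
-- the end.
--
-- Parity is what makes linearisation possible. At a vertex with defect 1 of the excluded sign, the
-- linear cost is smaller than `|x|` by 2; but such a subgraph is not optimal, hence costs at least
-- `m + 2`, and the minimum survives.
--
-- In the identity a defective block weighs 1, whereas a vertex added to `X` weighs `k`, so the two
-- kinds of blocks are treated differently. A block with a vertex whose number of neighbours in `T`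
-- is neither 0 nor `k` is paid for by the surplus of that vertex in the sum over `w`. Any other
-- defective block contributes a vertex to `X`; this puts no further vertices into `Λ(X)`, because a
-- vertex of the block without neighbours in `T` sees at most one of the added vertices, and
-- `k ≥ 2`.

-- Finite integer sums.

module Sums where

  open import Data.Bool using (Bool; true; false)
  open import Data.Nat as ℕ using (ℕ; zero; suc)
  open import Data.Fin using (Fin; zero; suc; _≟_)
  open import Data.Fin.Properties using (suc-injective)
  open import Data.Integer using (ℤ; +_; 0ℤ; 1ℤ; _+_; _-_; _*_; -_; _≤_; +≤+)
  import Data.Integer.Properties as ℤP
  open import Data.Integer.Solver using (module +-*-Solver)
  open +-*-Solver using (solve; con; _:+_; _:*_; _:-_; :-_; _:=_)
  open import Data.Product using (∃; _×_; _,_)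
  open import Data.Empty using (⊥-elim)
  open import Function using (_∘_)
  open import Relation.Nullary using (¬_; yes; no)
  open import Relation.Nullary.Decidable using (⌊_⌋)
  open import Relation.Binary.PropositionalEquality

  open import Algebra.Properties.Semiring.Sum ℤP.+-*-semiring public
    using (sum; sum-cong-≗; ∑-distrib-+; ∑-comm; *-distribˡ-sum; *-distribʳ-sum)

  -- Certificate for linear arithmetic: the hypotheses are added up to `l ≤ r`, and the ring solver
  -- checks that both differences are the same polynomial. Most inequalities below are proved this
  -- way; products of nonnegative factors enter as further summands.
  ≤-by : ∀ {l r a b} → l ≤ r → r - l ≡ b - a → a ≤ b
  ≤-by l≤r eq = ℤP.0≤i-j⇒j≤i (subst (0ℤ ≤_) eq (ℤP.i≤j⇒0≤j-i l≤r))

  1≰0 : ¬ (1ℤ ≤ 0ℤ)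
  1≰0 (+≤+ ())

  ⟨_⟩ : Bool → ℤ
  ⟨ true ⟩  = 1ℤ
  ⟨ false ⟩ = 0ℤ

  ⟨⟩-nonneg : ∀ b → 0ℤ ≤ ⟨ b ⟩
  ⟨⟩-nonneg true  = +≤+ ℕ.z≤n
  ⟨⟩-nonneg false = +≤+ ℕ.z≤n

  ⟨⟩≤1 : ∀ b → ⟨ b ⟩ ≤ 1ℤ
  ⟨⟩≤1 true  = ℤP.≤-refl
  ⟨⟩≤1 false = +≤+ ℕ.z≤n

  1≤⟨⟩ : ∀ {b} → 1ℤ ≤ ⟨ b ⟩ → b ≡ true
  1≤⟨⟩ {true}  _ = refl
  1≤⟨⟩ {false} (+≤+ ())

  δ : ∀ {n} → Fin n → Fin n → ℤ
  δ u v = ⟨ ⌊ u ≟ v ⌋ ⟩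

  δ-refl : ∀ {n} (u : Fin n) → δ u u ≡ 1ℤ
  δ-refl u with u ≟ u
  ... | yes _   = refl
  ... | no  u≢u = ⊥-elim (u≢u refl)

  δ-≢ : ∀ {n} {u v : Fin n} → u ≢ v → δ u v ≡ 0ℤ
  δ-≢ {u = u} {v} u≢v with u ≟ v
  ... | yes u≡v = ⊥-elim (u≢v u≡v)
  ... | no  _   = refl

  δ-suc : ∀ {n} (u v : Fin n) → δ (suc u) (suc v) ≡ δ u v
  δ-suc u v with u ≟ v
  ... | yes _ = refl
  ... | no  _ = refl

  ∑-zero : ∀ {n} {f : Fin n → ℤ} → (∀ i → f i ≡ 0ℤ) → sum f ≡ 0ℤ
  ∑-zero {zero}  f≡0 = refl
  ∑-zero {suc n} f≡0 = cong₂ _+_ (f≡0 zero) (∑-zero (f≡0 ∘ suc))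

  ∑-mono : ∀ {n} {f g : Fin n → ℤ} → (∀ i → f i ≤ g i) → sum f ≤ sum g
  ∑-mono {zero}  f≤g = ℤP.≤-refl
  ∑-mono {suc n} f≤g = ℤP.+-mono-≤ (f≤g zero) (∑-mono (f≤g ∘ suc))

  ∑-nonneg : ∀ {n} {f : Fin n → ℤ} → (∀ i → 0ℤ ≤ f i) → 0ℤ ≤ sum f
  ∑-nonneg {zero}  0≤f = ℤP.≤-refl
  ∑-nonneg {suc n} 0≤f = ℤP.+-mono-≤ (0≤f zero) (∑-nonneg (0≤f ∘ suc))

  ∑-const : ∀ n (c : ℤ) → sum {n} (λ _ → c) ≡ + n * c
  ∑-const zero    c = refl
  ∑-const (suc n) c = trans (cong (_+_ c) (∑-const n c))
    (solve 2 (λ c m → c :+ m :* c := (con 1ℤ :+ m) :* c) refl c (+ n))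

  ∑-neg : ∀ {n} (f : Fin n → ℤ) → sum (λ i → - f i) ≡ - sum f
  ∑-neg {zero}  f = refl
  ∑-neg {suc n} f = trans (cong (_+_ (- f zero)) (∑-neg (f ∘ suc)))
    (sym (ℤP.neg-distrib-+ (f zero) (sum (f ∘ suc))))

  ∑-distrib-- : ∀ {n} (f g : Fin n → ℤ) → sum (λ i → f i - g i) ≡ sum f - sum g
  ∑-distrib-- f g = trans (∑-distrib-+ f (λ i → - g i)) (cong (_+_ (sum f)) (∑-neg g))

  ∑-δ* : ∀ {n} (u : Fin n) (f : Fin n → ℤ) → sum (λ v → δ u v * f v) ≡ f u
  ∑-δ* {suc n} zero f = trans (cong₂ _+_ (ℤP.*-identityˡ (f zero)) (∑-zero {f = λ v → 0ℤ * f (suc v)} (λ v → ℤP.*-zeroˡ (f (suc v)))))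
    (ℤP.+-identityʳ (f zero))
  ∑-δ* {suc n} (suc u) f = trans (cong₂ _+_ (ℤP.*-zeroˡ (f zero))
      (trans (sum-cong-≗ (λ v → cong (_* f (suc v)) (δ-suc u v))) (∑-δ* u (f ∘ suc))))
    (ℤP.+-identityˡ (f (suc u)))

  ∑-δ : ∀ {n} (u : Fin n) → sum (δ u) ≡ 1ℤ
  ∑-δ u = trans (sum-cong-≗ (λ v → sym (ℤP.*-identityʳ (δ u v)))) (∑-δ* u (λ _ → 1ℤ))

  ∑-δ-scaled : ∀ {n} (u : Fin n) (c : ℤ) → sum (λ v → δ u v * c) ≡ c
  ∑-δ-scaled u c = ∑-δ* u (λ _ → c)

  ∑-update : ∀ {n} {p q : Fin n → ℤ} u → (∀ v → v ≢ u → p v ≡ q v) → sum p + q u ≡ sum q + p u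
  ∑-update {p = p} {q} u p≡q = trans (cong (_+ q u) (trans (sum-cong-≗ split)
      (trans (∑-distrib-+ q (λ v → δ u v * (p u - q u))) (cong (_+_ (sum q)) (∑-δ-scaled u (p u - q u))))))
    (solve 3 (λ s a b → (s :+ (a :- b)) :+ b := s :+ a) refl (sum q) (p u) (q u))
    where
    split : ∀ v → p v ≡ q v + δ u v * (p u - q u)
    split v with u ≟ v
    ... | yes refl = solve 2 (λ a b → a := b :+ con 1ℤ :* (a :- b)) refl (p u) (q u)
    ... | no  u≢v  = trans (p≡q v (u≢v ∘ sym)) (solve 3 (λ a b c → c := c :+ con 0ℤ :* (a :- b)) refl (p u) (q u) (q v))

  -- In an exchange at `u` all other vertices are compared termwise, and `u` is treated by itself;
  -- its terms are therefore moved to the opposite sides.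
  ∑-mono-except : ∀ {n} {p q : Fin n → ℤ} u → (∀ v → v ≢ u → p v ≤ q v) → sum p + q u ≤ sum q + p u
  ∑-mono-except {p = p} {q} u p≤q = ≤-by (∑-mono {f = p} {g = λ v → q v + δ u v * (p u - q u)} bound)
    (trans (cong (_- sum p) (trans (∑-distrib-+ q (λ v → δ u v * (p u - q u)))
                                   (cong (_+_ (sum q)) (∑-δ-scaled u (p u - q u)))))
      (solve 4 (λ s t a b → (s :+ (a :- b)) :- t := (s :+ a) :- (t :+ b)) refl (sum q) (sum p) (p u) (q u)))
    where
    bound : ∀ v → p v ≤ q v + δ u v * (p u - q u)
    bound v with u ≟ v
    ... | yes refl = ℤP.≤-reflexive (solve 2 (λ a b → a := b :+ con 1ℤ :* (a :- b)) refl (p u) (q u))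
    ... | no  u≢v  = ≤-by (p≤q v (u≢v ∘ sym))
      (solve 4 (λ a b c d → c :- d := (c :+ con 0ℤ :* (a :- b)) :- d) refl (p u) (q u) (q v) (p v))

  ∑-pos : ∀ {n} (f : Fin n → ℤ) → 1ℤ ≤ sum f → ∃ λ i → 1ℤ ≤ f i
  ∑-pos {zero}  f (+≤+ ())
  ∑-pos {suc n} f 1≤ with 1ℤ ℤP.≤? f zero
  ... | yes 1≤f0 = zero , 1≤f0
  ... | no  1≰f0 with ∑-pos (f ∘ suc) (≤-by (ℤP.+-mono-≤ 1≤ (ℤP.i<j⇒suc[i]≤j (ℤP.≰⇒> 1≰f0)))
                      (solve 2 (λ a s → ((a :+ s) :+ con 1ℤ) :- (con 1ℤ :+ (con 1ℤ :+ a)) := s :- con 1ℤ) refl (f zero) (sum (f ∘ suc))))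
  ... | i , 1≤fi = suc i , 1≤fi

  term≤∑ : ∀ {n} {f : Fin n → ℤ} → (∀ i → 0ℤ ≤ f i) → ∀ u → f u ≤ sum f
  term≤∑ {n} {f} 0≤f u = ≤-by (∑-mono-except {p = λ _ → 0ℤ} {q = f} u (λ v _ → 0≤f v))
    (trans (cong (λ z → (sum f + 0ℤ) - (z + f u)) (∑-zero {n} {λ _ → 0ℤ} (λ _ → refl)))
           (solve 2 (λ s a → (s :+ con 0ℤ) :- (con 0ℤ :+ a) := s :- a) refl (sum f) (f u)))

  ∑-at-most-one : ∀ {n} (b : Fin n → Bool) → (∀ i j → b i ≡ true → b j ≡ true → i ≡ j) → sum (λ i → ⟨ b i ⟩) ≤ 1ℤ
  ∑-at-most-one {zero}  b uniq = +≤+ ℕ.z≤n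
  ∑-at-most-one {suc n} b uniq with b zero in b0
  ... | false = ≤-by (∑-at-most-one (b ∘ suc) (λ i j bi bj → suc-injective (uniq (suc i) (suc j) bi bj)))
    (solve 1 (λ s → con 1ℤ :- s := con 1ℤ :- (con 0ℤ :+ s)) refl (sum (λ i → ⟨ b (suc i) ⟩)))
  ... | true = ℤP.≤-reflexive (cong (_+_ 1ℤ) (∑-zero rest))
    where
    rest : ∀ i → ⟨ b (suc i) ⟩ ≡ 0ℤ
    rest i with b (suc i) in bi
    ... | false = refl
    ... | true  with () ← uniq zero (suc i) b0 bi

  ∑-two : ∀ {n} (b : Fin n → Bool) → + 2 ≤ sum (λ i → ⟨ b i ⟩) →
          ∃ λ i → ∃ λ j → i ≢ j × b i ≡ true × b j ≡ true
  ∑-two {suc n} b 2≤ with b zero in b0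
  ... | false with i , j , i≢j , bi , bj ← ∑-two (b ∘ suc) (subst (+ 2 ≤_) (ℤP.+-identityˡ _) 2≤) =
    suc i , suc j , (i≢j ∘ suc-injective) , bi , bj
  ... | true with j , 1≤ ← ∑-pos (λ i → ⟨ b (suc i) ⟩)
                  (≤-by 2≤ (solve 1 (λ s → (con 1ℤ :+ s) :- con (+ 2) := s :- con 1ℤ) refl (sum (λ i → ⟨ b (suc i) ⟩)))) =
    zero , suc j , (λ ()) , b0 , 1≤⟨⟩ 1≤
  ∑-two {zero} b (+≤+ ())

  ∑-bounded : ∀ {n} (f : Fin n → ℤ) c → (∀ i → f i ≤ c) → sum f ≤ + n * c
  ∑-bounded {n} f c f≤c = ℤP.≤-trans (∑-mono f≤c) (ℤP.≤-reflexive (∑-const n c))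

  -- Double counting in the matrix `hit`: row `c` has sum `⟨ a c ⟩`, and injectivity leaves at most
  -- one entry in each column.
  ∑-injection : ∀ {n} (a b : Fin n → Bool) (r : Fin n → Fin n) →
    (∀ c → a c ≡ true → b (r c) ≡ true) →
    (∀ c c′ → a c ≡ true → a c′ ≡ true → r c ≡ r c′ → c ≡ c′) →
    sum (λ c → ⟨ a c ⟩) ≤ sum (λ w → ⟨ b w ⟩)
  ∑-injection {n} a b r hits inj = ℤP.≤-trans (ℤP.≤-reflexive double) (∑-mono column)
    where
    hit : Fin n → Fin n → Bool
    hit c w with a c | r c ≟ w
    ... | true | yes _ = true
    ... | _    | _     = false
    hit-true : ∀ c w → hit c w ≡ true → a c ≡ true × r c ≡ w
    hit-true c w e with a c | r c ≟ w
    ... | true | yes rc≡w = refl , rc≡w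
    hit-true c w () | true  | no _
    hit-true c w () | false | yes _
    hit-true c w () | false | no _
    row : ∀ c → sum (λ w → ⟨ hit c w ⟩) ≡ ⟨ a c ⟩
    row c = trans (sum-cong-≗ entry) (∑-δ-scaled (r c) ⟨ a c ⟩)
      where
      entry : ∀ w → ⟨ hit c w ⟩ ≡ δ (r c) w * ⟨ a c ⟩
      entry w with a c | r c ≟ w
      ... | true  | yes _ = refl
      ... | true  | no  _ = refl
      ... | false | yes _ = refl
      ... | false | no  _ = refl
    double : sum (λ c → ⟨ a c ⟩) ≡ sum (λ w → sum (λ c → ⟨ hit c w ⟩))
    double = trans (sym (sum-cong-≗ row)) (∑-comm (λ c w → ⟨ hit c w ⟩))
    column : ∀ w → sum (λ c → ⟨ hit c w ⟩) ≤ ⟨ b w ⟩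
    column w with b w in bw
    ... | true  = ∑-at-most-one (λ c → hit c w) λ c c′ e e′ →
      let ac , rc = hit-true c w e ; ac′ , rc′ = hit-true c′ w e′ in inj c c′ ac ac′ (trans rc (sym rc′))
    ... | false = ℤP.≤-reflexive (∑-zero none)
      where
      none : ∀ c → ⟨ hit c w ⟩ ≡ 0ℤ
      none c with hit c w in e
      ... | false = refl
      ... | true with ac , refl ← hit-true c w e with () ← trans (sym bw) (hits c ac)

-- Signs, convex costs and their parity.

module Costs where

  open import Data.Nat as ℕ using (ℕ; zero; suc)
  open import Data.Sign as S using (Sign; opposite)
  open import Data.Integer using (ℤ; +_; -[1+_]; 0ℤ; 1ℤ; _+_; _-_; -_; _≤_; ∣_∣; +≤+; -≤+)
  import Data.Integer.Properties as ℤP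
  open import Data.Integer.Solver using (module +-*-Solver)
  open +-*-Solver using (solve; con; _:+_; _:*_; _:-_; :-_; _:=_)
  open import Data.Product using (∃; _,_)
  open import Data.Empty using (⊥-elim)
  open import Relation.Nullary using (¬_; yes; no)
  open import Relation.Binary.PropositionalEquality
  open Sums

  sg : Sign → ℤ → ℤ
  sg S.+ x = x
  sg S.- x = - x

  ⟦_⟧ : Sign → ℤ
  ⟦ s ⟧ = sg s 1ℤ

  sg-+ : ∀ s x y → sg s (x + y) ≡ sg s x + sg s y
  sg-+ S.+ x y = refl
  sg-+ S.- x y = ℤP.neg-distrib-+ x y

  sg-opp : ∀ s x → sg (opposite s) x ≡ - sg s x
  sg-opp S.+ x = refl
  sg-opp S.- x = sym (ℤP.neg-involutive x)

  sg-up : ∀ s x → sg s (x + ⟦ s ⟧) ≡ sg s x + 1ℤ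
  sg-up S.+ x = refl
  sg-up S.- x = ℤP.neg-distrib-+ x (- 1ℤ)

  sg-down : ∀ s x → sg s (x + ⟦ opposite s ⟧) ≡ sg s x - 1ℤ
  sg-down S.+ x = refl
  sg-down S.- x = ℤP.neg-distrib-+ x 1ℤ

  -⟦⟧ : ∀ s x → x - ⟦ s ⟧ ≡ x + ⟦ opposite s ⟧
  -⟦⟧ S.+ x = refl
  -⟦⟧ S.- x = refl

  ⟦⟧≢0 : ∀ s → ⟦ s ⟧ ≢ 0ℤ
  ⟦⟧≢0 S.+ ()
  ⟦⟧≢0 S.- ()

  opposite-≢ : ∀ s t → t ≢ s → t ≡ opposite s
  opposite-≢ S.+ S.+ t≢s = ⊥-elim (t≢s refl)
  opposite-≢ S.+ S.- t≢s = refl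
  opposite-≢ S.- S.+ t≢s = refl
  opposite-≢ S.- S.- t≢s = ⊥-elim (t≢s refl)

  opposite-opposite : ∀ s → opposite (opposite s) ≡ s
  opposite-opposite S.+ = refl
  opposite-opposite S.- = refl

  abs : ℤ → ℤ
  abs x = + ∣ x ∣

  sg≤abs : ∀ s x → sg s x ≤ abs x
  sg≤abs S.+ (+ n)      = ℤP.≤-refl
  sg≤abs S.+ -[1+ n ]   = -≤+
  sg≤abs S.- (+ zero)   = ℤP.≤-refl
  sg≤abs S.- (+ suc n)  = -≤+
  sg≤abs S.- -[1+ n ]   = ℤP.≤-refl

  abs-sg : ∀ s x → 0ℤ ≤ sg s x → abs x ≡ sg s x
  abs-sg S.+ (+ n)     _ = refl
  abs-sg S.- (+ zero)  _ = refl
  abs-sg S.- (+ suc n) ()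
  abs-sg S.- -[1+ n ]  _ = refl

  signed : ∀ x → x ≢ 0ℤ → ∃ λ s → 1ℤ ≤ sg s x
  signed (+ zero)  x≢0 = ⊥-elim (x≢0 refl)
  signed (+ suc n) _   = S.+ , +≤+ (ℕ.s≤s ℕ.z≤n)
  signed -[1+ n ]  _   = S.- , +≤+ (ℕ.s≤s ℕ.z≤n)

  signed-≢0 : ∀ s {x} → 1ℤ ≤ sg s x → x ≢ 0ℤ
  signed-≢0 S.+ 1≤ refl = 1≰0 1≤
  signed-≢0 S.- 1≤ refl = 1≰0 1≤

  0≤1 : 0ℤ ≤ 1ℤ
  0≤1 = +≤+ ℕ.z≤n

  0≤x-1 : ∀ {x} → 1ℤ ≤ x → 0ℤ ≤ x - 1ℤ
  0≤x-1 = ℤP.i≤j⇒0≤j-i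

  abs-step-≤ : ∀ s x → abs (x + ⟦ s ⟧) ≤ abs x + 1ℤ
  abs-step-≤ s x = ℤP.≤-trans (+≤+ (ℤP.∣i+j∣≤∣i∣+∣j∣ x ⟦ s ⟧)) (ℤP.≤-reflexive (cong (λ k → + (∣ x ∣ ℕ.+ k)) (unit s)))
    where
    unit : ∀ s → ∣ ⟦ s ⟧ ∣ ≡ 1
    unit S.+ = refl
    unit S.- = refl

  abs-down : ∀ s x → 1ℤ ≤ sg s x → abs (x + ⟦ opposite s ⟧) ≡ abs x - 1ℤ
  abs-down s x 1≤ = trans (abs-sg s _ (subst (0ℤ ≤_) (sym (sg-down s x)) (0≤x-1 1≤)))
    (trans (sg-down s x) (cong (_- 1ℤ) (sym (abs-sg s x (ℤP.≤-trans 0≤1 1≤)))))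

  data Kind : Set where
    abs′ : Kind
    lin  : Sign → Kind

  cost : Kind → ℤ → ℤ
  cost abs′    x = abs x
  cost (lin s) x = sg s x

  -- Both new arguments stay between `x` and `x′` and keep the sum, so this is convexity. For `abs′`
  -- the signs of the new arguments select the bounds on `abs x` and `abs x′` that are used.
  cost-conv⁺ : ∀ κ x x′ e → 0ℤ ≤ e → e ≤ x′ - x → cost κ (x + e) + cost κ (x′ - e) ≤ cost κ x + cost κ x′
  cost-conv⁺ (lin s) x x′ e _ _ = ℤP.≤-reflexive (trans (sym (sg-+ s _ _))
    (trans (cong (sg s) (solve 3 (λ x x′ e → (x :+ e) :+ (x′ :- e) := x :+ x′) refl x x′ e)) (sg-+ s x x′)))
  cost-conv⁺ abs′ x x′ e 0≤e e≤d with 0ℤ ℤP.≤? (x + e) | 0ℤ ℤP.≤? (x′ - e)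
  ... | yes p | yes q = ℤP.≤-trans (ℤP.≤-reflexive (trans (cong₂ _+_ (abs-sg S.+ _ p) (abs-sg S.+ _ q))
          (solve 3 (λ x x′ e → (x :+ e) :+ (x′ :- e) := x :+ x′) refl x x′ e)))
        (ℤP.+-mono-≤ (sg≤abs S.+ x) (sg≤abs S.+ x′))
  ... | yes p | no  q = ℤP.≤-trans (ℤP.≤-reflexive (cong₂ _+_ (abs-sg S.+ _ p) (abs-sg S.- _ (ℤP.neg-mono-≤ (ℤP.<⇒≤ (ℤP.≰⇒> q))))))
        (≤-by (ℤP.+-mono-≤ (ℤP.+-mono-≤ (sg≤abs S.- x) (sg≤abs S.+ x′)) (ℤP.+-mono-≤ e≤d e≤d))
          (solve 5 (λ x x′ e a a′ → ((a :+ a′) :+ ((x′ :- x) :+ (x′ :- x))) :- (((:- x) :+ x′) :+ (e :+ e))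
                 := (a :+ a′) :- ((x :+ e) :+ (:- (x′ :- e)))) refl x x′ e (abs x) (abs x′)))
  ... | no  p | yes q = ℤP.≤-trans (ℤP.≤-reflexive (cong₂ _+_ (abs-sg S.- _ (ℤP.neg-mono-≤ (ℤP.<⇒≤ (ℤP.≰⇒> p)))) (abs-sg S.+ _ q)))
        (≤-by (ℤP.+-mono-≤ (ℤP.+-mono-≤ (sg≤abs S.- x) (sg≤abs S.+ x′)) (ℤP.+-mono-≤ 0≤e 0≤e))
          (solve 5 (λ x x′ e a a′ → ((a :+ a′) :+ (e :+ e)) :- (((:- x) :+ x′) :+ (con 0ℤ :+ con 0ℤ))
                 := (a :+ a′) :- ((:- (x :+ e)) :+ (x′ :- e))) refl x x′ e (abs x) (abs x′)))
  ... | no  p | no  q = ℤP.≤-trans (ℤP.≤-reflexive (trans (cong₂ _+_ (abs-sg S.- _ (ℤP.neg-mono-≤ (ℤP.<⇒≤ (ℤP.≰⇒> p))))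
            (abs-sg S.- _ (ℤP.neg-mono-≤ (ℤP.<⇒≤ (ℤP.≰⇒> q)))))
          (solve 3 (λ x x′ e → (:- (x :+ e)) :+ (:- (x′ :- e)) := (:- x) :+ (:- x′)) refl x x′ e)))
        (ℤP.+-mono-≤ (sg≤abs S.- x) (sg≤abs S.- x′))

  cost-conv : ∀ κ s x x′ a → 0ℤ ≤ a → a ≤ sg s (x′ - x) →
    cost κ (x + sg s a) + cost κ (x′ - sg s a) ≤ cost κ x + cost κ x′
  cost-conv κ S.+ x x′ a 0≤a a≤ = cost-conv⁺ κ x x′ a 0≤a a≤
  cost-conv κ S.- x x′ a 0≤a a≤ = subst₂ _≤_
    (trans (cong (λ z → cost κ (x′ + z) + cost κ (x - a)) (sym (ℤP.neg-involutive a))) (ℤP.+-comm (cost κ (x′ - (- a))) (cost κ (x - a))))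
    (ℤP.+-comm (cost κ x′) (cost κ x))
    (cost-conv⁺ κ x′ x a 0≤a (subst (a ≤_) (solve 2 (λ x x′ → :- (x′ :- x) := x :- x′) refl x x′) a≤))

  -- The arguments lie on opposite sides of 0 and both step towards it, so each loses 1.
  abs-gain : ∀ s x x′ → 1ℤ ≤ sg s x → 1ℤ ≤ sg (opposite s) x′ →
    abs (x + ⟦ opposite s ⟧) + abs (x′ - ⟦ opposite s ⟧) + + 2 ≡ abs x + abs x′
  abs-gain s x x′ 1≤ 1≤′ = trans (cong₂ (λ a b → a + b + + 2) (abs-down s x 1≤)
      (trans (cong abs (-⟦⟧ (opposite s) x′)) (abs-down (opposite s) x′ 1≤′)))
    (solve 2 (λ a b → ((a :- con 1ℤ) :+ (b :- con 1ℤ)) :+ con (+ 2) := a :+ b) refl (abs x) (abs x′))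

  -- The double step saves 2 on the first argument. The second may overshoot 0, but from distance at
  -- least 1 a double step does not increase its absolute value.
  abs-gain₂ : ∀ s x x′ → + 2 ≤ sg s x → 1ℤ ≤ sg (opposite s) x′ →
    abs (x + sg (opposite s) (+ 2)) + abs (x′ - sg (opposite s) (+ 2)) + + 2 ≤ abs x + abs x′
  abs-gain₂ s x x′ 2≤ 1≤′ = ≤-by (ℤP.+-mono-≤ (ℤP.≤-reflexive first) second)
    (solve 4 (λ a b c d → ((a :- con (+ 2)) :+ b) :- (c :+ d) := (a :+ b) :- ((c :+ d) :+ con (+ 2)))
       refl (abs x) (abs x′) (abs (x + sg (opposite s) (+ 2))) (abs (x′ - sg (opposite s) (+ 2))))
    where
    o = opposite s
    1≤ : 1ℤ ≤ sg s x
    1≤ = ℤP.≤-trans (+≤+ (ℕ.s≤s ℕ.z≤n)) 2≤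
    twice : ∀ t → sg t (+ 2) ≡ ⟦ t ⟧ + ⟦ t ⟧
    twice S.+ = refl
    twice S.- = refl
    first : abs (x + sg o (+ 2)) ≡ abs x - + 2
    first = trans (cong abs (trans (cong (_+_ x) (twice o)) (sym (ℤP.+-assoc x ⟦ o ⟧ ⟦ o ⟧))))
      (trans (abs-down s (x + ⟦ o ⟧) (subst (1ℤ ≤_) (sym (sg-down s x))
                (≤-by 2≤ (solve 1 (λ p → p :- con (+ 2) := (p :- con 1ℤ) :- con 1ℤ) refl (sg s x)))))
        (trans (cong (_- 1ℤ) (abs-down s x 1≤))
          (solve 1 (λ a → (a :- con 1ℤ) :- con 1ℤ := a :- con (+ 2)) refl (abs x))))
    second : abs (x′ - sg o (+ 2)) ≤ abs x′
    second = ℤP.≤-trans (ℤP.≤-reflexive (cong abs (trans (cong (λ z → x′ - z) (twice o))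
        (trans (solve 2 (λ a b → a :- (b :+ b) := (a :- b) :- b) refl x′ ⟦ o ⟧)
          (trans (-⟦⟧ o (x′ - ⟦ o ⟧)) (cong (_+ ⟦ opposite o ⟧) (-⟦⟧ o x′)))))))
      (≤-by (ℤP.≤-trans (abs-step-≤ (opposite o) (x′ + ⟦ opposite o ⟧)) (ℤP.≤-reflexive (cong (_+ 1ℤ) (abs-down o x′ 1≤′))))
        (solve 2 (λ a b → ((a :- con 1ℤ) :+ con 1ℤ) :- b := a :- b) refl (abs x′) (abs ((x′ + ⟦ opposite o ⟧) + ⟦ opposite o ⟧))))

  Even : ℤ → Set
  Even z = ∃ λ e → z ≡ e + e

  -- Sign changes and absolute values preserve parity, so the parity of a total cost does not depend
  -- on the chosen kinds.
  cost-parity : ∀ κ x → ∃ λ e → cost κ x ≡ x + (e + e)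
  cost-parity abs′ (+ n)     = 0ℤ , sym (ℤP.+-identityʳ (+ n))
  cost-parity abs′ -[1+ n ]  = + suc n , solve 1 (λ a → a := (:- a) :+ (a :+ a)) refl (+ suc n)
  cost-parity (lin S.+) x    = 0ℤ , sym (ℤP.+-identityʳ x)
  cost-parity (lin S.-) x    = - x , solve 1 (λ a → :- a := a :+ ((:- a) :+ (:- a))) refl x

  even-gap : ∀ {a b} → Even a → Even b → a ≤ b → ¬ (b ≤ a) → a + + 2 ≤ b
  even-gap {a} {b} (e , refl) (f , refl) a≤b b≰a with (1ℤ + e) ℤP.≤? f
  ... | yes e<f = ≤-by (ℤP.+-mono-≤ e<f e<f)
          (solve 2 (λ e f → (f :+ f) :- ((con 1ℤ :+ e) :+ (con 1ℤ :+ e)) := (f :+ f) :- ((e :+ e) :+ con (+ 2))) refl e f)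
  ... | no  e≮f = ⊥-elim (b≰a (ℤP.+-mono-≤ f≤e f≤e))
    where
    f≤e : f ≤ e
    f≤e = ℤP.≮⇒≥ (λ e<f → e≮f (ℤP.i<j⇒suc[i]≤j e<f))

-- Jump systems and their optimal members.

module Jump where

  open import Data.Nat as ℕ using (ℕ)
  open import Data.Fin using (Fin; _≟_)
  open import Data.Sign as S using (Sign; opposite)
  open import Data.Integer using (ℤ; +_; 0ℤ; 1ℤ; _+_; _-_; _*_; -_; _≤_; +≤+)
  import Data.Integer.Properties as ℤP
  open import Data.Integer.Solver using (module +-*-Solver)
  open +-*-Solver using (solve; con; _:+_; _:*_; _:-_; :-_; _:=_)
  open import Data.Product using (∃; _×_; _,_; proj₁; proj₂)
  open import Data.Sum using (_⊎_; inj₁; inj₂)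
  open import Data.Empty using (⊥; ⊥-elim)
  open import Function using (_∘_)
  open import Relation.Nullary using (Dec; yes; no)
  open import Relation.Binary.PropositionalEquality
  open Sums
  open Costs

  -- The simultaneous exchange axiom of constant-parity jump systems: the two members make the same
  -- two unit steps in opposite directions. `toward` is measured after the first step, hence the
  -- term with `δ u z`, which matters when `z` is `u`.
  record Exchange {n} {J : Set} (x : J → Fin n → ℤ) (F F′ : J) (u : Fin n) (s : Sign) : Set where
    field
      F₁ F₁′ : J
      z      : Fin n
      t      : Sign
      x₁     : ∀ v → x F₁ v ≡ x F v + (δ u v * ⟦ s ⟧ + δ z v * ⟦ t ⟧)
      x₁′    : ∀ v → x F₁′ v ≡ x F′ v - (δ u v * ⟦ s ⟧ + δ z v * ⟦ t ⟧)
      toward : 1ℤ ≤ sg t (x F′ z - x F z - δ u z * ⟦ s ⟧)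

  -- The two shapes of an exchange. If `z` is `u`, then `toward` and the gap at `u` force the second
  -- step to have the sign of the first, and `u` moves by 2.
  data Swap {n} {J : Set} (x : J → Fin n → ℤ) (F F′ : J) (u : Fin n) (s : Sign) (F₁ F₁′ : J) : Set where
    far : ∀ z t → u ≢ z →
      (∀ v → v ≢ u → v ≢ z → x F₁ v ≡ x F v × x F₁′ v ≡ x F′ v) →
      x F₁ u ≡ x F u + ⟦ s ⟧ → x F₁′ u ≡ x F′ u - ⟦ s ⟧ →
      x F₁ z ≡ x F z + ⟦ t ⟧ → x F₁′ z ≡ x F′ z - ⟦ t ⟧ →
      1ℤ ≤ sg t (x F′ z - x F z) → Swap x F F′ u s F₁ F₁′
    near : (∀ v → v ≢ u → x F₁ v ≡ x F v × x F₁′ v ≡ x F′ v) →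
      x F₁ u ≡ x F u + sg s (+ 2) → x F₁′ u ≡ x F′ u - sg s (+ 2) →
      + 2 ≤ sg s (x F′ u - x F u) → Swap x F F′ u s F₁ F₁′

  swap : ∀ {n} {J : Set} {x : J → Fin n → ℤ} {F F′ u s} → 1ℤ ≤ sg s (x F′ u - x F u) →
    (e : Exchange x F F′ u s) → Swap x F F′ u s (Exchange.F₁ e) (Exchange.F₁′ e)
  swap {n} {J} {x} {F} {F′} {u} {s} 1≤ e = go (u ≟ z)
    where
    open Exchange e
    at₁ : ∀ v {a b} → δ u v ≡ a → δ z v ≡ b → x F₁ v ≡ x F v + (a * ⟦ s ⟧ + b * ⟦ t ⟧)
    at₁ v refl refl = x₁ v
    at₁′ : ∀ v {a b} → δ u v ≡ a → δ z v ≡ b → x F₁′ v ≡ x F′ v - (a * ⟦ s ⟧ + b * ⟦ t ⟧)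
    at₁′ v refl refl = x₁′ v
    00+ : ∀ c a b → c + (0ℤ * a + 0ℤ * b) ≡ c
    00+ = solve 3 (λ c a b → c :+ (con 0ℤ :* a :+ con 0ℤ :* b) := c) refl
    10+ : ∀ c a b → c + (1ℤ * a + 0ℤ * b) ≡ c + a
    10+ = solve 3 (λ c a b → c :+ (con 1ℤ :* a :+ con 0ℤ :* b) := c :+ a) refl
    01+ : ∀ c a b → c + (0ℤ * a + 1ℤ * b) ≡ c + b
    01+ = solve 3 (λ c a b → c :+ (con 0ℤ :* a :+ con 1ℤ :* b) := c :+ b) refl
    11+ : ∀ c a b → c + (1ℤ * a + 1ℤ * b) ≡ c + (a + b)
    11+ = solve 3 (λ c a b → c :+ (con 1ℤ :* a :+ con 1ℤ :* b) := c :+ (a :+ b)) refl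
    00- : ∀ c a b → c - (0ℤ * a + 0ℤ * b) ≡ c
    00- = solve 3 (λ c a b → c :- (con 0ℤ :* a :+ con 0ℤ :* b) := c) refl
    10- : ∀ c a b → c - (1ℤ * a + 0ℤ * b) ≡ c - a
    10- = solve 3 (λ c a b → c :- (con 1ℤ :* a :+ con 0ℤ :* b) := c :- a) refl
    01- : ∀ c a b → c - (0ℤ * a + 1ℤ * b) ≡ c - b
    01- = solve 3 (λ c a b → c :- (con 0ℤ :* a :+ con 1ℤ :* b) := c :- b) refl
    11- : ∀ c a b → c - (1ℤ * a + 1ℤ * b) ≡ c - (a + b)
    11- = solve 3 (λ c a b → c :- (con 1ℤ :* a :+ con 1ℤ :* b) := c :- (a :+ b)) refl
    double : ∀ s → ⟦ s ⟧ + ⟦ s ⟧ ≡ sg s (+ 2)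
    double S.+ = refl
    double S.- = refl
    unit : ∀ s → ⟦ s ⟧ - 1ℤ * ⟦ s ⟧ ≡ 0ℤ
    unit S.+ = refl
    unit S.- = refl
    go : _ → Swap x F F′ u s F₁ F₁′
    go (no u≢z) = far z t u≢z
      (λ v v≢u v≢z → trans (at₁ v (δ-≢ (v≢u ∘ sym)) (δ-≢ (v≢z ∘ sym))) (00+ (x F v) ⟦ s ⟧ ⟦ t ⟧)
                   , trans (at₁′ v (δ-≢ (v≢u ∘ sym)) (δ-≢ (v≢z ∘ sym))) (00- (x F′ v) ⟦ s ⟧ ⟦ t ⟧))
      (trans (at₁ u (δ-refl u) (δ-≢ (u≢z ∘ sym))) (10+ (x F u) ⟦ s ⟧ ⟦ t ⟧))
      (trans (at₁′ u (δ-refl u) (δ-≢ (u≢z ∘ sym))) (10- (x F′ u) ⟦ s ⟧ ⟦ t ⟧))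
      (trans (at₁ z (δ-≢ u≢z) (δ-refl z)) (01+ (x F z) ⟦ s ⟧ ⟦ t ⟧))
      (trans (at₁′ z (δ-≢ u≢z) (δ-refl z)) (01- (x F′ z) ⟦ s ⟧ ⟦ t ⟧))
      (subst (1ℤ ≤_) (cong (sg t) (trans (cong (λ d → x F′ z - x F z - d * ⟦ s ⟧) (δ-≢ u≢z))
        (solve 2 (λ a c → a :- con 0ℤ :* c := a) refl (x F′ z - x F z) ⟦ s ⟧))) toward)
    go (yes refl) = near
      (λ v v≢u → trans (at₁ v (δ-≢ (v≢u ∘ sym)) (δ-≢ (v≢u ∘ sym))) (00+ (x F v) ⟦ s ⟧ ⟦ t ⟧)
               , trans (at₁′ v (δ-≢ (v≢u ∘ sym)) (δ-≢ (v≢u ∘ sym))) (00- (x F′ v) ⟦ s ⟧ ⟦ t ⟧))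
      (trans (at₁ u (δ-refl u) (δ-refl u)) (trans (11+ (x F u) ⟦ s ⟧ ⟦ t ⟧) (cong (_+_ (x F u)) two)))
      (trans (at₁′ u (δ-refl u) (δ-refl u)) (trans (11- (x F′ u) ⟦ s ⟧ ⟦ t ⟧) (cong (λ c → x F′ u - c) two)))
      2≤
      where
      D = x F′ u - x F u
      tow : 1ℤ ≤ sg t (D - 1ℤ * ⟦ s ⟧)
      tow = subst (λ d → 1ℤ ≤ sg t (D - d * ⟦ s ⟧)) (δ-refl u) toward
      rest : ∀ s D → sg s (D - 1ℤ * ⟦ s ⟧) ≡ sg s D - 1ℤ
      rest S.+ D = refl
      rest S.- D = solve 1 (λ d → :- (d :- con (- 1ℤ)) := (:- d) :- con 1ℤ) refl D
      t≡s : t ≡ s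
      t≡s = decide (t S.≟ s)
        where
        decide : _ → t ≡ s
        decide (yes p) = p
        decide (no  p) = ⊥-elim (1≰0 (≤-by (ℤP.+-mono-≤ 1≤ (subst (1ℤ ≤_)
          (trans (cong (λ t → sg t (D - 1ℤ * ⟦ s ⟧)) (opposite-≢ s t p))
            (trans (sg-opp s (D - 1ℤ * ⟦ s ⟧)) (cong -_ (rest s D)))) tow))
          (solve 1 (λ d → (d :+ (:- (d :- con 1ℤ))) :- (con 1ℤ :+ con 1ℤ) := con 0ℤ :- con 1ℤ) refl (sg s D))))
      two : ⟦ s ⟧ + ⟦ t ⟧ ≡ sg s (+ 2)
      two = trans (cong (λ t → ⟦ s ⟧ + ⟦ t ⟧) t≡s) (double s)
      2≤ : + 2 ≤ sg s D
      2≤ = ≤-by (subst (1ℤ ≤_) (trans (cong (λ t → sg t (D - 1ℤ * ⟦ s ⟧)) t≡s) (rest s D)) tow)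
             (solve 1 (λ d → (d :- con 1ℤ) :- con 1ℤ := d :- con (+ 2)) refl (sg s D))

  module System {n : ℕ} {J : Set} (x : J → Fin n → ℤ)
    (exch : ∀ F F′ u s → 1ℤ ≤ sg s (x F′ u - x F u) → Exchange x F F′ u s) where

    exchange : ∀ F F′ u s → 1ℤ ≤ sg s (x F′ u - x F u) → ∃ λ F₁ → ∃ λ F₁′ → Swap x F F′ u s F₁ F₁′
    exchange F F′ u s 1≤ = _ , _ , swap 1≤ (exch F F′ u s 1≤)

    Φ : (Fin n → Kind) → J → ℤ
    Φ κ F = sum (λ v → cost (κ v) (x F v))

    pair : (κ : Fin n → Kind) (F F′ : J) → Fin n → ℤ
    pair κ F F′ v = cost (κ v) (x F v) + cost (κ v) (x F′ v)

    ∑-pair : ∀ κ F F′ → sum (pair κ F F′) ≡ Φ κ F + Φ κ F′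
    ∑-pair κ F F′ = ∑-distrib-+ (λ v → cost (κ v) (x F v)) (λ v → cost (κ v) (x F′ v))

    conv : ∀ κ s {y y′} a {y₁ y₁′} → 0ℤ ≤ a → a ≤ sg s (y′ - y) → y₁ ≡ y + sg s a → y₁′ ≡ y′ - sg s a →
      cost κ y₁ + cost κ y₁′ ≤ cost κ y + cost κ y′
    conv κ s a 0≤a a≤ refl refl = cost-conv κ s _ _ a 0≤a a≤

    module _ {F F′ : J} {u : Fin n} {s : Sign} {F₁ F₁′ : J} (κ : Fin n → Kind) where

      pair-≤ : Swap x F F′ u s F₁ F₁′ → ∀ v → v ≢ u → pair κ F₁ F₁′ v ≤ pair κ F F′ v
      pair-≤ (far z t _ same _ _ z₁ z₁′ tow) v v≢u with v ≟ z
      ... | yes refl = conv (κ v) t 1ℤ 0≤1 tow z₁ z₁′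
      ... | no  v≢z  = ℤP.≤-reflexive (cong₂ _+_ (cong (cost (κ v)) (proj₁ (same v v≢u v≢z)))
                                                (cong (cost (κ v)) (proj₂ (same v v≢u v≢z))))
      pair-≤ (near same _ _ _) v v≢u = ℤP.≤-reflexive (cong₂ _+_ (cong (cost (κ v)) (proj₁ (same v v≢u)))
                                                                (cong (cost (κ v)) (proj₂ (same v v≢u))))

      swap-total : Swap x F F′ u s F₁ F₁′ → (Φ κ F₁ + Φ κ F₁′) + pair κ F F′ u ≤ (Φ κ F + Φ κ F′) + pair κ F₁ F₁′ u
      swap-total w = subst₂ (λ a b → a + pair κ F F′ u ≤ b + pair κ F₁ F₁′ u) (∑-pair κ F₁ F₁′) (∑-pair κ F F′)
        (∑-mono-except u (pair-≤ w))

      -- At `u` and at `z` the members approach each other and convexity applies; elsewhere nothing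
      -- changes.
      swap-conv : 1ℤ ≤ sg s (x F′ u - x F u) → Swap x F F′ u s F₁ F₁′ → Φ κ F₁ + Φ κ F₁′ ≤ Φ κ F + Φ κ F′
      swap-conv 1≤ w = ≤-by (ℤP.+-mono-≤ (swap-total w) (at-u w))
        (solve 4 (λ a b c d → ((b :+ d) :+ c) :- ((a :+ c) :+ d) := b :- a) refl
          (Φ κ F₁ + Φ κ F₁′) (Φ κ F + Φ κ F′) (pair κ F F′ u) (pair κ F₁ F₁′ u))
        where
        at-u : Swap x F F′ u s F₁ F₁′ → pair κ F₁ F₁′ u ≤ pair κ F F′ u
        at-u (far _ _ _ _ u₁ u₁′ _ _ _) = conv (κ u) s 1ℤ 0≤1 1≤ u₁ u₁′
        at-u (near _ u₁ u₁′ 2≤)         = conv (κ u) s (+ 2) (+≤+ ℕ.z≤n) 2≤ u₁ u₁′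

    module _ {F F′ : J} {u : Fin n} {s : Sign} {F₁ F₁′ : J} (κ : Fin n → Kind) (κu : κ u ≡ abs′)
      (w : Swap x F F′ u (opposite s) F₁ F₁′) (1≤′ : 1ℤ ≤ sg (opposite s) (x F′ u)) where

      total-gain : pair κ F₁ F₁′ u + + 2 ≤ pair κ F F′ u → (Φ κ F₁ + Φ κ F₁′) + + 2 ≤ Φ κ F + Φ κ F′
      total-gain at-u = ≤-by (ℤP.+-mono-≤ (swap-total κ w) at-u)
        (solve 4 (λ a b c d → ((b :+ d) :+ c) :- ((a :+ c) :+ (d :+ con (+ 2))) := b :- (a :+ con (+ 2))) refl
          (Φ κ F₁ + Φ κ F₁′) (Φ κ F + Φ κ F′) (pair κ F F′ u) (pair κ F₁ F₁′ u))

      -- The members are defective at `u` with opposite signs. If the second step goes elsewhere,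
      -- both defects at `u` shrink by 1; the exception is the double step, which leaves the first
      -- member unchanged outside `u`.
      gain-or-flip : 1ℤ ≤ sg s (x F u) → (Φ κ F₁ + Φ κ F₁′) + + 2 ≤ Φ κ F + Φ κ F′
        ⊎ ((∀ v → v ≢ u → x F₁ v ≡ x F v) × x F₁ u ≡ x F u + sg (opposite s) (+ 2))
      gain-or-flip 1≤ = go w
        where
        go : Swap x F F′ u (opposite s) F₁ F₁′ → _
        go (far _ _ _ _ u₁ u₁′ _ _ _) = inj₁ (total-gain at-u)
          where
          at-u : pair κ F₁ F₁′ u + + 2 ≤ pair κ F F′ u
          at-u rewrite κu | u₁ | u₁′ = ℤP.≤-reflexive (abs-gain s (x F u) (x F′ u) 1≤ 1≤′)
        go (near same u₁ _ _) = inj₂ ((λ v v≢u → proj₁ (same v v≢u)) , u₁)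

      -- From a defect of 2 the double step saves 2 as well.
      gain : + 2 ≤ sg s (x F u) → (Φ κ F₁ + Φ κ F₁′) + + 2 ≤ Φ κ F + Φ κ F′
      gain 2≤ = total-gain (go w)
        where
        go : Swap x F F′ u (opposite s) F₁ F₁′ → pair κ F₁ F₁′ u + + 2 ≤ pair κ F F′ u
        go (far _ _ _ _ u₁ u₁′ _ _ _) rewrite κu | u₁ | u₁′ =
          ℤP.≤-reflexive (abs-gain s (x F u) (x F′ u) (ℤP.≤-trans (+≤+ (ℕ.s≤s ℕ.z≤n)) 2≤) 1≤′)
        go (near _ u₁ u₁′ _) rewrite κu | u₁ | u₁′ = abs-gain₂ s (x F u) (x F′ u) 2≤ 1≤′

    record Toggle (F : J) (u v : Fin n) (s : Sign) : Set where
      field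
        F₁  : J
        u≢v : u ≢ v
        at-u : x F₁ u ≡ x F u + ⟦ s ⟧
        at-v : x F₁ v ≡ x F v + ⟦ s ⟧
        rest : ∀ w → w ≢ u → w ≢ v → x F₁ w ≡ x F w

      reverse : Toggle F v u s
      reverse = record { F₁ = F₁ ; u≢v = u≢v ∘ sym ; at-u = at-v ; at-v = at-u ; rest = λ w w≢v w≢u → rest w w≢u w≢v }

      -- Two single-term updates, with `mid` as the family after the first.
      toggle-sum : ∀ (c : Fin n → ℤ → ℤ) → sum (λ w → c w (x F₁ w)) + (c u (x F u) + c v (x F v))
                        ≡ sum (λ w → c w (x F w)) + (c u (x F u + ⟦ s ⟧) + c v (x F v + ⟦ s ⟧))
      toggle-sum c = trans (solve 3 (λ a b c → a :+ (b :+ c) := (a :+ c) :+ b) refl (sum new) (old u) (old v))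
        (trans (cong (_+ old u) step₂)
          (trans (solve 3 (λ a b c → (a :+ b) :+ c := (a :+ c) :+ b) refl (sum mid) (new v) (old u))
            (trans (cong (_+ new v) step₁)
              (trans (solve 3 (λ a b c → (a :+ b) :+ c := a :+ (b :+ c)) refl (sum old) (new u) (new v))
                (cong (_+_ (sum old)) (cong₂ _+_ (cong (c u) at-u) (cong (c v) at-v)))))))
        where
        old new mid : Fin n → ℤ
        old w = c w (x F w)
        new w = c w (x F₁ w)
        mid w with w ≟ u
        ... | yes _ = new u
        ... | no  _ = old w
        mid-u : mid u ≡ new u
        mid-u with u ≟ u
        ... | yes _   = refl
        ... | no  u≢u = ⊥-elim (u≢u refl)
        mid-≢ : ∀ w → w ≢ u → mid w ≡ old w
        mid-≢ w w≢u with w ≟ u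
        ... | yes w≡u = ⊥-elim (w≢u w≡u)
        ... | no  _   = refl
        step₁ : sum mid + old u ≡ sum old + new u
        step₁ = trans (∑-update u mid-≢) (cong (_+_ (sum old)) mid-u)
        step₂ : sum new + old v ≡ sum mid + new v
        step₂ = trans (cong (_+_ (sum new)) (sym (mid-≢ v (u≢v ∘ sym)))) (∑-update v λ w w≢v → only w w≢v)
          where
          only : ∀ w → w ≢ v → new w ≡ mid w
          only w w≢v with w ≟ u
          ... | yes refl = refl
          ... | no  w≢u  = cong (c w) (rest w w≢u w≢v)

      toggle-cost : ∀ κ → Φ κ F₁ + (cost (κ u) (x F u) + cost (κ v) (x F v))
                        ≡ Φ κ F + (cost (κ u) (x F u + ⟦ s ⟧) + cost (κ v) (x F v + ⟦ s ⟧))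
      toggle-cost κ = toggle-sum (λ w → cost (κ w))

    module Optimal (κ : Fin n → Kind) (m : ℤ) (minimal : ∀ F → m ≤ Φ κ F) where

      Opt : J → Set
      Opt F = Φ κ F ≤ m

      Has : Sign → Fin n → Set
      Has s v = ∃ λ F → Opt F × 1ℤ ≤ sg s (x F v)

      both-opt : ∀ {F F′} → Φ κ F + Φ κ F′ ≤ m + m → Opt F × Opt F′
      both-opt {F} {F′} total =
          ≤-by (ℤP.+-mono-≤ total (minimal F′)) (solve 3 (λ a b m → ((m :+ m) :+ b) :- ((a :+ b) :+ m) := m :- a) refl (Φ κ F) (Φ κ F′) m)
        , ≤-by (ℤP.+-mono-≤ total (minimal F)) (solve 3 (λ a b m → ((m :+ m) :+ a) :- ((a :+ b) :+ m) := m :- b) refl (Φ κ F) (Φ κ F′) m)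

      no-gain : ∀ {F F′ F₁ F₁′} → Opt F → Opt F′ → (Φ κ F₁ + Φ κ F₁′) + + 2 ≤ Φ κ F + Φ κ F′ → ⊥
      no-gain {F} {F′} {F₁} {F₁′} o o′ g = 1≰0 (≤-by (ℤP.+-mono-≤ (ℤP.+-mono-≤ (ℤP.+-mono-≤ o o′) (ℤP.+-mono-≤ (minimal F₁) (minimal F₁′))) (ℤP.+-mono-≤ g 0≤1))
        (solve 5 (λ a b c d m → (((m :+ m) :+ (c :+ d)) :+ ((a :+ b) :+ con 1ℤ)) :- (((a :+ b) :+ (m :+ m)) :+ (((c :+ d) :+ con (+ 2)) :+ con 0ℤ)) := con 0ℤ :- con 1ℤ)
          refl (Φ κ F) (Φ κ F′) (Φ κ F₁) (Φ κ F₁′) m))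

      separated : ∀ s {a b} → 1ℤ ≤ sg s a → 1ℤ ≤ sg (opposite s) b → + 2 ≤ sg (opposite s) (b - a)
      separated s {a} {b} 1≤ 1≤′ = ≤-by (ℤP.+-mono-≤ 1≤ 1≤′)
        (trans (cong (λ c → (sg s a + c) - (1ℤ + 1ℤ)) (sg-opp s b))
          (trans (go s) (cong (_- + 2) (sym (sg-opp s (b - a))))))
        where
        go : ∀ s → (sg s a + - sg s b) - (1ℤ + 1ℤ) ≡ - sg s (b - a) - + 2
        go S.+ = solve 2 (λ a b → (a :+ (:- b)) :- con (+ 2) := (:- (b :- a)) :- con (+ 2)) refl a b
        go S.- = solve 2 (λ a b → ((:- a) :+ (:- (:- b))) :- con (+ 2) := (:- (:- (b :- a))) :- con (+ 2)) refl a b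

      1≤separated : ∀ s {a b} → 1ℤ ≤ sg s a → 1ℤ ≤ sg (opposite s) b → 1ℤ ≤ sg (opposite s) (b - a)
      1≤separated s 1≤ 1≤′ = ℤP.≤-trans (+≤+ (ℕ.s≤s ℕ.z≤n)) (separated s 1≤ 1≤′)

      -- An optimal member with the opposite defect exists by `has`; if the defect at `u` were 2 or
      -- more, exchanging with it would save 2.
      defect≤1 : ∀ {u} → κ u ≡ abs′ → (∀ s → Has s u) → ∀ {F} → Opt F → ∀ s → 1ℤ ≤ sg s (x F u) → sg s (x F u) ≤ 1ℤ
      defect≤1 {u} κu has {F} oF s 1≤ with sg s (x F u) ℤP.≤? 1ℤ
      ... | yes ≤1 = ≤1
      ... | no  ≰1 with F′ , oF′ , 1≤′ ← has (opposite s)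
                   with F₁ , F₁′ , w ← exchange F F′ u (opposite s) (1≤separated s 1≤ 1≤′) =
        ⊥-elim (no-gain {F} {F′} {F₁} {F₁′} oF oF′ (gain κ κu w 1≤′ (ℤP.i<j⇒suc[i]≤j (ℤP.≰⇒> ≰1))))

      -- Optimality excludes the gain in `gain-or-flip`, so the exchange with an oppositely
      -- defective optimum is the double step at `u`. As the defect there is exactly 1, its sign is
      -- reversed.
      flip : ∀ {u} → κ u ≡ abs′ → (∀ s → Has s u) → ∀ {F} → Opt F → ∀ s → 1ℤ ≤ sg s (x F u) →
        ∃ λ F₁ → Opt F₁ × 1ℤ ≤ sg (opposite s) (x F₁ u) × (∀ v → v ≢ u → x F₁ v ≡ x F v)
      flip {u} κu has {F} oF s 1≤ with F′ , oF′ , 1≤′ ← has (opposite s)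
        with F₁ , F₁′ , w ← exchange F F′ u (opposite s) (1≤separated s 1≤ 1≤′)
        with gain-or-flip κ κu w 1≤′ 1≤
      ... | inj₁ g = ⊥-elim (no-gain {F} {F′} {F₁} {F₁′} oF oF′ g)
      ... | inj₂ (same , u₁) = F₁ ,
          proj₁ (both-opt {F₁} {F₁′} (ℤP.≤-trans (swap-conv κ (1≤separated s 1≤ 1≤′) w) (ℤP.+-mono-≤ oF oF′))) ,
          flipped s (x F u) (x F₁ u) u₁ (defect≤1 κu has oF s 1≤) , same
        where
        flipped : ∀ s a b → b ≡ a + sg (opposite s) (+ 2) → sg s a ≤ 1ℤ → 1ℤ ≤ sg (opposite s) b
        flipped S.+ a _ refl ≤1 = ≤-by ≤1 (solve 1 (λ a → con 1ℤ :- a := (:- (a :+ con (- + 2))) :- con 1ℤ) refl a)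
        flipped S.- a _ refl ≤1 = ≤-by ≤1 (solve 1 (λ a → con 1ℤ :- (:- a) := (a :+ con (+ 2)) :- con 1ℤ) refl a)

      -- On vertices that are defective with both signs R is an equivalence; its classes are the blocks.
      R : Fin n → Fin n → Set
      R u v = ∀ F → Opt F → x F u ≢ 0ℤ → x F v ≢ 0ℤ → u ≡ v

      R-sym : ∀ {u v} → R u v → R v u
      R-sym r F o v≢0 u≢0 = sym (r F o u≢0 v≢0)

      -- Gallai's argument. Let `F` be defective at `u` and `v`, and let an optimal `F′` be
      -- defective at `w`; then `F` vanishes at `w` and `F′` at `u`. Exchange at `u`: if the second
      -- step misses `w`, `F₁′` is defective at `u` and `w`; if it hits `w`, `F₁` is defective at
      -- `w` and `v`.
      R-trans : ∀ {u w v} → κ u ≡ abs′ → (∀ s → Has s u) → (∀ s → Has s w) → R u w → R w v → R u v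
      R-trans {u} {w} {v} κu has-u has-w ruw rwv F oF u≢0 v≢0 with u ≟ v | u ≟ w | w ≟ v
      ... | yes p | _ | _ = p
      ... | no _  | yes refl | _ = rwv F oF u≢0 v≢0
      ... | no _  | no _ | yes refl = ruw F oF u≢0 v≢0
      ... | no u≢v | no u≢w | no w≢v
        with s , 1≤ ← signed (x F u) u≢0
        with F′ , oF′ , 1≤w ← has-w S.+ = ⊥-elim (go w′)
        where
        w≢0 : x F′ w ≢ 0ℤ
        w≢0 = signed-≢0 S.+ 1≤w
        zero-at : ∀ {G a b} → Opt G → a ≢ b → R a b → x G b ≢ 0ℤ → x G a ≡ 0ℤ
        zero-at {G} {a} oG a≢b r b≢0 with x G a ℤP.≟ 0ℤ
        ... | yes p = p
        ... | no  p = ⊥-elim (a≢b (r G oG p b≢0))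
        u′≡0 : x F′ u ≡ 0ℤ
        u′≡0 = zero-at oF′ u≢w ruw w≢0
        w≡0 : x F w ≡ 0ℤ
        w≡0 = zero-at oF w≢v rwv v≢0
        o = opposite s
        difference : sg o (x F′ u - x F u) ≡ sg s (x F u)
        difference = trans (cong (λ c → sg o (c - x F u)) u′≡0) (trans (sg-opp s _) (go s))
          where
          go : ∀ s → - sg s (0ℤ - x F u) ≡ sg s (x F u)
          go S.+ = solve 1 (λ a → :- (con 0ℤ :- a) := a) refl (x F u)
          go S.- = solve 1 (λ a → :- (:- (con 0ℤ :- a)) := :- a) refl (x F u)
        1≤d : 1ℤ ≤ sg o (x F′ u - x F u)
        1≤d = subst (1ℤ ≤_) (sym difference) 1≤
        ex : ∃ λ F₁ → ∃ λ F₁′ → Swap x F F′ u o F₁ F₁′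
        ex = exchange F F′ u o 1≤d
        F₁ = proj₁ ex
        F₁′ = proj₁ (proj₂ ex)
        w′ : Swap x F F′ u o F₁ F₁′
        w′ = proj₂ (proj₂ ex)
        opts : Opt F₁ × Opt F₁′
        opts = both-opt {F₁} {F₁′} (ℤP.≤-trans (swap-conv κ 1≤d w′) (ℤP.+-mono-≤ oF oF′))
        go : Swap x F F′ u o F₁ F₁′ → ⊥
        -- A double step needs a gap of 2 at `u`, but the gap equals the defect of `F` there, which
        -- is at most 1.
        go (near _ _ _ 2≤) = 1≰0 (≤-by (ℤP.≤-trans (subst (+ 2 ≤_) difference 2≤) (defect≤1 κu has-u oF s 1≤)) refl)
        go (far z t u≢z same u₁ u₁′ z₁ z₁′ _) with w ≟ z
        ... | no w≢z = u≢w (ruw F₁′ (proj₂ opts) u′≢0 (subst (_≢ 0ℤ) (sym (proj₂ (same w (u≢w ∘ sym) w≢z))) w≢0))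
          where
          u′≢0 : x F₁′ u ≢ 0ℤ
          u′≢0 eq = ⟦⟧≢0 (opposite o) (trans (sym (trans (trans u₁′ (trans (cong (_- ⟦ o ⟧) u′≡0) (-⟦⟧ o 0ℤ))) (ℤP.+-identityˡ _))) eq)
        ... | yes refl = w≢v (rwv F₁ (proj₁ opts) w₁≢0 (subst (_≢ 0ℤ) (sym (proj₁ (same v (u≢v ∘ sym) (w≢v ∘ sym)))) v≢0))
          where
          w₁≢0 : x F₁ w ≢ 0ℤ
          w₁≢0 eq = ⟦⟧≢0 t (trans (sym (trans (trans z₁ (cong (_+ ⟦ t ⟧) w≡0)) (ℤP.+-identityˡ _))) eq)

      module Adjacent {u v : Fin n} (toggle : ∀ F → ∃ λ s → Toggle F u v s) where

        -- A toggle of the edge shifts both ends with the same sign. If it repairs one of them,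
        -- `repair` applies. If it worsens both, the defect at `u` is flipped first; the two defects
        -- then have different signs, and any toggle repairs one end.
        R-adjacent : κ u ≡ abs′ → κ v ≡ abs′ → (∀ s → Has s u) → (∀ s → Has s v) → R u v
        R-adjacent κu κv has-u has-v F oF u≢0 v≢0 = ⊥-elim contra
          where
          -- Toggling uv repairs u; then v is either repaired as well or pushed to a defect of 2.
          repair : ∀ {a b} → κ a ≡ abs′ → κ b ≡ abs′ → (∀ s → Has s b) → ∀ {F s} → Opt F → Toggle F a b s →
            1ℤ ≤ sg (opposite s) (x F a) → x F b ≢ 0ℤ → ⊥
          repair {a} {b} κa κb has-b {F} {s} oF tg 1≤a b≢0 = split (signed (x F b) b≢0)
            where
            open Toggle tg
            tc : Φ κ F₁ + (abs (x F a) + abs (x F b)) ≡ Φ κ F + (abs (x F a + ⟦ s ⟧) + abs (x F b + ⟦ s ⟧))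
            tc = subst₂ (λ ka kb → Φ κ F₁ + (cost ka (x F a) + cost kb (x F b))
                   ≡ Φ κ F + (cost ka (x F a + ⟦ s ⟧) + cost kb (x F b + ⟦ s ⟧))) κa κb (toggle-cost κ)
            a-down : abs (x F a + ⟦ s ⟧) ≡ abs (x F a) - 1ℤ
            a-down = trans (cong (λ s → abs (x F a + ⟦ s ⟧)) (sym (opposite-opposite s))) (abs-down (opposite s) (x F a) 1≤a)
            oF₁ : Opt F₁
            oF₁ = ≤-by (ℤP.+-mono-≤ (ℤP.+-mono-≤ oF (ℤP.≤-reflexive tc)) (ℤP.+-mono-≤ (ℤP.≤-reflexive a-down) (abs-step-≤ s (x F b))))
              (solve 7 (λ f₁ f a b a′ b′ m → ((m :+ (f :+ (a′ :+ b′))) :+ ((a :- con 1ℤ) :+ (b :+ con 1ℤ))) :- ((f :+ (f₁ :+ (a :+ b))) :+ (a′ :+ b′)) := m :- f₁)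
                refl (Φ κ F₁) (Φ κ F) (abs (x F a)) (abs (x F b)) (abs (x F a + ⟦ s ⟧)) (abs (x F b + ⟦ s ⟧)) m)
            split : (∃ λ t → 1ℤ ≤ sg t (x F b)) → ⊥
            split (t , 1≤b) with t S.≟ s
            ... | yes refl = 1≰0 (≤-by (ℤP.+-mono-≤ 1≤b (defect≤1 κb has-b oF₁ s 1≤b₁))
                    (trans (cong (λ c → (sg s (x F b) + 1ℤ) - (1ℤ + c)) b₁)
                      (solve 1 (λ b → (b :+ con 1ℤ) :- (con 1ℤ :+ (b :+ con 1ℤ)) := con 0ℤ :- con 1ℤ) refl (sg s (x F b)))))
              where
              b₁ : sg s (x F₁ b) ≡ sg s (x F b) + 1ℤ
              b₁ = trans (cong (sg s) at-v) (sg-up s (x F b))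
              1≤b₁ : 1ℤ ≤ sg s (x F₁ b)
              1≤b₁ = subst (1ℤ ≤_) (sym b₁) (ℤP.≤-trans 1≤b (ℤP.i≤i+j (sg s (x F b)) 1ℤ))
            ... | no t≢s = 1≰0 (≤-by (ℤP.+-mono-≤ (ℤP.+-mono-≤ oF (ℤP.≤-reflexive tc)) (ℤP.+-mono-≤ (ℤP.+-mono-≤ (ℤP.≤-reflexive a-down) (ℤP.≤-reflexive b-down)) (ℤP.+-mono-≤ (minimal F₁) 0≤1)))
              (solve 7 (λ f₁ f a b a′ b′ m → ((m :+ (f :+ (a′ :+ b′))) :+ (((a :- con 1ℤ) :+ (b :- con 1ℤ)) :+ (f₁ :+ con 1ℤ)))
                         :- ((f :+ (f₁ :+ (a :+ b))) :+ ((a′ :+ b′) :+ (m :+ con 0ℤ))) := con 0ℤ :- con 1ℤ)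
                refl (Φ κ F₁) (Φ κ F) (abs (x F a)) (abs (x F b)) (abs (x F a + ⟦ s ⟧)) (abs (x F b + ⟦ s ⟧)) m))
              where
              b-down : abs (x F b + ⟦ s ⟧) ≡ abs (x F b) - 1ℤ
              b-down = trans (cong (λ s → abs (x F b + ⟦ s ⟧)) (trans (sym (opposite-opposite s)) (cong opposite (sym (opposite-≢ s t t≢s)))))
                (abs-down t (x F b) 1≤b)
          contra : ⊥
          contra with p , 1≤u ← signed (x F u) u≢0 | q , 1≤v ← signed (x F v) v≢0 | s , tg ← toggle F with p S.≟ s | q S.≟ s
          ... | no p≢s | _ = repair κu κv has-v oF tg (subst (λ p → 1ℤ ≤ sg p (x F u)) (opposite-≢ s p p≢s) 1≤u) v≢0
          ... | yes _ | no q≢s = repair κv κu has-u oF (Toggle.reverse tg) (subst (λ p → 1ℤ ≤ sg p (x F v)) (opposite-≢ s q q≢s) 1≤v) u≢0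
          ... | yes refl | yes refl with F̃ , oF̃ , 1≤ũ , same ← flip κu has-u oF s 1≤u with s′ , tg′ ← toggle F̃ with s′ S.≟ s
          ...   | yes refl = repair κu κv has-v oF̃ tg′ 1≤ũ (subst (_≢ 0ℤ) (sym (same v (Toggle.u≢v tg ∘ sym))) v≢0)
          ...   | no s′≢s = repair κv κu has-u oF̃ (Toggle.reverse tg′)
                  (subst₂ (λ p y → 1ℤ ≤ sg p y) (trans (sym (opposite-opposite s)) (cong opposite (sym (opposite-≢ s s′ s′≢s)))) (sym (same v (Toggle.u≢v tg ∘ sym))) 1≤v)
                  (signed-≢0 (opposite s) 1≤ũ)

        -- Toggling the edge makes `v` defective. When it also repairs `u`, the result is optimal
        -- and contradicts `never`; when it worsens `u`, one more exchange is needed.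
        not-adjacent : κ u ≡ abs′ → κ v ≡ abs′ → (∀ s → Has s u) → (∀ F → Opt F → x F v ≡ 0ℤ) → ⊥
        not-adjacent κu κv has-u never with F , oF , 1≤u ← has-u S.+ with s , tg ← toggle F = go s tg (s S.≟ S.+)
          where
          module _ (s : Sign) (tg : Toggle F u v s) where
            open Toggle tg
            tc : Φ κ F₁ + (abs (x F u) + abs (x F v)) ≡ Φ κ F + (abs (x F u + ⟦ s ⟧) + abs (x F v + ⟦ s ⟧))
            tc = subst₂ (λ ka kb → Φ κ F₁ + (cost ka (x F u) + cost kb (x F v))
                   ≡ Φ κ F + (cost ka (x F u + ⟦ s ⟧) + cost kb (x F v + ⟦ s ⟧))) κu κv (toggle-cost κ)
            v₁ : x F₁ v ≡ ⟦ s ⟧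
            v₁ = trans at-v (trans (cong (_+ ⟦ s ⟧) (never F oF)) (ℤP.+-identityˡ ⟦ s ⟧))
            v₁≢0 : x F₁ v ≢ 0ℤ
            v₁≢0 eq = ⟦⟧≢0 s (trans (sym v₁) eq)
            go : Dec (s ≡ S.+) → ⊥
            go (no s≢+) = v₁≢0 (never F₁ oF₁)
              where
              u-down : abs (x F u + ⟦ s ⟧) ≡ abs (x F u) - 1ℤ
              u-down = trans (cong (λ s → abs (x F u + ⟦ s ⟧)) (opposite-≢ S.+ s s≢+)) (abs-down S.+ (x F u) 1≤u)
              oF₁ : Opt F₁
              oF₁ = ≤-by (ℤP.+-mono-≤ (ℤP.+-mono-≤ oF (ℤP.≤-reflexive tc)) (ℤP.+-mono-≤ (ℤP.≤-reflexive u-down) (abs-step-≤ s (x F v))))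
                (solve 7 (λ f₁ f a b a′ b′ m → ((m :+ (f :+ (a′ :+ b′))) :+ ((a :- con 1ℤ) :+ (b :+ con 1ℤ))) :- ((f :+ (f₁ :+ (a :+ b))) :+ (a′ :+ b′)) := m :- f₁)
                  refl (Φ κ F₁) (Φ κ F) (abs (x F u)) (abs (x F v)) (abs (x F u + ⟦ s ⟧)) (abs (x F v + ⟦ s ⟧)) m)
            -- The toggled member costs 2 more but has defect 2 at u; exchanging it with a
            -- flipped optimum regains that cost, and one of the results is still defective at v.
            go (yes refl) with F̃ , oF̃ , 1≤ũ , _ ← flip κu has-u oF S.+ 1≤u = after w
              where
              u₁ : + 2 ≤ x F₁ u
              u₁ = ≤-by 1≤u (trans (solve 1 (λ a → a :- con 1ℤ := (a :+ con 1ℤ) :- con (+ 2)) refl (x F u)) (cong (_- + 2) (sym at-u)))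
              1≤u₁ : 1ℤ ≤ x F₁ u
              1≤u₁ = ℤP.≤-trans (+≤+ (ℕ.s≤s ℕ.z≤n)) u₁
              cost₁ : Φ κ F₁ ≤ m + + 2
              cost₁ = ≤-by (ℤP.+-mono-≤ (ℤP.+-mono-≤ oF (ℤP.≤-reflexive tc)) (ℤP.+-mono-≤ (abs-step-≤ S.+ (x F u)) (abs-step-≤ S.+ (x F v))))
                (solve 7 (λ f₁ f a b a′ b′ m → ((m :+ (f :+ (a′ :+ b′))) :+ ((a :+ con 1ℤ) :+ (b :+ con 1ℤ))) :- ((f :+ (f₁ :+ (a :+ b))) :+ (a′ :+ b′)) := (m :+ con (+ 2)) :- f₁)
                  refl (Φ κ F₁) (Φ κ F) (abs (x F u)) (abs (x F v)) (abs (x F u + 1ℤ)) (abs (x F v + 1ℤ)) m)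
              ex : ∃ λ H → ∃ λ H′ → Swap x F₁ F̃ u S.- H H′
              ex = exchange F₁ F̃ u S.- (1≤separated S.+ 1≤u₁ 1≤ũ)
              H = proj₁ ex
              H′ = proj₁ (proj₂ ex)
              w : Swap x F₁ F̃ u S.- H H′
              w = proj₂ (proj₂ ex)
              opts : Opt H × Opt H′
              opts = both-opt {H} {H′} (≤-by (ℤP.+-mono-≤ (gain {s = S.+} κ κu w 1≤ũ u₁) (ℤP.+-mono-≤ cost₁ oF̃))
                (solve 4 (λ h f f̃ m → ((f :+ f̃) :+ ((m :+ con (+ 2)) :+ m)) :- ((h :+ con (+ 2)) :+ (f :+ f̃)) := (m :+ m) :- h)
                  refl (Φ κ H + Φ κ H′) (Φ κ F₁) (Φ κ F̃) m))
              after : Swap x F₁ F̃ u S.- H H′ → ⊥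
              after (near same _ _ _) = v₁≢0 (trans (sym (proj₁ (same v (u≢v ∘ sym)))) (never H (proj₁ opts)))
              after (far z t _ same _ _ _ z₁′ _) with v ≟ z
              ... | no v≢z = v₁≢0 (trans (sym (proj₁ (same v (u≢v ∘ sym) v≢z))) (never H (proj₁ opts)))
              ... | yes refl = ⟦⟧≢0 (opposite t) (trans (sym (trans (trans z₁′ (trans (cong (_- ⟦ t ⟧) (never F̃ oF̃)) (-⟦⟧ t 0ℤ))) (ℤP.+-identityˡ _))) (never H′ (proj₂ opts)))

-- Replacing absolute values by linear costs.

module Linearisation where

  open import Data.Bool using (Bool; true; false)
  open import Data.Nat as ℕ using (ℕ; zero; suc)
  open import Data.Fin using (Fin; zero; suc; _≟_)
  open import Data.Fin.Properties using (∀-cons)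
  open import Data.Sign as S using (Sign; opposite)
  open import Data.Integer using (ℤ; +_; 0ℤ; 1ℤ; _+_; _-_; -_; _≤_; +≤+; -≤+)
  import Data.Integer.Properties as ℤP
  open import Data.Integer.Solver using (module +-*-Solver)
  open +-*-Solver using (solve; con; _:+_; _:*_; _:-_; :-_; _:=_)
  open import Data.Product using (Σ; ∃; _×_; _,_; proj₁; proj₂)
  open import Data.Sum using (_⊎_; inj₁; inj₂)
  open import Data.Empty using (⊥; ⊥-elim)
  open import Function using (_∘_)
  open import Relation.Nullary using (¬_; Dec; yes; no)
  open import Relation.Binary.PropositionalEquality
  open Sums
  open Costs
  open Jump

  -- Double negation commutes with finite products. This permits an undecided case distinction at
  -- all vertices at once.
  ¬¬-Π : ∀ {n} {P : Fin n → Set} → (∀ i → ¬ ¬ P i) → ¬ ¬ (∀ i → P i)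
  ¬¬-Π {zero}      h k = k λ ()
  ¬¬-Π {suc n} {P} h k = h zero λ p₀ → ¬¬-Π (h ∘ suc) λ ps → k (∀-cons {P = P} p₀ ps)

  -- Each strictly smaller value comes closer to the lower bound `b`, so the distance to `b` serves
  -- as fuel.
  minimise : ∀ {A : Set} (f : A → ℤ) b → (∀ a → b ≤ f a) → A → ¬ ¬ (∃ λ a → ∀ a′ → f a ≤ f a′)
  minimise {A} f b bounded a₀ k = go _ a₀ (ℤP.≤-reflexive (trans (solve 2 (λ a b → a := b :+ (a :- b)) refl (f a₀) b)
      (cong (_+_ b) (sym (ℤP.0≤i⇒+∣i∣≡i (ℤP.i≤j⇒0≤j-i (bounded a₀)))))))
    where
    go : ∀ j a → f a ≤ b + + j → ⊥
    go j a fa≤ = k (a , λ a′ → decide a′ (f a ℤP.≤? f a′))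
      where
      next : ∀ j a′ → f a ≤ b + + j → 1ℤ + f a′ ≤ f a → ⊥
      next zero    a′ fa≤ lt = 1≰0 (≤-by (ℤP.+-mono-≤ (ℤP.+-mono-≤ fa≤ lt) (bounded a′))
        (solve 3 (λ a a′ b → (((b :+ con 0ℤ) :+ a) :+ a′) :- ((a :+ (con 1ℤ :+ a′)) :+ b) := con 0ℤ :- con 1ℤ) refl (f a) (f a′) b))
      next (suc j) a′ fa≤ lt = go j a′ (≤-by (ℤP.+-mono-≤ fa≤ lt)
        (solve 4 (λ a a′ b j → ((b :+ (con 1ℤ :+ j)) :+ a) :- (a :+ (con 1ℤ :+ a′)) := (b :+ j) :- a′) refl (f a) (f a′) b (+ j)))
      decide : ∀ a′ → Dec (f a ≤ f a′) → f a ≤ f a′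
      decide a′ (yes p) = p
      decide a′ (no  p) = ⊥-elim (next j a′ fa≤ (ℤP.i<j⇒suc[i]≤j (ℤP.≰⇒> p)))

  is-abs : Kind → Bool
  is-abs abs′    = true
  is-abs (lin _) = false

  module Settle {n : ℕ} {J : Set} (x : J → Fin n → ℤ)
    (exch : ∀ F F′ u s → 1ℤ ≤ sg s (x F′ u - x F u) → Exchange x F F′ u s)
    (even : ∀ κ F → Even (System.Φ x exch κ F)) where

    open System x exch

    _[_]≔_ : (Fin n → Kind) → Fin n → Kind → Fin n → Kind
    (κ [ v ]≔ k) w with w ≟ v
    ... | yes _ = k
    ... | no  _ = κ w

    updated : ∀ κ v k → (κ [ v ]≔ k) v ≡ k
    updated κ v k with v ≟ v
    ... | yes _   = refl
    ... | no  v≢v = ⊥-elim (v≢v refl)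

    unchanged : ∀ κ v k {w} → w ≢ v → (κ [ v ]≔ k) w ≡ κ w
    unchanged κ v k {w} w≢v with w ≟ v
    ... | yes w≡v = ⊥-elim (w≢v w≡v)
    ... | no  _   = refl

    module _ (κ : Fin n → Kind) (m : ℤ) (minimal : ∀ F → m ≤ Φ κ F) (even-m : Even m)
      {v : Fin n} (κv : κ v ≡ abs′) (s : Sign) where
      open Optimal κ m minimal

      κ′ : Fin n → Kind
      κ′ = κ [ v ]≔ lin (opposite s)

      Φ-update : ∀ F → Φ κ′ F + abs (x F v) ≡ Φ κ F + sg (opposite s) (x F v)
      Φ-update F = subst₂ (λ k k′ → Φ κ′ F + cost k (x F v) ≡ Φ κ F + cost k′ (x F v)) κv (updated κ v (lin (opposite s)))
        (∑-update {p = λ w → cost (κ′ w) (x F w)} {q = λ w → cost (κ w) (x F w)} v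
          (λ w w≢v → cong (λ k → cost k (x F w)) (unchanged κ v (lin (opposite s)) w≢v)))

      Φ-same : ∀ F → sg s (x F v) ≤ 0ℤ → Φ κ′ F ≡ Φ κ F
      Φ-same F ≤0 = trans (solve 2 (λ a b → a := (a :+ b) :- b) refl (Φ κ′ F) (abs (x F v)))
        (trans (cong (_- abs (x F v)) (trans (Φ-update F) (cong (_+_ (Φ κ F)) (sym (abs-sg (opposite s) (x F v)
            (subst (0ℤ ≤_) (sym (sg-opp s (x F v))) (ℤP.neg-mono-≤ ≤0)))))))
          (solve 2 (λ a b → (a :+ b) :- b := a) refl (Φ κ F) (abs (x F v))))

      opposed : ∀ {y} → 1ℤ ≤ sg (opposite s) y → sg s y ≤ - 1ℤ
      opposed {y} 1≤ = ≤-by (subst (1ℤ ≤_) (sg-opp s y) 1≤) (solve 1 (λ a → (:- a) :- con 1ℤ := con (- 1ℤ) :- a) refl (sg s y))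

      -- The two costs agree unless the defect has sign `s`. At defect 1 of that sign the new cost
      -- is smaller by 2, but `F` is then not optimal and, by parity, costs at least `m + 2`. Larger
      -- defects are reduced to this by induction.
      linearise : Has (opposite s) v → ¬ Has s v → ∀ F → m ≤ Φ κ′ F
      linearise (F₀ , oF₀ , 1≤₀) never F = high _ F (sg≤abs s (x F v))
        where
        x₀≤-1 : sg s (x F₀ v) ≤ - 1ℤ
        x₀≤-1 = opposed 1≤₀
        low : ∀ F → sg s (x F v) ≤ 1ℤ → m ≤ Φ κ′ F
        low F ≤1 with 1ℤ ℤP.≤? sg s (x F v)
        ... | no 1≰ = ℤP.≤-trans (minimal F) (ℤP.≤-reflexive (sym (Φ-same F
                (≤-by (ℤP.i<j⇒suc[i]≤j (ℤP.≰⇒> 1≰)) (solve 1 (λ a → con 1ℤ :- (con 1ℤ :+ a) := con 0ℤ :- a) refl (sg s (x F v)))))))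
        ... | yes 1≤ = ≤-by (ℤP.+-mono-≤ (ℤP.+-mono-≤ (even-gap even-m (even κ F) (minimal F) (λ o → never (F , o , 1≤)))
                  (ℤP.≤-reflexive (sym (Φ-update F)))) (ℤP.+-mono-≤ ≤1 ≤1))
                (trans (cong₂ (λ a b → (Φ κ F + (Φ κ′ F + a) + (1ℤ + 1ℤ)) - (m + + 2 + (Φ κ F + b) + (sg s (x F v) + sg s (x F v))))
                    (abs-sg s (x F v) (ℤP.≤-trans 0≤1 1≤)) (sg-opp s (x F v)))
                  (solve 4 (λ f f′ p m → ((f :+ (f′ :+ p)) :+ (con 1ℤ :+ con 1ℤ)) :- (((m :+ con (+ 2)) :+ (f :+ (:- p))) :+ (p :+ p)) := f′ :- m)
                    refl (Φ κ F) (Φ κ′ F) (sg s (x F v)) m))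
        -- Exchanging with F₀ moves a large defect of F down while staying below the kink in F₀.
        high : ∀ j F → sg s (x F v) ≤ + j → m ≤ Φ κ′ F
        high zero    F ≤j = low F (ℤP.≤-trans ≤j 0≤1)
        high (suc j) F ≤j with sg s (x F v) ℤP.≤? 1ℤ
        ... | yes ≤1 = low F ≤1
        ... | no  ≰1 = step (exchange F₀ F v s 1≤d)
          where
          sg-minus : ∀ s a b → sg s (a - b) ≡ sg s a - sg s b
          sg-minus S.+ a b = refl
          sg-minus S.- a b = solve 2 (λ a b → :- (a :- b) := (:- a) :- (:- b)) refl a b
          2≤ : + 2 ≤ sg s (x F v)
          2≤ = ℤP.i<j⇒suc[i]≤j (ℤP.≰⇒> ≰1)
          1≤d : 1ℤ ≤ sg s (x F v - x F₀ v)
          1≤d = subst (1ℤ ≤_) (sym (sg-minus s (x F v) (x F₀ v))) (≤-by (ℤP.+-mono-≤ (ℤP.+-mono-≤ 2≤ x₀≤-1) (-≤+ {1} {0}))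
             (solve 2 (λ a b → ((a :+ (con (- 1ℤ))) :+ con 0ℤ) :- ((con (+ 2) :+ b) :+ con (- + 2)) := (a :- b) :- con 1ℤ) refl (sg s (x F v)) (sg s (x F₀ v))))
          step : (∃ λ F₁ → ∃ λ F₁′ → Swap x F₀ F v s F₁ F₁′) → m ≤ Φ κ′ F
          step (F₁ , F₁′ , w) = ≤-by (ℤP.+-mono-≤ (ℤP.+-mono-≤ (swap-conv κ′ 1≤d w) cost₀) (ℤP.+-mono-≤ (proj₁ (bounds w)) (proj₂ (bounds w))))
              (solve 5 (λ a b c d m → (((c :+ d) :+ m) :+ (a :+ b)) :- (((a :+ b) :+ c) :+ (m :+ m)) := d :- m)
                refl (Φ κ′ F₁) (Φ κ′ F₁′) (Φ κ′ F₀) (Φ κ′ F) m)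
            where
            cost₀ : Φ κ′ F₀ ≤ m
            cost₀ = ℤP.≤-trans (ℤP.≤-reflexive (Φ-same F₀ (ℤP.≤-trans x₀≤-1 -≤+))) oF₀
            sg-unit : ∀ s a → sg s (sg s a) ≡ a
            sg-unit S.+ a = refl
            sg-unit S.- a = ℤP.neg-involutive a
            F₁-bound : ∀ a → a ≤ + 2 → x F₁ v ≡ x F₀ v + sg s a → sg s (x F₁ v) ≤ 1ℤ
            F₁-bound a a≤2 e = ≤-by (ℤP.+-mono-≤ a≤2 x₀≤-1) (trans (solve 2 (λ a p → (con (+ 2) :+ con (- 1ℤ)) :- (a :+ p) := con 1ℤ :- (p :+ a)) refl a (sg s (x F₀ v)))
              (cong (λ z → 1ℤ - z) (sym (trans (cong (sg s) e) (trans (sg-+ s _ _) (cong (_+_ (sg s (x F₀ v))) (sg-unit s a)))))))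
            F₁′-bound : ∀ a → 1ℤ ≤ a → x F₁′ v ≡ x F v - sg s a → sg s (x F₁′ v) ≤ + j
            F₁′-bound a 1≤a e = ≤-by (ℤP.+-mono-≤ ≤j 1≤a) (trans (solve 3 (λ j p a → ((con 1ℤ :+ j) :+ a) :- (p :+ con 1ℤ) := j :- (p :- a)) refl (+ j) (sg s (x F v)) a)
              (cong (λ z → + j - z) (sym (trans (cong (sg s) e) (trans (sg-minus s _ _) (cong (λ z → sg s (x F v) - z) (sg-unit s a)))))))
            bounds : Swap x F₀ F v s F₁ F₁′ → m ≤ Φ κ′ F₁ × m ≤ Φ κ′ F₁′
            bounds (far _ _ _ _ u₁ u₁′ _ _ _) = low F₁ (F₁-bound 1ℤ (+≤+ (ℕ.s≤s ℕ.z≤n)) u₁) , high j F₁′ (F₁′-bound 1ℤ ℤP.≤-refl u₁′)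
            bounds (near _ u₁ u₁′ _) = low F₁ (F₁-bound (+ 2) ℤP.≤-refl u₁) , high j F₁′ (F₁′-bound (+ 2) (+≤+ (ℕ.s≤s ℕ.z≤n)) u₁′)

    Settled : (κ : Fin n → Kind) (m : ℤ) → (∀ F → m ≤ Φ κ F) → Set
    Settled κ m minimal = ∀ v → κ v ≡ abs′ → (∀ s → Has s v) ⊎ (∀ F → Opt F → x F v ≡ 0ℤ)
      where open Optimal κ m minimal

    -- Each linearisation removes one vertex of kind `abs′`, which bounds the number of rounds. The
    -- optimum witnessing the sign that does occur has the same cost for the new kinds, so the
    -- minimum stays attained.
    settle : ∀ m → Even m → (κ : Fin n → Kind) → (∀ F → m ≤ Φ κ F) → (∃ λ F → Φ κ F ≤ m) →
      ¬ ¬ (∃ λ κ → Σ (∀ F → m ≤ Φ κ F) λ minimal → (∃ λ F → Φ κ F ≤ m) × Settled κ m minimal)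
    settle m even-m κ minimal attained k = go n κ minimal attained (ℤP.≤-trans
        (∑-bounded (λ v → ⟨ is-abs (κ v) ⟩) 1ℤ (λ v → ⟨⟩≤1 (is-abs (κ v)))) (ℤP.≤-reflexive (ℤP.*-identityʳ (+ n))))
      where
      go : ∀ fuel κ (minimal : ∀ F → m ≤ Φ κ F) → (∃ λ F → Φ κ F ≤ m) → sum (λ v → ⟨ is-abs (κ v) ⟩) ≤ + fuel → ⊥
      go fuel κ minimal attained count = ¬¬-Π classify λ settled → k (κ , minimal , attained , settled)
        where
        open Optimal κ m minimal
        next : ∀ fuel v → κ v ≡ abs′ → ∀ s → Has (opposite s) v → ¬ Has s v → sum (λ v → ⟨ is-abs (κ v) ⟩) ≤ + fuel → ⊥
        next fuel v κv s has never count = recurse fuel count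
          where
          κ″ = κ [ v ]≔ lin (opposite s)
          fewer : sum (λ v → ⟨ is-abs (κ″ v) ⟩) + 1ℤ ≡ sum (λ v → ⟨ is-abs (κ v) ⟩) + 0ℤ
          fewer = subst₂ (λ a b → sum (λ v → ⟨ is-abs (κ″ v) ⟩) + ⟨ is-abs a ⟩ ≡ sum (λ v → ⟨ is-abs (κ v) ⟩) + ⟨ is-abs b ⟩)
            κv (updated κ v (lin (opposite s)))
            (∑-update {p = λ w → ⟨ is-abs (κ″ w) ⟩} {q = λ w → ⟨ is-abs (κ w) ⟩} v
              (λ w w≢v → cong (λ k → ⟨ is-abs k ⟩) (unchanged κ v (lin (opposite s)) w≢v)))
          recurse : ∀ fuel → sum (λ v → ⟨ is-abs (κ v) ⟩) ≤ + fuel → ⊥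
          recurse zero count = 1≰0 (ℤP.≤-trans (ℤP.≤-trans (ℤP.≤-reflexive (cong (λ k → ⟨ is-abs k ⟩) (sym κv)))
            (term≤∑ {f = λ v → ⟨ is-abs (κ v) ⟩} (λ v → ⟨⟩-nonneg (is-abs (κ v))) v)) count)
          recurse (suc fuel) count = go fuel κ″ (linearise κ m minimal even-m κv s has never)
            (proj₁ has , ℤP.≤-trans (ℤP.≤-reflexive (Φ-same κ m minimal even-m κv s (proj₁ has)
              (ℤP.≤-trans (opposed κ m minimal even-m κv s (proj₂ (proj₂ has))) -≤+))) (proj₁ (proj₂ has)))
            (≤-by (ℤP.+-mono-≤ count (ℤP.≤-reflexive fewer))
              (solve 3 (λ a b f → ((con 1ℤ :+ f) :+ (a :+ con 0ℤ)) :- (a :+ (b :+ con 1ℤ)) := f :- b) refl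
                (sum (λ v → ⟨ is-abs (κ v) ⟩)) (sum (λ v → ⟨ is-abs (κ″ v) ⟩)) (+ fuel)))
        classify : ∀ v → ¬ ¬ (κ v ≡ abs′ → (∀ s → Has s v) ⊎ (∀ F → Opt F → x F v ≡ 0ℤ))
        classify v np = by-kind (κ v) refl
          where
          by-kind : ∀ c → κ v ≡ c → ⊥
          by-kind (lin t) e = np λ e′ → impossible (trans (sym e) e′)
            where
            impossible : ∀ {A : Set} → lin t ≡ abs′ → A
            impossible ()
          by-kind abs′ κv = no-both no-plus
            where
            no-both : ¬ ¬ Has S.+ v
            no-both no+ = no-minus no+ λ no- → np λ _ → inj₂ λ F oF → zero-defect no+ no- F oF (x F v ℤP.≟ 0ℤ)
              where
              zero-defect : ¬ Has S.+ v → ¬ Has S.- v → ∀ F → Opt F → Dec (x F v ≡ 0ℤ) → x F v ≡ 0ℤ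
              zero-defect no+ no- F oF (yes p) = p
              zero-defect no+ no- F oF (no p) with signed (x F v) p
              ... | S.+ , 1≤ = ⊥-elim (no+ (F , oF , 1≤))
              ... | S.- , 1≤ = ⊥-elim (no- (F , oF , 1≤))
              no-minus : ¬ Has S.+ v → ¬ ¬ (¬ Has S.- v)
              no-minus no+ h = h λ has- → next fuel v κv S.+ has- no+ count
            no-plus : ¬ Has S.+ v
            no-plus has+ = with-minus λ has- → np λ _ → inj₁ λ { S.+ → has+ ; S.- → has- }
              where
              with-minus : ¬ ¬ Has S.- v
              with-minus no- = next fuel v κv S.- has+ no- count

-- Subgraphs of a graph: exchange by alternating walks.

module Subgraphs where

  open import Defs using (Graph; adj; loopless) renaming (sym to adj-sym)
  open import Data.Bool using (Bool; true; false; not; _xor_; if_then_else_; _∧_; _∨_)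
  import Data.Bool.Properties as BP
  open import Data.Nat as ℕ using (ℕ; zero; suc)
  open import Data.Fin using (Fin; zero; suc; _≟_)
  open import Data.Sign as S using (Sign; opposite)
  open import Data.Integer using (ℤ; +_; 0ℤ; 1ℤ; _+_; _-_; _*_; -_; _≤_; +≤+)
  import Data.Integer.Properties as ℤP
  open import Data.Integer.Solver using (module +-*-Solver)
  open +-*-Solver using (solve; con; _:+_; _:*_; _:-_; :-_; _:=_)
  open import Data.Product using (∃; _×_; _,_; proj₁; proj₂)
  open import Data.Sum using (_⊎_; inj₁; inj₂)
  open import Data.Empty using (⊥-elim)
  open import Function using (_∘_)
  open import Relation.Nullary using (Dec; yes; no)
  open import Relation.Nullary.Decidable using (⌊_⌋)
  open import Relation.Binary.PropositionalEquality
  open Sums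
  open Costs
  open Jump
  open Linearisation

  -- Handshake lemma: by symmetry the first row and the first column have equal sums, and what
  -- remains is a smaller matrix of the same form.
  ∑∑-even : ∀ {n} (M : Fin n → Fin n → Bool) → (∀ u v → M u v ≡ M v u) → (∀ v → M v v ≡ false) →
    Even (sum (λ u → sum (λ v → ⟨ M u v ⟩)))
  ∑∑-even {zero}  M _ _ = 0ℤ , refl
  ∑∑-even {suc n} M M-sym M-irr with e , eq ← ∑∑-even (λ u v → M (suc u) (suc v)) (λ u v → M-sym (suc u) (suc v)) (λ v → M-irr (suc v)) =
    r + e , trans (cong₂ _+_ (cong (λ b → ⟨ b ⟩ + r) (M-irr zero))
        (trans (∑-distrib-+ (λ u → ⟨ M (suc u) zero ⟩) (λ u → sum (λ v → ⟨ M (suc u) (suc v) ⟩)))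
          (cong₂ _+_ (sum-cong-≗ (λ u → cong ⟨_⟩ (M-sym (suc u) zero))) eq)))
      (solve 2 (λ r e → (con 0ℤ :+ r) :+ (r :+ (e :+ e)) := (r :+ e) :+ (r :+ e)) refl r e)
    where
    r : ℤ
    r = sum (λ v → ⟨ M zero (suc v) ⟩)

  sg-∑ : ∀ s {n} (f : Fin n → ℤ) → sum (λ i → sg s (f i)) ≡ sg s (sum f)
  sg-∑ S.+ f = refl
  sg-∑ S.- f = ∑-neg f

  module InGraph {n : ℕ} (G : Graph n) where

    record Sub : Set where
      field
        mat  : Fin n → Fin n → Bool
        msym : ∀ u v → mat u v ≡ mat v u
        m⊆G  : ∀ u v → mat u v ≡ true → adj G u v ≡ true
    open Sub public

    empty : Sub
    empty = record { mat = λ _ _ → false ; msym = λ _ _ → refl ; m⊆G = λ _ _ () }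

    irreflexive : ∀ F v → mat F v v ≡ false
    irreflexive F v with mat F v v in e
    ... | false = refl
    ... | true  = trans (sym (m⊆G F v v e)) (loopless G v)

    deg : Sub → Fin n → ℤ
    deg F v = sum (λ w → ⟨ mat F v w ⟩)

    -- Equality of undirected edges: `v w` is `u y` in one of the two orders.
    hit : Fin n → Fin n → Fin n → Fin n → Bool
    hit u y v w = (⌊ u ≟ v ⌋ ∧ ⌊ y ≟ w ⌋) ∨ (⌊ y ≟ v ⌋ ∧ ⌊ u ≟ w ⌋)

    hit-sym : ∀ u y v w → hit u y v w ≡ hit u y w v
    hit-sym u y v w = trans (BP.∨-comm (⌊ u ≟ v ⌋ ∧ ⌊ y ≟ w ⌋) _)
      (cong₂ _∨_ (BP.∧-comm ⌊ y ≟ v ⌋ _) (BP.∧-comm ⌊ u ≟ v ⌋ _))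

    hit-sound : ∀ u y v w → hit u y v w ≡ true → (u ≡ v × y ≡ w) ⊎ (y ≡ v × u ≡ w)
    hit-sound u y v w e with u ≟ v | y ≟ w | y ≟ v | u ≟ w
    ... | yes p | yes q | _ | _ = inj₁ (p , q)
    ... | yes _ | no _ | yes p | yes q = inj₂ (p , q)
    hit-sound u y v w () | yes _ | no _ | yes _ | no _
    hit-sound u y v w () | yes _ | no _ | no _ | _
    ... | no _ | _ | yes p | yes q = inj₂ (p , q)
    hit-sound u y v w () | no _ | _ | yes _ | no _
    hit-sound u y v w () | no _ | _ | no _ | _

    hit-⟨⟩ : ∀ {u y} → u ≢ y → ∀ v w → ⟨ hit u y v w ⟩ ≡ δ y w * δ u v + δ u w * δ y v
    hit-⟨⟩ {u} {y} u≢y v w with u ≟ v | y ≟ w | y ≟ v | u ≟ w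
    ... | yes refl | _ | yes refl | _ = ⊥-elim (u≢y refl)
    ... | yes _ | yes _ | no _ | yes _ = refl
    ... | yes _ | yes _ | no _ | no _ = refl
    ... | yes _ | no _ | no _ | yes _ = refl
    ... | yes _ | no _ | no _ | no _ = refl
    ... | no _ | yes refl | yes _ | yes refl = ⊥-elim (u≢y refl)
    ... | no _ | yes _ | yes _ | no _ = refl
    ... | no _ | no _ | yes _ | yes _ = refl
    ... | no _ | no _ | yes _ | no _ = refl
    ... | no _ | yes _ | no _ | yes _ = refl
    ... | no _ | yes _ | no _ | no _ = refl
    ... | no _ | no _ | no _ | yes _ = refl
    ... | no _ | no _ | no _ | no _ = refl

    ∑-hit : ∀ {u y} → u ≢ y → ∀ v → sum (λ w → ⟨ hit u y v w ⟩) ≡ δ u v + δ y v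
    ∑-hit {u} {y} u≢y v = trans (sum-cong-≗ (hit-⟨⟩ u≢y v))
      (trans (∑-distrib-+ (λ w → δ y w * δ u v) (λ w → δ u w * δ y v)) (cong₂ _+_ (∑-δ-scaled y (δ u v)) (∑-δ-scaled u (δ y v))))

    module Patch (F : Sub) (u y : Fin n) (b : Bool) (b⊆G : b ≡ true → adj G u y ≡ true) where

      matₚ : Fin n → Fin n → Bool
      matₚ v w = if hit u y v w then b else mat F v w

      patch : Sub
      patch = record
        { mat  = matₚ
        ; msym = λ v w → trans (cong (if hit u y v w then b else_) (msym F v w)) (cong (if_then b else mat F w v) (hit-sym u y v w))
        ; m⊆G  = inside }
        where
        inside : ∀ v w → matₚ v w ≡ true → adj G v w ≡ true
        inside v w e with hit u y v w in h
        ... | false = m⊆G F v w e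
        ... | true with hit-sound u y v w h
        ...   | inj₁ (refl , refl) = b⊆G e
        ...   | inj₂ (refl , refl) = trans (adj-sym G y u) (b⊆G e)

      patch-entry : ∀ v w → ⟨ matₚ v w ⟩ ≡ ⟨ mat F v w ⟩ + ⟨ hit u y v w ⟩ * (⟨ b ⟩ - ⟨ mat F u y ⟩)
      patch-entry v w with hit u y v w in h
      ... | false = sym (trans (cong (_+_ ⟨ mat F v w ⟩) (ℤP.*-zeroˡ (⟨ b ⟩ - ⟨ mat F u y ⟩))) (ℤP.+-identityʳ _))
      ... | true = trans (solve 2 (λ b a → b := a :+ con 1ℤ :* (b :- a)) refl ⟨ b ⟩ ⟨ mat F u y ⟩)
                     (cong (λ c → ⟨ c ⟩ + 1ℤ * (⟨ b ⟩ - ⟨ mat F u y ⟩)) (entry (hit-sound u y v w h)))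
        where
        entry : (u ≡ v × y ≡ w) ⊎ (y ≡ v × u ≡ w) → mat F u y ≡ mat F v w
        entry (inj₁ (refl , refl)) = refl
        entry (inj₂ (refl , refl)) = msym F u y

      deg-patch : u ≢ y → ∀ {c} → ⟨ b ⟩ - ⟨ mat F u y ⟩ ≡ c → ∀ v → deg patch v ≡ deg F v + (δ u v + δ y v) * c
      deg-patch u≢y refl v = trans (sum-cong-≗ (patch-entry v))
        (trans (∑-distrib-+ (λ w → ⟨ mat F v w ⟩) (λ w → ⟨ hit u y v w ⟩ * c))
          (cong (_+_ (deg F v)) (trans (sym (*-distribʳ-sum c (λ w → ⟨ hit u y v w ⟩))) (cong (_* c) (∑-hit u≢y v)))))
        where
        c : ℤ
        c = ⟨ b ⟩ - ⟨ mat F u y ⟩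

    xor-entry : ∀ a b c → c ≡ a ⊎ c ≡ b → ⟨ (a xor b) xor c ⟩ ≡ (⟨ a ⟩ + ⟨ b ⟩) - ⟨ c ⟩
    xor-entry false false .false (inj₁ refl) = refl
    xor-entry false true  .false (inj₁ refl) = refl
    xor-entry true  false .true  (inj₁ refl) = refl
    xor-entry true  true  .true  (inj₁ refl) = refl
    xor-entry false false .false (inj₂ refl) = refl
    xor-entry false true  .true  (inj₂ refl) = refl
    xor-entry true  false .false (inj₂ refl) = refl
    xor-entry true  true  .true  (inj₂ refl) = refl

    xor-true : ∀ a b c → c ≡ a ⊎ c ≡ b → (a xor b) xor c ≡ true → a ≡ true ⊎ b ≡ true
    xor-true true  b     c _ _ = inj₁ refl
    xor-true false true  c _ _ = inj₂ refl
    xor-true false false .false (inj₁ refl) ()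
    xor-true false false .false (inj₂ refl) ()

    Between : Sub → Sub → Sub → Set
    Between F F′ F₁ = ∀ v w → mat F₁ v w ≡ mat F v w ⊎ mat F₁ v w ≡ mat F′ v w

    module _ (F F′ F₁ : Sub) (between : Between F F′ F₁) where

      -- The second half of an exchange comes for free: where `F₁` copies one of `F` and `F′`, this
      -- subgraph copies the other, so the degrees of the two add up to those of `F` and `F′`.
      co : Sub
      co = record
        { mat  = λ v w → (mat F v w xor mat F′ v w) xor mat F₁ v w
        ; msym = λ v w → cong₂ _xor_ (cong₂ _xor_ (msym F v w) (msym F′ v w)) (msym F₁ v w)
        ; m⊆G  = λ v w e → inside v w (xor-true (mat F v w) (mat F′ v w) (mat F₁ v w) (between v w) e) }
        where
        inside : ∀ v w → mat F v w ≡ true ⊎ mat F′ v w ≡ true → adj G v w ≡ true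
        inside v w (inj₁ e) = m⊆G F v w e
        inside v w (inj₂ e) = m⊆G F′ v w e

      deg-co : ∀ v → deg co v ≡ (deg F v + deg F′ v) - deg F₁ v
      deg-co v = trans (sum-cong-≗ (λ w → xor-entry (mat F v w) (mat F′ v w) (mat F₁ v w) (between v w)))
        (trans (∑-distrib-- (λ w → ⟨ mat F v w ⟩ + ⟨ mat F′ v w ⟩) (λ w → ⟨ mat F₁ v w ⟩))
          (cong (_- deg F₁ v) (∑-distrib-+ (λ w → ⟨ mat F v w ⟩) (λ w → ⟨ mat F′ v w ⟩))))

    -- Twice the number of edges in the symmetric difference; each step of the walk lowers it by 2,
    -- which makes it the fuel.
    distance : Sub → Sub → ℤ
    distance F F′ = sum (λ v → sum (λ w → ⟨ mat F v w xor mat F′ v w ⟩))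

    unit-step : ∀ s a b → 1ℤ ≤ sg s (⟨ b ⟩ - ⟨ a ⟩) → ⟨ b ⟩ - ⟨ a ⟩ ≡ ⟦ s ⟧ × a xor b ≡ true × (a ≡ true ⊎ b ≡ true)
    unit-step S.+ false true  _ = refl , refl , inj₂ refl
    unit-step S.- true  false _ = refl , refl , inj₁ refl
    unit-step S.+ false false (+≤+ ())
    unit-step S.+ true  true  (+≤+ ())
    unit-step S.- false false (+≤+ ())
    unit-step S.- true  true  (+≤+ ())

    record Half (F F′ : Sub) (u : Fin n) (s : Sign) : Set where
      field
        F₁      : Sub
        between : Between F F′ F₁
        z       : Fin n
        t       : Sign
        d₁      : ∀ v → deg F₁ v ≡ deg F v + (δ u v * ⟦ s ⟧ + δ z v * ⟦ t ⟧)
        toward  : 1ℤ ≤ sg t (deg F′ z - deg F z - δ u z * ⟦ s ⟧)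

    -- Walk along edges of F △ F′, alternately adding and deleting, until the walk can stop.
    half : ∀ fuel F F′ u s → distance F F′ ≤ + fuel → 1ℤ ≤ sg s (deg F′ u - deg F u) → Half F F′ u s
    half fuel F F′ u s dist 1≤ = from (∑-pos (λ w → sg s (⟨ mat F′ u w ⟩ - ⟨ mat F u w ⟩))
        (subst (1ℤ ≤_) (sym (trans (sg-∑ s (λ w → ⟨ mat F′ u w ⟩ - ⟨ mat F u w ⟩))
          (cong (sg s) (∑-distrib-- (λ w → ⟨ mat F′ u w ⟩) (λ w → ⟨ mat F u w ⟩))))) 1≤))
      where
      from : (∃ λ y → 1ℤ ≤ sg s (⟨ mat F′ u y ⟩ - ⟨ mat F u y ⟩)) → Half F F′ u s
      from (y , gap) = finish (1ℤ ℤP.≤? sg s (deg F′ y - deg F y - δ u y * ⟦ s ⟧))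
        where
        step = unit-step s (mat F u y) (mat F′ u y) gap
        c≡s = proj₁ step
        open Patch F u y (mat F′ u y) (m⊆G F′ u y)
        inside : mat F u y ≡ true ⊎ mat F′ u y ≡ true → adj G u y ≡ true
        inside (inj₁ e) = m⊆G F u y e
        inside (inj₂ e) = m⊆G F′ u y e
        u≢y : u ≢ y
        u≢y refl with () ← trans (sym (inside (proj₂ (proj₂ step)))) (loopless G u)
        d₊ : ∀ v → deg patch v ≡ deg F v + (δ u v + δ y v) * ⟦ s ⟧
        d₊ = deg-patch u≢y c≡s
        between₊ : Between F F′ patch
        between₊ v w with hit u y v w in h
        ... | false = inj₁ refl
        ... | true with hit-sound u y v w h
        ...   | inj₁ (refl , refl) = inj₂ refl
        ...   | inj₂ (refl , refl) = inj₂ (msym F′ u y)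
        closer : distance patch F′ + + 2 ≡ distance F F′
        closer = trans (cong (_+_ (distance patch F′)) (sym two))
            (trans (sym (∑-distrib-+ (λ v → sum (λ w → ⟨ matₚ v w xor mat F′ v w ⟩)) (λ v → sum (λ w → ⟨ hit u y v w ⟩))))
              (sum-cong-≗ (λ v → trans (sym (∑-distrib-+ (λ w → ⟨ matₚ v w xor mat F′ v w ⟩) (λ w → ⟨ hit u y v w ⟩)))
                (sum-cong-≗ (entry v)))))
          where
          two : sum (λ v → sum (λ w → ⟨ hit u y v w ⟩)) ≡ + 2
          two = trans (sum-cong-≗ (∑-hit u≢y)) (trans (∑-distrib-+ (δ u) (δ y)) (cong₂ _+_ (∑-δ u) (∑-δ y)))
          flipped : ∀ a b → a xor b ≡ true → ⟨ b xor b ⟩ + 1ℤ ≡ ⟨ a xor b ⟩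
          flipped false true  _ = refl
          flipped true  false _ = refl
          flipped false false ()
          flipped true  true  ()
          entry : ∀ v w → ⟨ matₚ v w xor mat F′ v w ⟩ + ⟨ hit u y v w ⟩ ≡ ⟨ mat F v w xor mat F′ v w ⟩
          entry v w with hit u y v w in h
          ... | false = ℤP.+-identityʳ _
          ... | true with hit-sound u y v w h
          ...   | inj₁ (refl , refl) = flipped (mat F u y) (mat F′ u y) (proj₁ (proj₂ step))
          ...   | inj₂ (refl , refl) = trans (cong (λ b → ⟨ mat F′ u y xor b ⟩ + 1ℤ) (msym F′ y u))
                  (trans (flipped (mat F u y) (mat F′ u y) (proj₁ (proj₂ step))) (cong₂ (λ a b → ⟨ a xor b ⟩) (msym F u y) (msym F′ u y)))
        -- If `F` lags behind `F′` at `y` in the direction `s`, the walk may end there. Otherwise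
        -- switching the edge leaves `y` off by at least 1 in the other direction, and the walk
        -- continues from `y` with the opposite sign.
        finish : Dec (1ℤ ≤ sg s (deg F′ y - deg F y - δ u y * ⟦ s ⟧)) → Half F F′ u s
        finish (yes stop) = record { F₁ = patch ; between = between₊ ; z = y ; t = s ; toward = stop
          ; d₁ = λ v → trans (d₊ v) (cong (_+_ (deg F v)) (ℤP.*-distribʳ-+ ⟦ s ⟧ (δ u v) (δ y v))) }
        finish (no go-on) = recurse fuel dist
          where
          continue : 1ℤ ≤ sg (opposite s) (deg F′ y - deg patch y)
          continue = subst (1ℤ ≤_) (sym (trans (cong (sg (opposite s)) remaining) (trans (sg-opp s _) (cong -_ (unit s _)))))
              (≤-by (ℤP.i<j⇒suc[i]≤j (ℤP.≰⇒> go-on))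
                (solve 1 (λ a → con 1ℤ :- (con 1ℤ :+ a) := (:- (a :- con 1ℤ)) :- con 1ℤ) refl (sg s (deg F′ y - deg F y - δ u y * ⟦ s ⟧))))
            where
            unit : ∀ s D → sg s (D - ⟦ s ⟧) ≡ sg s D - 1ℤ
            unit S.+ D = refl
            unit S.- D = solve 1 (λ d → :- (d :- con (- 1ℤ)) := (:- d) :- con 1ℤ) refl D
            remaining : deg F′ y - deg patch y ≡ (deg F′ y - deg F y - δ u y * ⟦ s ⟧) - ⟦ s ⟧
            remaining = trans (cong (λ c → deg F′ y - c) (trans (d₊ y) (cong (λ c → deg F y + (δ u y + c) * ⟦ s ⟧) (δ-refl y))))
              (solve 4 (λ a b d s → a :- (b :+ (d :+ con 1ℤ) :* s) := ((a :- b) :- d :* s) :- s) refl (deg F′ y) (deg F y) (δ u y) ⟦ s ⟧)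
          -- The contributions at `y` cancel: the switched edge adds a step of sign `s` there, and
          -- the remaining walk starts with the opposite sign.
          extend : Half patch F′ y (opposite s) → Half F F′ u s
          extend h = record { F₁ = H.F₁ ; between = between′ ; z = H.z ; t = H.t
              ; d₁ = λ v → trans (H.d₁ v) (trans (cong₂ (λ a b → a + (δ y v * b + δ H.z v * ⟦ H.t ⟧)) (d₊ v) (sg-opp s 1ℤ))
                  (solve 5 (λ d a b z s → (d :+ (a :+ b) :* s) :+ (b :* (:- s) :+ z) := d :+ (a :* s :+ z)) refl
                    (deg F v) (δ u v) (δ y v) (δ H.z v * ⟦ H.t ⟧) ⟦ s ⟧))
              ; toward = subst (1ℤ ≤_) (cong (sg H.t) (trans (cong₂ (λ a b → deg F′ H.z - a - δ y H.z * b) (d₊ H.z) (sg-opp s 1ℤ))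
                  (solve 5 (λ d′ d a b s → (d′ :- (d :+ (a :+ b) :* s)) :- b :* (:- s) := (d′ :- d) :- a :* s) refl
                    (deg F′ H.z) (deg F H.z) (δ u H.z) (δ y H.z) ⟦ s ⟧))) H.toward }
            where
            module H = Half h
            between′ : Between F F′ H.F₁
            between′ v w with H.between v w
            ... | inj₂ e = inj₂ e
            ... | inj₁ e with between₊ v w
            ...   | inj₁ e′ = inj₁ (trans e e′)
            ...   | inj₂ e′ = inj₂ (trans e e′)
          bounded : ∀ {c} → distance F F′ ≤ c → distance patch F′ ≤ c - + 2
          bounded {c} le = ≤-by le (trans (cong (_-_ c) (sym closer)) (solve 2 (λ c p → c :- (p :+ con (+ 2)) := (c :- con (+ 2)) :- p) refl c (distance patch F′)))
          0≤distance : 0ℤ ≤ distance patch F′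
          0≤distance = ∑-nonneg (λ v → ∑-nonneg (λ w → ⟨⟩-nonneg (matₚ v w xor mat F′ v w)))
          recurse : ∀ fuel → distance F F′ ≤ + fuel → Half F F′ u s
          recurse zero le with () ← ℤP.≤-trans 0≤distance (bounded le)
          recurse (suc fuel) le = extend (half fuel patch F′ y (opposite s)
            (≤-by (ℤP.+-mono-≤ (bounded le) 0≤1) (solve 2 (λ f d → (((con 1ℤ :+ f) :- con (+ 2)) :+ con 1ℤ) :- (d :+ con 0ℤ) := f :- d) refl (+ fuel) (distance patch F′)))
            continue)

    module Excess (k : ℕ) where

      excess : Sub → Fin n → ℤ
      excess F v = deg F v - + k

      excess-difference : ∀ F F′ v → excess F′ v - excess F v ≡ deg F′ v - deg F v
      excess-difference F F′ v = solve 3 (λ a b k → (a :- k) :- (b :- k) := a :- b) refl (deg F′ v) (deg F v) (+ k)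

      exch : ∀ F F′ u s → 1ℤ ≤ sg s (excess F′ u - excess F u) → Exchange excess F F′ u s
      exch F F′ u s 1≤ = record { F₁ = H.F₁ ; F₁′ = co F F′ H.F₁ H.between ; z = H.z ; t = H.t
          ; x₁ = λ v → trans (cong (_- + k) (H.d₁ v)) (solve 3 (λ d e k → (d :+ e) :- k := (d :- k) :+ e) refl (deg F v) (move v) (+ k))
          ; x₁′ = λ v → trans (cong (_- + k) (trans (deg-co F F′ H.F₁ H.between v) (cong (λ c → deg F v + deg F′ v - c) (H.d₁ v))))
              (solve 4 (λ d d′ e k → ((d :+ d′) :- (d :+ e)) :- k := (d′ :- k) :- e) refl (deg F v) (deg F′ v) (move v) (+ k))
          ; toward = subst (λ c → 1ℤ ≤ sg H.t (c - δ u H.z * ⟦ s ⟧)) (sym (excess-difference F F′ H.z)) H.toward }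
        where
        h : Half F F′ u s
        h = half _ F F′ u s (ℤP.≤-reflexive (sym (ℤP.0≤i⇒+∣i∣≡i (∑-nonneg (λ v → ∑-nonneg (λ w → ⟨⟩-nonneg (mat F v w xor mat F′ v w)))))))
              (subst (λ c → 1ℤ ≤ sg s c) (excess-difference F F′ u) 1≤)
        module H = Half h
        move : Fin n → ℤ
        move v = δ u v * ⟦ s ⟧ + δ H.z v * ⟦ H.t ⟧

      open System excess exch public

      -- Modulo 2 every cost agrees with the sum of the excesses, which is a degree sum minus `n k`.
      even : Even (+ n * + k) → ∀ κ F → Even (Φ κ F)
      even (h , nk≡2h) κ F = (d + sum e) - h , trans (sum-cong-≗ (λ v → proj₂ (cost-parity (κ v) (excess F v))))
        (trans (∑-distrib-+ (excess F) (λ v → e v + e v))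
          (trans (cong₂ _+_ (trans (∑-distrib-- (deg F) (λ _ → + k)) (cong₂ _-_ (proj₂ handshake) (trans (∑-const n (+ k)) nk≡2h)))
                            (∑-distrib-+ e e))
            (solve 3 (λ d h e → ((d :+ d) :- (h :+ h)) :+ (e :+ e) := ((d :+ e) :- h) :+ ((d :+ e) :- h)) refl d h (sum e))))
        where
        e : Fin n → ℤ
        e v = proj₁ (cost-parity (κ v) (excess F v))
        handshake : Even (sum (deg F))
        handshake = ∑∑-even (mat F) (msym F) (irreflexive F)
        d : ℤ
        d = proj₁ handshake

      toggle-sign : Bool → Sign
      toggle-sign true  = S.-
      toggle-sign false = S.+

      toggle : ∀ {u v} → adj G u v ≡ true → ∀ F → Toggle F u v (toggle-sign (mat F u v))
      toggle {u} {v} uv F = record { F₁ = patch ; u≢v = u≢v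
          ; at-u = trans (cong (_- + k) (trans (d₊ u) (cong₂ (λ a b → deg F u + (a + b) * c) (δ-refl u) (δ-≢ (u≢v ∘ sym)))))
              (solve 3 (λ d c k → (d :+ (con 1ℤ :+ con 0ℤ) :* c) :- k := (d :- k) :+ c) refl (deg F u) c (+ k))
          ; at-v = trans (cong (_- + k) (trans (d₊ v) (cong₂ (λ a b → deg F v + (a + b) * c) (δ-≢ u≢v) (δ-refl v))))
              (solve 3 (λ d c k → (d :+ (con 0ℤ :+ con 1ℤ) :* c) :- k := (d :- k) :+ c) refl (deg F v) c (+ k))
          ; rest = λ w w≢u w≢v → trans (cong (_- + k) (trans (d₊ w) (cong₂ (λ a b → deg F w + (a + b) * c) (δ-≢ (w≢u ∘ sym)) (δ-≢ (w≢v ∘ sym)))))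
              (solve 3 (λ d c k → (d :+ (con 0ℤ :+ con 0ℤ) :* c) :- k := d :- k) refl (deg F w) c (+ k)) }
        where
        c : ℤ
        c = ⟦ toggle-sign (mat F u v) ⟧
        u≢v : u ≢ v
        u≢v refl with () ← trans (sym uv) (loopless G u)
        open Patch F u v (not (mat F u v)) (λ _ → uv)
        step : ∀ b → ⟨ not b ⟩ - ⟨ b ⟩ ≡ ⟦ toggle-sign b ⟧
        step true  = refl
        step false = refl
        d₊ : ∀ w → deg patch w ≡ deg F w + (δ u w + δ v w) * c
        d₊ = deg-patch u≢v (step (mat F u v))

-- Breaking ties among optimal subgraphs.

module Saturation where

  open import Defs using (Graph; adj)
  open import Data.Bool using (true)
  open import Data.Nat as ℕ using (ℕ; zero; suc)
  open import Data.Fin using (Fin; zero; suc; _≟_)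
  open import Data.Sign as S using (opposite)
  open import Data.Integer using (ℤ; +_; 0ℤ; 1ℤ; _+_; _-_; _*_; -_; _≤_; +≤+)
  import Data.Integer.Properties as ℤP
  open import Data.Integer.Solver using (module +-*-Solver)
  open +-*-Solver using (solve; con; _:+_; _:*_; _:-_; :-_; _:=_)
  open import Data.Product using (∃; _×_; _,_; proj₁; proj₂)
  open import Data.Empty using (⊥-elim)
  open import Relation.Nullary using (¬_; yes; no)
  open import Relation.Binary.PropositionalEquality
  open Sums
  open Costs
  open Linearisation using (minimise)

  -- Secondary objective: it decides between subgraphs in which a saving at a linear vertex is
  -- offset by a loss at an `abs′` neighbour.
  linear-part : Kind → ℤ → ℤ
  linear-part abs′    _ = 0ℤ
  linear-part (lin s) x = sg s x

  module _ {n : ℕ} (G : Graph n) (k : ℕ) where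
    open Subgraphs.InGraph G
    open Excess k

    0≤deg : ∀ F v → 0ℤ ≤ deg F v
    0≤deg F v = ∑-nonneg (λ w → ⟨⟩-nonneg (mat F v w))

    deg≤n : ∀ F v → deg F v ≤ + n
    deg≤n F v = ℤP.≤-trans (∑-bounded (λ w → ⟨ mat F v w ⟩) 1ℤ (λ w → ⟨⟩≤1 (mat F v w))) (ℤP.≤-reflexive (ℤP.*-identityʳ (+ n)))

    linear-part-bounded : ∀ κ F v → - (+ n + + k) ≤ linear-part κ (excess F v)
    linear-part-bounded abs′ F v = ℤP.neg-mono-≤ {0ℤ} (+≤+ ℕ.z≤n)
    linear-part-bounded (lin S.+) F v = ≤-by (ℤP.+-mono-≤ (0≤deg F v) (+≤+ (ℕ.z≤n {n})))
      (solve 3 (λ d n k → (d :+ n) :- (con 0ℤ :+ con 0ℤ) := (d :- k) :- (:- (n :+ k))) refl (deg F v) (+ n) (+ k))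
    linear-part-bounded (lin S.-) F v = ≤-by (ℤP.+-mono-≤ (deg≤n F v) (ℤP.+-mono-≤ (+≤+ (ℕ.z≤n {k})) (+≤+ (ℕ.z≤n {k}))))
      (solve 3 (λ d n k → (n :+ (k :+ k)) :- (d :+ (con 0ℤ :+ con 0ℤ)) := (:- (d :- k)) :- (:- (n :+ k))) refl (deg F v) (+ n) (+ k))

    module _ (κ : Fin n → Kind) (m : ℤ) (minimal : ∀ F → m ≤ Φ κ F) where
      open Optimal κ m minimal

      -- With `T` and `S` the vertices of kind `lin S.-` and `lin S.+`: `F` contains all edges of
      -- `G` from `T` to vertices outside `S`, and no edges from `S` to vertices outside `T`.
      Saturated : Sub → Set
      Saturated F = ∀ u v s → κ u ≡ lin s → κ v ≢ lin (opposite s) → adj G u v ≡ true → toggle-sign (mat F u v) ≢ opposite s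

      -- Among optimal subgraphs, take one that is also optimal for the linear vertices alone.
      saturate : (∃ λ F → Opt F) → ¬ ¬ (∃ λ F → Opt F × Saturated F)
      saturate F₀ cont = minimise {∃ Opt} linear (+ n * (- (+ n + + k))) bounded F₀ λ { ((F , oF) , least) → cont (F , oF , full F oF least) }
        where
        linear : ∃ Opt → ℤ
        linear (F , _) = sum (λ v → linear-part (κ v) (excess F v))
        bounded : ∀ F → + n * (- (+ n + + k)) ≤ linear F
        bounded (F , _) = ℤP.≤-trans (ℤP.≤-reflexive (sym (∑-const n (- (+ n + + k)))))
          (∑-mono {f = λ _ → - (+ n + + k)} (λ v → linear-part-bounded (κ v) F v))
        -- A forbidden toggle saves 1 at `u` and costs at most 1 at `v`, so its result is optimal;
        -- the linear part drops by 1 at `u` and does not grow at `v`, against the choice of `F`.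
        full : ∀ F (oF : Opt F) → (∀ F′ → linear (F , oF) ≤ linear F′) → Saturated F
        full F oF least u v s κu κv uv bad = 1≰0 (≤-by (ℤP.+-mono-≤ (least (F₁ , oF₁)) (ℤP.+-mono-≤ (ℤP.≤-reflexive ts) linear-gain))
            (solve 6 (λ f f₁ a b a′ b′ → (f₁ :+ ((f :+ (a′ :+ b′)) :+ (a :+ b))) :- (f :+ ((f₁ :+ (a :+ b)) :+ ((a′ :+ b′) :+ con 1ℤ))) := con 0ℤ :- con 1ℤ)
              refl (linear (F , oF)) (linear (F₁ , oF₁)) (lp u (excess F u)) (lp v (excess F v)) (lp u (excess F u + c)) (lp v (excess F v + c))))
          where
          lp : Fin n → ℤ → ℤ
          lp w = linear-part (κ w)
          c : ℤ
          c = ⟦ opposite s ⟧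
          tg : Toggle F u v (opposite s)
          tg = subst (Toggle F u v) bad (toggle uv F)
          open Toggle tg
          tc = toggle-cost κ
          ts = toggle-sum lp
          u-down : cost (κ u) (excess F u + c) ≡ cost (κ u) (excess F u) - 1ℤ
          u-down = subst (λ a → cost a (excess F u + c) ≡ cost a (excess F u) - 1ℤ) (sym κu) (sg-down s (excess F u))
          u-down′ : lp u (excess F u + c) ≡ lp u (excess F u) - 1ℤ
          u-down′ = subst (λ a → linear-part a (excess F u + c) ≡ linear-part a (excess F u) - 1ℤ) (sym κu) (sg-down s (excess F u))
          not-opposite : ∀ a x → a ≢ lin (opposite s) → cost a (x + c) ≤ cost a x + 1ℤ × linear-part a (x + c) ≤ linear-part a x
          not-opposite abs′ x _ = abs-step-≤ (opposite s) x , ℤP.≤-refl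
          not-opposite (lin t) x ne with t S.≟ s
          ... | yes refl = ≤-by (+≤+ (ℕ.z≤n {2})) (trans (solve 1 (λ p → con (+ 2) :- con 0ℤ := (p :+ con 1ℤ) :- (p :- con 1ℤ)) refl (sg t x))
                                                       (cong (λ z → (sg t x + 1ℤ) - z) (sym (sg-down t x))))
                         , ≤-by 0≤1 (trans (solve 1 (λ p → con 1ℤ :- con 0ℤ := p :- (p :- con 1ℤ)) refl (sg t x))
                                           (cong (λ z → sg t x - z) (sym (sg-down t x))))
          ... | no t≢s = ⊥-elim (ne (cong lin (opposite-≢ s t t≢s)))
          v-bounds = not-opposite (κ v) (excess F v) κv
          oF₁ : Opt F₁
          oF₁ = ≤-by (ℤP.+-mono-≤ (ℤP.+-mono-≤ oF (ℤP.≤-reflexive tc)) (ℤP.+-mono-≤ (ℤP.≤-reflexive u-down) (proj₁ v-bounds)))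
            (solve 7 (λ f₁ f a b a′ b′ m → ((m :+ (f :+ (a′ :+ b′))) :+ ((a :- con 1ℤ) :+ (b :+ con 1ℤ))) :- ((f :+ (f₁ :+ (a :+ b))) :+ (a′ :+ b′)) := m :- f₁)
              refl (Φ κ F₁) (Φ κ F) (cost (κ u) (excess F u)) (cost (κ v) (excess F v)) (cost (κ u) (excess F u + c)) (cost (κ v) (excess F v + c)) m)
          linear-gain : (lp u (excess F u + c) + lp v (excess F v + c)) + 1ℤ ≤ lp u (excess F u) + lp v (excess F v)
          linear-gain = ≤-by (ℤP.+-mono-≤ (ℤP.≤-reflexive u-down′) (proj₂ v-bounds))
            (solve 4 (λ a b a′ b′ → ((a :- con 1ℤ) :+ b) :- (a′ :+ b′) := (a :+ b) :- ((a′ :+ b′) :+ con 1ℤ)) refl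
              (lp u (excess F u)) (lp v (excess F v)) (lp u (excess F u + c)) (lp v (excess F v + c)))

-- Tutte's identity against the expansion of sets.

module Counting where

  open import Defs using (Graph; adj; loopless) renaming (sym to adj-sym)
  open import Data.Bool using (Bool; true; false; not; _∧_; _∨_)
  import Data.Bool as Bool
  open import Data.Nat as ℕ using (ℕ; zero; suc)
  open import Data.Fin using (Fin; zero; suc; _≟_)
  open import Data.Fin.Properties using (any?)
  open import Data.Sign as S using (Sign)
  open import Data.Integer using (ℤ; +_; 0ℤ; 1ℤ; _+_; _-_; _*_; -_; _≤_; +≤+; nonNegative)
  import Data.Integer.Properties as ℤP
  open import Data.Integer.Solver using (module +-*-Solver)
  open +-*-Solver using (solve; con; _:+_; _:*_; _:-_; :-_; _:=_)
  open import Data.Product using (∃; _×_; _,_; proj₁; proj₂)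
  open import Data.Sum using (_⊎_; inj₁; inj₂)
  open import Data.Empty using (⊥; ⊥-elim)
  open import Function using (_∘_)
  open import Relation.Nullary using (¬_; Dec; yes; no)
  open import Relation.Nullary.Decidable using (⌊_⌋; _×-dec_)
  open import Relation.Binary.PropositionalEquality
  open Sums
  open Costs
  open Linearisation using (is-abs; ¬¬-Π; module Settle)
  open Saturation

  size : ∀ {n} → (Fin n → Bool) → ℤ
  size X = sum (λ v → ⟨ X v ⟩)

  0≤size : ∀ {n} (X : Fin n → Bool) → 0ℤ ≤ size X
  0≤size X = ∑-nonneg (λ v → ⟨⟩-nonneg (X v))

  insert : ∀ {n} → (Fin n → Bool) → Fin n → Fin n → Bool
  insert X v w = X w ∨ ⌊ v ≟ w ⌋

  size-insert : ∀ {n} (X : Fin n → Bool) v → size (insert X v) ≤ size X + 1ℤ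
  size-insert X v = ℤP.≤-trans (∑-mono {g = λ w → ⟨ X w ⟩ + δ v w} bound)
    (ℤP.≤-reflexive (trans (∑-distrib-+ (λ w → ⟨ X w ⟩) (δ v)) (cong (_+_ (size X)) (∑-δ v))))
    where
    bound : ∀ w → ⟨ insert X v w ⟩ ≤ ⟨ X w ⟩ + δ v w
    bound w with X w | v ≟ w
    ... | true  | yes _ = +≤+ (ℕ.s≤s ℕ.z≤n)
    ... | true  | no  _ = ℤP.≤-refl
    ... | false | yes _ = ℤP.≤-refl
    ... | false | no  _ = ℤP.≤-refl

  insert-old : ∀ {n} (X : Fin n → Bool) v w → X w ≡ true → insert X v w ≡ true
  insert-old X v w e rewrite e = refl

  insert-new : ∀ {n} (X : Fin n → Bool) v → insert X v v ≡ true
  insert-new X v with X v | v ≟ v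
  ... | true  | _       = refl
  ... | false | yes _   = refl
  ... | false | no  v≢v = ⊥-elim (v≢v refl)

  extend : ∀ {n} (X : Fin n → Bool) j → size X ≤ + j → + j ≤ + n →
    ∃ λ Y → (∀ v → X v ≡ true → Y v ≡ true) × size Y ≡ + j
  extend {n} X₀ j X₀≤j j≤n = go j X₀ X₀≤j (ℤP.i≤j+i (+ j) (size X₀) {{nonNegative (0≤size X₀)}})
    where
    go : ∀ fuel X → size X ≤ + j → + j ≤ size X + + fuel → ∃ λ Y → (∀ v → X v ≡ true → Y v ≡ true) × size Y ≡ + j
    go zero X X≤ ≤X = X , (λ _ e → e) , ℤP.≤-antisym X≤ (subst (+ j ≤_) (ℤP.+-identityʳ (size X)) ≤X)
    go (suc fuel) X X≤ ≤X with size X ℤP.≟ + j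
    ... | yes e = X , (λ _ e → e) , e
    ... | no ne with v , 1≤ ← ∑-pos (λ v → 1ℤ - ⟨ X v ⟩)
                (≤-by (ℤP.≤-trans (ℤP.i<j⇒suc[i]≤j (ℤP.≤∧≢⇒< X≤ ne)) j≤n)
                  (trans (solve 2 (λ n x → n :- (con 1ℤ :+ x) := (n :* con 1ℤ :- x) :- con 1ℤ) refl (+ n) (size X))
                    (cong (_- 1ℤ) (sym (trans (∑-distrib-- (λ _ → 1ℤ) (λ v → ⟨ X v ⟩)) (cong (_- size X) (∑-const n 1ℤ)))))))
      = let Y , sub , size≡ = go fuel (insert X v)
              (ℤP.≤-trans (size-insert X v) (ℤP.≤-trans (ℤP.≤-reflexive (ℤP.+-comm (size X) 1ℤ)) (ℤP.i<j⇒suc[i]≤j (ℤP.≤∧≢⇒< X≤ ne))))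
              (≤-by (ℤP.+-mono-≤ ≤X (grown v (absent (X v) 1≤)))
                (solve 4 (λ x f y j → ((x :+ (con 1ℤ :+ f)) :+ y) :- (j :+ (x :+ con 1ℤ)) := (y :+ f) :- j) refl (size X) (+ fuel) (size (insert X v)) (+ j)))
        in Y , (λ w e → sub w (insert-old X v w e)) , size≡
      where
      absent : ∀ b → 1ℤ ≤ 1ℤ - ⟨ b ⟩ → b ≡ false
      absent false _ = refl
      absent true (+≤+ ())
      grown : ∀ v → X v ≡ false → size X + 1ℤ ≤ size (insert X v)
      grown v Xv = ℤP.≤-trans (ℤP.≤-reflexive (trans (cong (_+_ (size X)) (sym (∑-δ v))) (sym (∑-distrib-+ (λ w → ⟨ X w ⟩) (δ v)))))
          (∑-mono {f = λ w → ⟨ X w ⟩ + δ v w} bound)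
        where
        bound : ∀ w → ⟨ X w ⟩ + δ v w ≤ ⟨ insert X v w ⟩
        bound w with v ≟ w
        ... | yes refl rewrite Xv = ℤP.≤-refl
        ... | no _ with X w
        ...   | true  = ℤP.≤-refl
        ...   | false = ℤP.≤-refl

  is-lin : Sign → Kind → Bool
  is-lin s abs′    = false
  is-lin s (lin t) = ⌊ t S.≟ s ⌋

  is-lin-sound : ∀ s a → is-lin s a ≡ true → a ≡ lin s
  is-lin-sound s (lin t) e with t S.≟ s
  ... | yes refl = refl

  ∧-true : ∀ {a b} → a ∧ b ≡ true → a ≡ true × b ≡ true
  ∧-true {true} {true} _ = refl , refl

  module Neighbours {n : ℕ} (G : Graph n) (k : ℕ) where

    nbrs : (Fin n → Bool) → Fin n → ℤ
    nbrs X w = sum (λ v → ⟨ X v ∧ adj G w v ⟩)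

    Λᵇ : (Fin n → Bool) → Fin n → Bool
    Λᵇ X w = ⌊ + k ℤP.≤? nbrs X w ⌋

    Λᵇ-sound : ∀ X w → Λᵇ X w ≡ true → + k ≤ nbrs X w
    Λᵇ-sound X w e with + k ℤP.≤? nbrs X w
    ... | yes p = p

    0≤nbrs : ∀ X w → 0ℤ ≤ nbrs X w
    0≤nbrs X w = ∑-nonneg (λ v → ⟨⟩-nonneg (X v ∧ adj G w v))

  module Barrier {n : ℕ} (G : Graph n) (k : ℕ) (2≤k : + 2 ≤ + k) (k≤n : + k ≤ + n)
    (even-nk : Even (+ n * + k))
    (expands : ∀ X → + k ≤ size X → size X ≤ size (Neighbours.Λᵇ G k X)) where

    open Neighbours G k
    open Subgraphs.InGraph G
    open Excess k

    module At (κ : Fin n → Kind) (m : ℤ) (minimal : ∀ F → m ≤ Φ κ F)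
      (settled : Settle.Settled excess exch (even even-nk) κ m minimal) (2≤m : + 2 ≤ m)
      (F : Sub) (oF : Φ κ F ≤ m) (sat : Saturated G k κ m minimal F) where

      open Optimal κ m minimal

      -- `R` allows at most one defective vertex of `F` per block, so `Q` has one vertex in each
      -- defective block and `q` counts these blocks.
      T S Q : Fin n → Bool
      T v = is-lin S.- (κ v)
      S v = is-lin S.+ (κ v)
      Q v = is-abs (κ v) ∧ not ⌊ excess F v ℤP.≟ 0ℤ ⌋

      dT : Fin n → ℤ
      dT = nbrs T

      E : ℤ
      E = sum (λ w → ⟨ not (S w) ⟩ * dT w)

      t s q : ℤ
      t = size T
      s = size S
      q = size Q

      adj-swap : ∀ {u v} → adj G u v ≡ true → adj G v u ≡ true
      adj-swap {u} {v} e = trans (adj-sym G v u) e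

      T-full : ∀ {u v} → κ u ≡ lin S.- → κ v ≢ lin S.+ → adj G u v ≡ true → mat F u v ≡ true
      T-full {u} {v} κu κv uv with mat F u v in e
      ... | true  = refl
      ... | false = ⊥-elim (sat u v S.- κu κv uv (cong toggle-sign e))

      S-empty : ∀ {u v} → κ u ≡ lin S.+ → κ v ≢ lin S.- → mat F u v ≡ false
      S-empty {u} {v} κu κv with mat F u v in e
      ... | false = refl
      ... | true  = ⊥-elim (sat u v S.+ κu κv (m⊆G F u v e) (cong toggle-sign e))

      Block : Fin n → Set
      Block v = κ v ≡ abs′ × (∀ s → Has s v)

      -- `not-adjacent` excludes the `abs′` vertices that are never defective and `R-adjacent`
      -- excludes the other blocks, so a block is joined only to `T`, to `S` and within itself.
      block-nbr : ∀ {w v} → Block w → adj G w v ≡ true → κ v ≡ lin S.- ⊎ κ v ≡ lin S.+ ⊎ (Block v × R w v)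
      block-nbr {w} {v} (κw , has) wv = by-kind (κ v) refl
        where
        open Adjacent {w} {v} (λ F → _ , toggle wv F)
        by-kind : ∀ a → κ v ≡ a → κ v ≡ lin S.- ⊎ κ v ≡ lin S.+ ⊎ (Block v × R w v)
        by-kind (lin S.-) e = inj₁ e
        by-kind (lin S.+) e = inj₂ (inj₁ e)
        by-kind abs′      e with settled v e
        ... | inj₁ has-v = inj₂ (inj₂ ((e , has-v) , R-adjacent κw e has has-v))
        ... | inj₂ never = ⊥-elim (not-adjacent κw e has never)

      Q-abs : ∀ {c} → Q c ≡ true → κ c ≡ abs′ × excess F c ≢ 0ℤ
      Q-abs {c} e with κ c | excess F c ℤP.≟ 0ℤ
      ... | abs′ | no ne = refl , ne

      Q-block : ∀ {c} → Q c ≡ true → Block c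
      Q-block {c} e with settled c (proj₁ (Q-abs e))
      ... | inj₁ has   = proj₁ (Q-abs e) , has
      ... | inj₂ never = ⊥-elim (proj₂ (Q-abs e) (never F oF))

      abs≢lin : ∀ {v s} → κ v ≡ abs′ → κ v ≢ lin s
      abs≢lin e e′ with () ← trans (sym e) e′

      abs-T : ∀ {v} → κ v ≡ abs′ → T v ≡ false
      abs-T e rewrite e = refl

      abs-S : ∀ {v} → κ v ≡ abs′ → S v ≡ false
      abs-S e rewrite e = refl

      T≤F : ∀ {w} → κ w ≢ lin S.+ → ∀ v → ⟨ T v ∧ adj G w v ⟩ ≤ ⟨ mat F w v ⟩
      T≤F {w} κw v with T v in Tv | adj G w v in wv
      ... | false | _     = ⟨⟩-nonneg (mat F w v)
      ... | true  | false = ⟨⟩-nonneg (mat F w v)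
      ... | true  | true  = ℤP.≤-reflexive (cong ⟨_⟩ (sym (trans (msym F w v)
                              (T-full (is-lin-sound S.- (κ v) Tv) κw (adj-swap wv)))))

      -- The cost of `F` is evaluated by kinds: `T` gives `k t - A`, `S` gives `B - k s`, and each
      -- defective block gives 1. Counting the edges of `F` at `T` from their other ends yields
      -- `A ≡ B + E`: at `S` all edges of `F` lead to `T`, and elsewhere all edges of `G` leading to
      -- `T` are in `F`.
      balance : m + + k * s + E ≡ + k * t + q
      balance = trans (cong (λ z → z + + k * s + E) (ℤP.≤-antisym (minimal F) oF))
          (trans (cong (λ z → z + + k * s + E) total)
            (trans (cong (λ z → ((+ k * t - z) + (B - + k * s)) + q + + k * s + E) columns)
              (solve 5 (λ a b e s q → ((((a :- (b :+ e)) :+ (b :- s)) :+ q) :+ s) :+ e := a :+ q) refl (+ k * t) B E (+ k * s) q)))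
        where
        A B : ℤ
        A = sum (λ v → ⟨ T v ⟩ * deg F v)
        B = sum (λ v → ⟨ S v ⟩ * deg F v)
        split : ∀ v → cost (κ v) (excess F v) ≡ ((+ k * ⟨ T v ⟩ - ⟨ T v ⟩ * deg F v) + (⟨ S v ⟩ * deg F v - + k * ⟨ S v ⟩)) + ⟨ Q v ⟩
        split v = by-kind (κ v) refl
          where
          d = deg F v
          rhs : Kind → ℤ
          rhs a = ((+ k * ⟨ is-lin S.- a ⟩ - ⟨ is-lin S.- a ⟩ * d) + (⟨ is-lin S.+ a ⟩ * d - + k * ⟨ is-lin S.+ a ⟩)) + ⟨ is-abs a ∧ not ⌊ excess F v ℤP.≟ 0ℤ ⌋ ⟩
          small : (∀ s → Has s v) ⊎ (∀ F → Opt F → excess F v ≡ 0ℤ) → κ v ≡ abs′ → abs (excess F v) ≡ rhs abs′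
          small h κv with excess F v ℤP.≟ 0ℤ
          ... | yes e = trans (cong abs e) (solve 2 (λ k d → con 0ℤ := ((k :* con 0ℤ :- con 0ℤ :* d) :+ (con 0ℤ :* d :- k :* con 0ℤ)) :+ con 0ℤ) refl (+ k) d)
          small (inj₂ never) κv | no ne = ⊥-elim (ne (never F oF))
          small (inj₁ has) κv | no ne with s , 1≤ ← signed (excess F v) ne =
            trans (trans (abs-sg s (excess F v) (ℤP.≤-trans 0≤1 1≤)) (ℤP.≤-antisym (defect≤1 κv has {F} oF s 1≤) 1≤))
              (solve 2 (λ k d → con 1ℤ := ((k :* con 0ℤ :- con 0ℤ :* d) :+ (con 0ℤ :* d :- k :* con 0ℤ)) :+ con 1ℤ) refl (+ k) d)
          by-kind : ∀ a → κ v ≡ a → cost (κ v) (excess F v) ≡ rhs (κ v)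
          by-kind (lin S.-) e rewrite e = solve 2 (λ k d → :- (d :- k) := ((k :* con 1ℤ :- con 1ℤ :* d) :+ (con 0ℤ :* d :- k :* con 0ℤ)) :+ con 0ℤ) refl (+ k) d
          by-kind (lin S.+) e rewrite e = solve 2 (λ k d → d :- k := ((k :* con 0ℤ :- con 0ℤ :* d) :+ (con 1ℤ :* d :- k :* con 1ℤ)) :+ con 0ℤ) refl (+ k) d
          by-kind abs′ e = subst (λ a → cost a (excess F v) ≡ rhs a) (sym e) (small (settled v e) e)
        total : Φ κ F ≡ ((+ k * t - A) + (B - + k * s)) + q
        total = trans (sum-cong-≗ split)
          (trans (∑-distrib-+ (λ v → (+ k * ⟨ T v ⟩ - ⟨ T v ⟩ * deg F v) + (⟨ S v ⟩ * deg F v - + k * ⟨ S v ⟩)) (λ v → ⟨ Q v ⟩))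
            (cong (_+ q) (trans (∑-distrib-+ (λ v → + k * ⟨ T v ⟩ - ⟨ T v ⟩ * deg F v) (λ v → ⟨ S v ⟩ * deg F v - + k * ⟨ S v ⟩))
              (cong₂ _+_ (trans (∑-distrib-- (λ v → + k * ⟨ T v ⟩) (λ v → ⟨ T v ⟩ * deg F v)) (cong (_- A) (sym (*-distribˡ-sum (+ k) (λ v → ⟨ T v ⟩)))))
                         (trans (∑-distrib-- (λ v → ⟨ S v ⟩ * deg F v) (λ v → + k * ⟨ S v ⟩)) (cong (_-_ B) (sym (*-distribˡ-sum (+ k) (λ v → ⟨ S v ⟩)))))))))
        column : ∀ w → sum (λ v → ⟨ T v ⟩ * ⟨ mat F v w ⟩) ≡ ⟨ S w ⟩ * deg F w + ⟨ not (S w) ⟩ * dT w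
        column w with S w in Sw
        ... | true = trans (sum-cong-≗ entry) (solve 2 (λ d e → d := con 1ℤ :* d :+ con 0ℤ :* e) refl (deg F w) (dT w))
          where
          κw : κ w ≡ lin S.+
          κw = is-lin-sound S.+ (κ w) Sw
          entry : ∀ v → ⟨ T v ⟩ * ⟨ mat F v w ⟩ ≡ ⟨ mat F w v ⟩
          entry v with T v in Tv
          ... | true  = trans (ℤP.*-identityˡ _) (cong ⟨_⟩ (msym F v w))
          ... | false = trans (ℤP.*-zeroˡ ⟨ mat F v w ⟩) (cong ⟨_⟩ (sym (S-empty κw (not-T Tv))))
            where
            not-T : T v ≡ false → κ v ≢ lin S.-
            not-T Tv e with () ← trans (sym Tv) (cong (is-lin S.-) e)
        ... | false = trans (sum-cong-≗ entry) (solve 2 (λ d e → e := con 0ℤ :* d :+ con 1ℤ :* e) refl (deg F w) (dT w))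
          where
          κw : κ w ≢ lin S.+
          κw e with () ← trans (sym Sw) (cong (is-lin S.+) e)
          entry : ∀ v → ⟨ T v ⟩ * ⟨ mat F v w ⟩ ≡ ⟨ T v ∧ adj G w v ⟩
          entry v with T v in Tv
          ... | false = ℤP.*-zeroˡ ⟨ mat F v w ⟩
          ... | true with adj G w v in wv
          ...   | true = trans (ℤP.*-identityˡ _) (cong ⟨_⟩ (T-full (is-lin-sound S.- (κ v) Tv) κw (adj-swap wv)))
          ...   | false with mat F v w in e
          ...     | false = refl
          ...     | true with () ← trans (sym (adj-swap (m⊆G F v w e))) wv
        columns : A ≡ B + E
        columns = trans (sum-cong-≗ (λ v → *-distribˡ-sum ⟨ T v ⟩ (λ w → ⟨ mat F v w ⟩)))
          (trans (∑-comm (λ v w → ⟨ T v ⟩ * ⟨ mat F v w ⟩))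
            (trans (sum-cong-≗ column) (∑-distrib-+ (λ w → ⟨ S w ⟩ * deg F w) (λ w → ⟨ not (S w) ⟩ * dT w))))

      -- How a defective block enters the count: a slack block has a vertex whose surplus in `E`
      -- pays for it, an exact block supplies its vertex `r` to `X`.
      data Rep (c : Fin n) : Set where
        none  : Q c ≡ false → Rep c
        slack : Q c ≡ true → ∀ r → Block r → R r c → dT r ≢ 0ℤ → dT r ≢ + k → Rep c
        exact : Q c ≡ true → ∀ r → Block r → R r c → dT r ≡ 0ℤ → (∀ v → Block v → R v c → dT v ≡ 0ℤ ⊎ dT v ≡ + k) → Rep c

      1≤k : 1ℤ ≤ + k
      1≤k = ℤP.≤-trans (+≤+ (ℕ.s≤s ℕ.z≤n)) 2≤k

      -- If every vertex of a block had exactly k neighbours in T, the defective vertex c would have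
      -- a further F-neighbour w in its block, and w would be defective too.
      block-not-full : ∀ {c} → Q c ≡ true → ¬ (∀ v → Block v → R v c → dT v ≡ + k)
      block-not-full {c} Qc full = extra (∑-pos (λ w → ⟨ mat F c w ⟩ - ⟨ T w ∧ adj G c w ⟩)
          (≤-by (ℤP.i<j⇒suc[i]≤j (ℤP.≤∧≢⇒< (∑-mono (T≤F (abs≢lin κc))) dc≢))
            (trans (solve 2 (λ d t → d :- (con 1ℤ :+ t) := (d :- t) :- con 1ℤ) refl (deg F c) (dT c))
              (cong (_- 1ℤ) (sym (∑-distrib-- (λ w → ⟨ mat F c w ⟩) (λ w → ⟨ T w ∧ adj G c w ⟩)))))))
        where
        κc : κ c ≡ abs′
        κc = proj₁ (Q-abs Qc)
        dTc : dT c ≡ + k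
        dTc = full c (Q-block Qc) (λ _ _ _ _ → refl)
        dc≢ : dT c ≢ deg F c
        dc≢ e = proj₂ (Q-abs Qc) (trans (cong (_- + k) (trans (sym e) dTc)) (ℤP.+-inverseʳ (+ k)))
        entries : ∀ a b → 1ℤ ≤ ⟨ a ⟩ - ⟨ b ⟩ → a ≡ true × b ≡ false
        entries true  false _ = refl , refl
        entries true  true  (+≤+ ())
        entries false false (+≤+ ())
        extra : ¬ (∃ λ w → 1ℤ ≤ ⟨ mat F c w ⟩ - ⟨ T w ∧ adj G c w ⟩)
        extra (w , 1≤) = by-nbr (block-nbr (Q-block Qc) cw)
          where
          Fcw : mat F c w ≡ true
          Fcw = proj₁ (entries (mat F c w) (T w ∧ adj G c w) 1≤)
          cw : adj G c w ≡ true
          cw = m⊆G F c w Fcw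
          by-nbr : κ w ≡ lin S.- ⊎ κ w ≡ lin S.+ ⊎ (Block w × R c w) → ⊥
          by-nbr (inj₁ e) with () ← trans (sym (cong₂ _∧_ (cong (is-lin S.-) e) cw)) (proj₂ (entries (mat F c w) (T w ∧ adj G c w) 1≤))
          by-nbr (inj₂ (inj₁ e)) with () ← trans (sym Fcw) (trans (msym F c w) (S-empty e (abs≢lin κc)))
          by-nbr (inj₂ (inj₂ (block , r))) = loop (r F oF (proj₂ (Q-abs Qc)) w-defective)
            where
            loop : c ≡ w → ⊥
            loop refl with () ← trans (sym cw) (loopless G c)
            dTw : dT w ≡ + k
            dTw = full w block (R-sym {c} {w} r)
            more : dT w + 1ℤ ≤ deg F w
            more = ℤP.≤-trans (ℤP.≤-reflexive (trans (cong (_+_ (dT w)) (sym (∑-δ c))) (sym (∑-distrib-+ (λ v → ⟨ T v ∧ adj G w v ⟩) (δ c)))))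
                (∑-mono {f = λ v → ⟨ T v ∧ adj G w v ⟩ + δ c v} bound)
              where
              bound : ∀ v → ⟨ T v ∧ adj G w v ⟩ + δ c v ≤ ⟨ mat F w v ⟩
              bound v with c ≟ v
              ... | yes refl = ℤP.≤-reflexive (trans (cong (λ b → ⟨ b ∧ adj G w c ⟩ + 1ℤ) (abs-T κc)) (cong ⟨_⟩ (sym (trans (msym F w c) Fcw))))
              ... | no _ = ℤP.≤-trans (ℤP.≤-reflexive (ℤP.+-identityʳ _)) (T≤F (abs≢lin (proj₁ block)) v)
            w-defective : excess F w ≢ 0ℤ
            w-defective e = 1≰0 (≤-by more (trans (cong₂ (λ a b → a - (b + 1ℤ)) (ℤP.i-j≡0⇒i≡j (deg F w) (+ k) e) dTw)
              (solve 1 (λ k → k :- (k :+ con 1ℤ) := con 0ℤ :- con 1ℤ) refl (+ k))))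

      -- A defective block of neither type would have exactly `k` neighbours in `T` at each vertex,
      -- which `block-not-full` forbids.
      reps : ¬ ¬ (∀ c → Rep c)
      reps = ¬¬-Π λ c no-rep → by-Q c no-rep (Q c) refl
        where
        by-Q : ∀ c → ¬ Rep c → ∀ b → Q c ≡ b → ⊥
        by-Q c no-rep false e = no-rep (none e)
        by-Q c no-rep true  e = block-not-full e λ v block r → by-value v block r (dT v ℤP.≟ + k)
          where
          tight : ∀ v → Block v → R v c → dT v ≡ 0ℤ ⊎ dT v ≡ + k
          tight v block r with dT v ℤP.≟ 0ℤ | dT v ℤP.≟ + k
          ... | yes p | _     = inj₁ p
          ... | no _  | yes p = inj₂ p
          ... | no p  | no p′ = ⊥-elim (no-rep (slack e v block r p p′))
          by-value : ∀ v → Block v → R v c → Dec (dT v ≡ + k) → dT v ≡ + k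
          by-value v block r (yes p) = p
          by-value v block r (no p) with tight v block r
          ... | inj₂ p′ = p′
          ... | inj₁ p′ = ⊥-elim (no-rep (exact e v block r p′ tight))

      module WithReps (rep : ∀ c → Rep c) where

        r : Fin n → Fin n
        r c with rep c
        ... | none _ = c
        ... | slack _ r _ _ _ _ = r
        ... | exact _ r _ _ _ _ = r

        slackᵇ exactᵇ : Fin n → Bool
        slackᵇ c with rep c
        ... | slack _ _ _ _ _ _ = true
        ... | _ = false
        exactᵇ c with rep c
        ... | exact _ _ _ _ _ _ = true
        ... | _ = false

        slack-spec : ∀ c → slackᵇ c ≡ true → Q c ≡ true × Block (r c) × R (r c) c × dT (r c) ≢ 0ℤ × dT (r c) ≢ + k
        slack-spec c e with rep c
        ... | slack Qc r block rc ≢0 ≢k = Qc , block , rc , ≢0 , ≢k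

        exact-spec : ∀ c → exactᵇ c ≡ true → Q c ≡ true × Block (r c) × R (r c) c × dT (r c) ≡ 0ℤ
          × (∀ v → Block v → R v c → dT v ≡ 0ℤ ⊎ dT v ≡ + k)
        exact-spec c e with rep c
        ... | exact Qc r block rc ≡0 tight = Qc , block , rc , ≡0 , tight

        q₁ q₂ : ℤ
        q₁ = size slackᵇ
        q₂ = size exactᵇ

        q-split : q ≡ q₁ + q₂
        q-split = trans (sum-cong-≗ entry) (∑-distrib-+ (λ c → ⟨ slackᵇ c ⟩) (λ c → ⟨ exactᵇ c ⟩))
          where
          entry : ∀ c → ⟨ Q c ⟩ ≡ ⟨ slackᵇ c ⟩ + ⟨ exactᵇ c ⟩
          entry c with rep c
          ... | none e = cong ⟨_⟩ e
          ... | slack e _ _ _ _ _ = cong ⟨_⟩ e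
          ... | exact e _ _ _ _ _ = cong ⟨_⟩ e

        -- `R-trans` through `v` relates `c` and `c′`, and both are defective in the same optimal
        -- `F`.
        same-block : ∀ {v c c′} → Block v → Q c ≡ true → Q c′ ≡ true → R v c → R v c′ → c ≡ c′
        same-block {v} {c} {c′} block Qc Qc′ rc rc′ =
          R-trans {c} {v} {c′} (proj₁ (Q-block Qc)) (proj₂ (Q-block Qc)) (proj₂ block) (R-sym {v} {c} rc) rc′
            F oF (proj₂ (Q-abs Qc)) (proj₂ (Q-abs Qc′))

        rich spare : Fin n → Bool
        rich  w = not (S w) ∧ ⌊ + k ℤP.≤? dT w ⌋
        spare w = not (S w) ∧ not ⌊ dT w ℤP.≟ 0ℤ ⌋ ∧ not ⌊ dT w ℤP.≟ + k ⌋

        -- k is subtracted from the T-degree of the rich vertices; what is left over pays for the slack blocks.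
        E-bound : + k * size rich + q₁ ≤ E
        E-bound = ℤP.≤-trans (ℤP.+-monoʳ-≤ (+ k * size rich) (∑-injection slackᵇ spare r hits inj))
            (ℤP.≤-trans (ℤP.≤-reflexive (trans (cong (_+ size spare) (*-distribˡ-sum (+ k) (λ w → ⟨ rich w ⟩)))
                (sym (∑-distrib-+ (λ w → + k * ⟨ rich w ⟩) (λ w → ⟨ spare w ⟩)))))
              (∑-mono {f = λ w → + k * ⟨ rich w ⟩ + ⟨ spare w ⟩} bound))
          where
          hits : ∀ c → slackᵇ c ≡ true → spare (r c) ≡ true
          hits c e with Qc , block , rc , ≢0 , ≢k ← slack-spec c e with dT (r c) ℤP.≟ 0ℤ | dT (r c) ℤP.≟ + k
          ... | yes p | _     = ⊥-elim (≢0 p)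
          ... | no _  | yes p = ⊥-elim (≢k p)
          ... | no _  | no _ rewrite abs-S (proj₁ block) = refl
          inj : ∀ c c′ → slackᵇ c ≡ true → slackᵇ c′ ≡ true → r c ≡ r c′ → c ≡ c′
          inj c c′ e e′ rc≡rc′ with Qc , block , rc , _ ← slack-spec c e | Qc′ , _ , rc′ , _ ← slack-spec c′ e′ =
            same-block block Qc Qc′ rc (subst (λ v → R v c′) (sym rc≡rc′) rc′)
          bound : ∀ w → + k * ⟨ rich w ⟩ + ⟨ spare w ⟩ ≤ ⟨ not (S w) ⟩ * dT w
          bound w with S w
          ... | true = ℤP.≤-reflexive (trans (solve 1 (λ k → k :* con 0ℤ :+ con 0ℤ := con 0ℤ) refl (+ k)) (sym (ℤP.*-zeroˡ (dT w))))
          ... | false with + k ℤP.≤? dT w | dT w ℤP.≟ 0ℤ | dT w ℤP.≟ + k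
          ...   | yes k≤ | yes ≡0 | _      = ⊥-elim (1≰0 (ℤP.≤-trans 1≤k (ℤP.≤-trans k≤ (ℤP.≤-reflexive ≡0))))
          ...   | yes k≤ | no _   | yes _  = ≤-by k≤ (solve 2 (λ k d → d :- k := con 1ℤ :* d :- (k :* con 1ℤ :+ con 0ℤ)) refl (+ k) (dT w))
          ...   | yes k≤ | no _   | no ≢k  = ≤-by (ℤP.i<j⇒suc[i]≤j (ℤP.≤∧≢⇒< k≤ (≢k ∘ sym)))
                    (solve 2 (λ k d → d :- (con 1ℤ :+ k) := con 1ℤ :* d :- (k :* con 1ℤ :+ con 1ℤ)) refl (+ k) (dT w))
          ...   | no _   | yes _  | _      = ≤-by (0≤nbrs T w) (solve 2 (λ k d → d :- con 0ℤ := con 1ℤ :* d :- (k :* con 0ℤ :+ con 0ℤ)) refl (+ k) (dT w))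
          ...   | no _   | no _   | yes _  = ≤-by (0≤nbrs T w) (solve 2 (λ k d → d :- con 0ℤ := con 1ℤ :* d :- (k :* con 0ℤ :+ con 0ℤ)) refl (+ k) (dT w))
          ...   | no _   | no ≢0  | no _   = ≤-by (ℤP.i<j⇒suc[i]≤j (ℤP.≤∧≢⇒< (0≤nbrs T w) (≢0 ∘ sym)))
                    (solve 2 (λ k d → d :- (con 1ℤ :+ con 0ℤ) := con 1ℤ :* d :- (k :* con 0ℤ :+ con 1ℤ)) refl (+ k) (dT w))

        Z? : ∀ w → Dec (∃ λ c → exactᵇ c ≡ true × r c ≡ w)
        Z? w = any? (λ c → (exactᵇ c Bool.≟ true) ×-dec (r c ≟ w))

        Z X : Fin n → Bool
        Z w = ⌊ Z? w ⌋
        X w = T w ∨ Z w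

        Z-sound : ∀ {w} → Z w ≡ true → ∃ λ c → exactᵇ c ≡ true × r c ≡ w
        Z-sound {w} e with Z? w
        ... | yes p = p

        Z-complete : ∀ c → exactᵇ c ≡ true → Z (r c) ≡ true
        Z-complete c e with Z? (r c)
        ... | yes _ = refl
        ... | no np = ⊥-elim (np (c , e , refl))

        q₂≤Z : q₂ ≤ size Z
        q₂≤Z = ∑-injection exactᵇ Z r Z-complete inj
          where
          inj : ∀ c c′ → exactᵇ c ≡ true → exactᵇ c′ ≡ true → r c ≡ r c′ → c ≡ c′
          inj c c′ e e′ rc≡rc′ with Qc , block , rc , _ ← exact-spec c e | Qc′ , _ , rc′ , _ ← exact-spec c′ e′ =
            same-block block Qc Qc′ rc (subst (λ v → R v c′) (sym rc≡rc′) rc′)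

        size-X : size X ≡ t + size Z
        size-X = trans (sum-cong-≗ entry) (∑-distrib-+ (λ w → ⟨ T w ⟩) (λ w → ⟨ Z w ⟩))
          where
          entry : ∀ w → ⟨ X w ⟩ ≡ ⟨ T w ⟩ + ⟨ Z w ⟩
          entry w with Z w in Zw
          ... | false with T w
          ...   | true  = refl
          ...   | false = refl
          entry w | true with c , e , refl ← Z-sound {w} Zw with _ , block , _ ← exact-spec c e
            rewrite abs-T (proj₁ block) = refl

        -- Suppose `w` outside `S` has fewer than `k` neighbours in `T`. Then it has a neighbour in
        -- `Z`, which itself has none in `T`, so `w` lies in the block of that neighbour. The block
        -- is exact, so `w` has no neighbours in `T`; and `Z` meets the block only once, whereas `w`
        -- needs `k ≥ 2` neighbours.
        Λ-X : ∀ w → ⟨ Λᵇ X w ⟩ ≤ ⟨ S w ⟩ + ⟨ rich w ⟩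
        Λ-X w = by-Λ (Λᵇ X w) refl
          where
          0≤rhs : 0ℤ ≤ ⟨ S w ⟩ + ⟨ rich w ⟩
          0≤rhs = ℤP.+-mono-≤ (⟨⟩-nonneg (S w)) (⟨⟩-nonneg (rich w))
          by-Λ : ∀ b → Λᵇ X w ≡ b → ⟨ b ⟩ ≤ ⟨ S w ⟩ + ⟨ rich w ⟩
          by-Λ false _ = 0≤rhs
          by-Λ true Λw = by-S (S w) refl
            where
            by-S : ∀ b → S w ≡ b → 1ℤ ≤ ⟨ b ⟩ + ⟨ not b ∧ ⌊ + k ℤP.≤? dT w ⌋ ⟩
            by-S true  _  = ℤP.≤-refl
            by-S false Sw with + k ℤP.≤? dT w
            ... | yes _ = ℤP.≤-refl
            ... | no k≰ = ⊥-elim (poor (∑-pos (λ v → ⟨ Z v ∧ adj G w v ⟩) (ℤP.≤-trans 1≤k-dT k-dT≤dZ)))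
              where
              dZ : ℤ
              dZ = nbrs Z w
              split : nbrs X w ≤ dT w + dZ
              split = ℤP.≤-trans (∑-mono {g = λ v → ⟨ T v ∧ adj G w v ⟩ + ⟨ Z v ∧ adj G w v ⟩} entry)
                  (ℤP.≤-reflexive (∑-distrib-+ (λ v → ⟨ T v ∧ adj G w v ⟩) (λ v → ⟨ Z v ∧ adj G w v ⟩)))
                where
                entry : ∀ v → ⟨ X v ∧ adj G w v ⟩ ≤ ⟨ T v ∧ adj G w v ⟩ + ⟨ Z v ∧ adj G w v ⟩
                entry v with T v | Z v | adj G w v
                ... | true  | true  | true  = +≤+ (ℕ.s≤s ℕ.z≤n)
                ... | true  | false | true  = ℤP.≤-refl
                ... | false | true  | true  = ℤP.≤-refl
                ... | false | false | true  = ℤP.≤-refl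
                ... | true  | true  | false = ℤP.≤-refl
                ... | true  | false | false = ℤP.≤-refl
                ... | false | true  | false = ℤP.≤-refl
                ... | false | false | false = ℤP.≤-refl
              1≤k-dT : 1ℤ ≤ + k - dT w
              1≤k-dT = ≤-by (ℤP.i<j⇒suc[i]≤j (ℤP.≰⇒> k≰)) (solve 2 (λ k d → k :- (con 1ℤ :+ d) := (k :- d) :- con 1ℤ) refl (+ k) (dT w))
              k-dT≤dZ : + k - dT w ≤ dZ
              k-dT≤dZ = ≤-by (ℤP.≤-trans (Λᵇ-sound X w Λw) split) (solve 3 (λ k d z → (d :+ z) :- k := z :- (k :- d)) refl (+ k) (dT w) dZ)
              poor : ¬ (∃ λ z → 1ℤ ≤ ⟨ Z z ∧ adj G w z ⟩)
              poor (z , 1≤) = by-nbr (block-nbr (block-z z Zz) zw)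
                where
                Zz : Z z ≡ true
                Zz = proj₁ (∧-true (1≤⟨⟩ 1≤))
                wz : adj G w z ≡ true
                wz = proj₂ (∧-true {Z z} (1≤⟨⟩ 1≤))
                zw : adj G z w ≡ true
                zw = adj-swap wz
                block-z : ∀ z → Z z ≡ true → Block z
                block-z z Zz with c , e , refl ← Z-sound {z} Zz = proj₁ (proj₂ (exact-spec c e))
                dTz : ∀ z → Z z ≡ true → dT z ≡ 0ℤ
                dTz z Zz with c , e , refl ← Z-sound {z} Zz = proj₁ (proj₂ (proj₂ (proj₂ (exact-spec c e))))
                by-nbr : κ w ≡ lin S.- ⊎ κ w ≡ lin S.+ ⊎ (Block w × R z w) → ⊥
                by-nbr (inj₁ e) = 1≰0 (ℤP.≤-trans (ℤP.≤-trans (ℤP.≤-reflexive (cong ⟨_⟩ (sym (cong₂ _∧_ (cong (is-lin S.-) e) zw))))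
                  (term≤∑ {f = λ v → ⟨ T v ∧ adj G z v ⟩} (λ v → ⟨⟩-nonneg (T v ∧ adj G z v)) w)) (ℤP.≤-reflexive (dTz z Zz)))
                by-nbr (inj₂ (inj₁ e)) with () ← trans (sym Sw) (cong (is-lin S.+) e)
                by-nbr (inj₂ (inj₂ (block , _))) = 1≰0 (≤-by (ℤP.+-mono-≤ (ℤP.+-mono-≤ 2≤k k-dT≤dZ) dZ≤1)
                    (trans (cong (λ d → ((+ k + dZ) + 1ℤ) - ((+ 2 + (+ k - d)) + dZ)) dTw)
                      (solve 2 (λ k z → ((k :+ z) :+ con 1ℤ) :- ((con (+ 2) :+ (k :- con 0ℤ)) :+ z) := con 0ℤ :- con 1ℤ) refl (+ k) dZ)))
                  where
                  R-w : ∀ c → exactᵇ c ≡ true → adj G w (r c) ≡ true → R w c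
                  R-w c e wr with Qc , block-r , rc , _ ← exact-spec c e with block-nbr block-r (adj-swap wr)
                  ... | inj₁ e = ⊥-elim (abs≢lin (proj₁ block) e)
                  ... | inj₂ (inj₁ e) = ⊥-elim (abs≢lin (proj₁ block) e)
                  ... | inj₂ (inj₂ (_ , rw)) = R-trans {w} {r c} {c} (proj₁ block) (proj₂ block) (proj₂ block-r) (R-sym {r c} {w} rw) rc
                  dTw : dT w ≡ 0ℤ
                  dTw with c , e , refl ← Z-sound {z} Zz with proj₂ (proj₂ (proj₂ (proj₂ (exact-spec c e)))) w block (R-w c e wz)
                  ... | inj₁ ≡0 = ≡0
                  ... | inj₂ ≡k = ⊥-elim (k≰ (ℤP.≤-reflexive (sym ≡k)))
                  dZ≤1 : dZ ≤ 1ℤ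
                  dZ≤1 = ∑-at-most-one (λ v → Z v ∧ adj G w v) unique
                    where
                    unique : ∀ i j → Z i ∧ adj G w i ≡ true → Z j ∧ adj G w j ≡ true → i ≡ j
                    unique i j ei ej with Zi , wi ← ∧-true {Z i} ei | Zj , wj ← ∧-true {Z j} ej
                      with c , e , refl ← Z-sound {i} Zi | c′ , e′ , refl ← Z-sound {j} Zj =
                      cong r (same-block block (proj₁ (exact-spec c e)) (proj₁ (exact-spec c′ e′)) (R-w c e wi) (R-w c′ e′ wj))

        k*-mono : ∀ {a b} → a ≤ b → + k * a ≤ + k * b
        k*-mono = ℤP.*-monoˡ-≤-nonNeg (+ k)

        -- Expansion and `Λ-X` give `t + |Z| ≤ s + |rich|`. Multiplied by `k` and combined with
        -- `E-bound` and `balance`, this leaves `k q₂ + m ≤ q₂`, which is impossible.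
        large-X : ¬ (+ k ≤ size X)
        large-X k≤X = 1≰0 (≤-by (ℤP.+-mono-≤ (ℤP.+-mono-≤ (ℤP.+-mono-≤ 2≤m (ℤP.≤-reflexive balance)) (ℤP.+-mono-≤ E-bound (k*-mono X≤)))
                                            (ℤP.+-mono-≤ (k*-mono q₂≤Z) (ℤP.+-mono-≤ q₂≤kq₂ 0≤1)))
            (trans (cong (λ q → ((m + (+ k * t + q)) + (E + + k * (s + size rich)) + (+ k * size Z + (+ k * q₂ + 1ℤ)))
                     - ((+ 2 + (m + + k * s + E)) + ((+ k * size rich + q₁) + + k * (t + size Z)) + (+ k * q₂ + (q₂ + 0ℤ)))) q-split)
              (solve 9 (λ m k t q₁ q₂ e s ρ z → ((m :+ (k :* t :+ (q₁ :+ q₂))) :+ (e :+ k :* (s :+ ρ)) :+ (k :* z :+ (k :* q₂ :+ con 1ℤ)))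
                  :- ((con (+ 2) :+ (m :+ k :* s :+ e)) :+ ((k :* ρ :+ q₁) :+ k :* (t :+ z)) :+ (k :* q₂ :+ (q₂ :+ con 0ℤ))) := con 0ℤ :- con 1ℤ)
                refl m (+ k) t q₁ q₂ E s (size rich) (size Z))))
          where
          X≤ : t + size Z ≤ s + size rich
          X≤ = subst (_≤ s + size rich) size-X (ℤP.≤-trans (expands X k≤X)
            (ℤP.≤-trans (∑-mono {g = λ w → ⟨ S w ⟩ + ⟨ rich w ⟩} Λ-X) (ℤP.≤-reflexive (∑-distrib-+ (λ w → ⟨ S w ⟩) (λ w → ⟨ rich w ⟩)))))
          q₂≤kq₂ : q₂ ≤ + k * q₂
          q₂≤kq₂ = ℤP.≤-trans (ℤP.≤-reflexive (sym (ℤP.*-identityˡ q₂))) (ℤP.*-monoʳ-≤-nonNeg q₂ {{nonNegative (0≤size exactᵇ)}} 1≤k)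

        module Common (Y : Fin n → Bool) (T⊆Y : ∀ v → T v ≡ true → Y v ≡ true) (size-Y : size Y ≡ + k) where

          -- `Y` has only `k` vertices, so `k` neighbours in `Y` are all of `Y`: the nonnegative
          -- terms `missing` have sum at most 0.
          common : ∀ w → Λᵇ Y w ≡ true → ∀ v → Y v ≡ true → adj G w v ≡ true
          common w Λw v Yv = by-adj (adj G w v) refl
            where
            missing : Fin n → ℤ
            missing v = ⟨ Y v ⟩ - ⟨ Y v ∧ adj G w v ⟩
            0≤missing : ∀ v → 0ℤ ≤ missing v
            0≤missing v with Y v | adj G w v
            ... | true  | true  = ℤP.≤-refl
            ... | true  | false = 0≤1
            ... | false | _     = ℤP.≤-refl
            total : sum missing ≤ 0ℤ
            total = ℤP.≤-trans (ℤP.≤-reflexive (∑-distrib-- (λ v → ⟨ Y v ⟩) (λ v → ⟨ Y v ∧ adj G w v ⟩)))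
              (ℤP.i≤j⇒i-j≤0 (ℤP.≤-trans (ℤP.≤-reflexive size-Y) (Λᵇ-sound Y w Λw)))
            by-adj : ∀ b → adj G w v ≡ b → b ≡ true
            by-adj true  _ = refl
            by-adj false e = ⊥-elim (1≰0 (ℤP.≤-trans (ℤP.≤-trans (ℤP.≤-reflexive (sym (cong₂ (λ a b → ⟨ a ⟩ - ⟨ a ∧ b ⟩) Yv e)))
              (term≤∑ 0≤missing v)) total))

          outside-T : ∀ w → Λᵇ Y w ≡ true → κ w ≢ lin S.-
          outside-T w Λw e with () ← trans (sym (common w Λw w (T⊆Y w (cong (is-lin S.-) e)))) (loopless G w)

          dT-common : ∀ w → Λᵇ Y w ≡ true → dT w ≡ t
          dT-common w Λw = sum-cong-≗ entry
            where
            entry : ∀ v → ⟨ T v ∧ adj G w v ⟩ ≡ ⟨ T v ⟩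
            entry v with T v in Tv
            ... | false = refl
            ... | true  = cong ⟨_⟩ (common w Λw v (T⊆Y v Tv))

          in-block : ∀ {c} → Q c ≡ true → Y c ≡ true → ∀ w → Λᵇ Y w ≡ true → S w ≡ false → Block w × R w c
          in-block {c} Qc Yc w Λw Sw with block-nbr (Q-block Qc) (adj-swap (common w Λw c Yc))
          ... | inj₁ e = ⊥-elim (outside-T w Λw e)
          ... | inj₂ (inj₁ e) with () ← trans (sym Sw) (cong (is-lin S.+) e)
          in-block {c} Qc Yc w Λw Sw | inj₂ (inj₂ (block , rc)) = block , R-sym {c} {w} rc

          outside : Fin n → Bool
          outside w = not (S w) ∧ Λᵇ Y w

          -- Expansion gives `Y` at least `k` common neighbours, and at most `s` of them lie in `S`.
          size-outside : + k - s ≤ size outside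
          size-outside = ≤-by (ℤP.≤-trans (ℤP.≤-reflexive (sym size-Y)) (ℤP.≤-trans (expands Y (ℤP.≤-reflexive (sym size-Y)))
              (ℤP.≤-trans (∑-mono {g = λ w → ⟨ S w ⟩ + ⟨ outside w ⟩} entry) (ℤP.≤-reflexive (∑-distrib-+ (λ w → ⟨ S w ⟩) (λ w → ⟨ outside w ⟩))))))
            (solve 3 (λ k s o → (s :+ o) :- k := o :- (k :- s)) refl (+ k) s (size outside))
            where
            entry : ∀ w → ⟨ Λᵇ Y w ⟩ ≤ ⟨ S w ⟩ + ⟨ outside w ⟩
            entry w with S w | Λᵇ Y w
            ... | true  | true  = ℤP.≤-refl
            ... | true  | false = 0≤1
            ... | false | true  = ℤP.≤-refl
            ... | false | false = ℤP.≤-refl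

        0≤* : ∀ {a b} → 0ℤ ≤ a → 0ℤ ≤ b → 0ℤ ≤ a * b
        0≤* {a} {b} 0≤a 0≤b = ℤP.≤-trans (ℤP.≤-reflexive (sym (ℤP.*-zeroˡ b))) (ℤP.*-monoʳ-≤-nonNeg b {{nonNegative 0≤b}} 0≤a)

        -- Counts the edges between T and the vertices outside S that have a whole set Y c as neighbours.
        disjoint-families : (I : Fin n → Bool) (Y : Fin n → Fin n → Bool)
          (T⊆Y : ∀ c v → T v ≡ true → Y c v ≡ true) (size-Y : ∀ c → size (Y c) ≡ + k) →
          (∀ w c c′ → S w ≡ false → I c ≡ true → I c′ ≡ true → Λᵇ (Y c) w ≡ true → Λᵇ (Y c′) w ≡ true → c ≡ c′) →
          size I * (t * (+ k - s)) ≤ E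
        disjoint-families I Y T⊆Y size-Y unique = ℤP.≤-trans (ℤP.≤-reflexive (*-distribʳ-sum (t * (+ k - s)) (λ c → ⟨ I c ⟩)))
            (ℤP.≤-trans (∑-mono {f = λ c → ⟨ I c ⟩ * (t * (+ k - s))} row)
              (ℤP.≤-trans (ℤP.≤-reflexive (∑-comm (λ c w → ⟨ h c w ⟩ * t))) (∑-mono column)))
          where
          module C c = Common (Y c) (T⊆Y c) (size-Y c)
          h : Fin n → Fin n → Bool
          h c w = I c ∧ C.outside c w
          row : ∀ c → ⟨ I c ⟩ * (t * (+ k - s)) ≤ sum (λ w → ⟨ h c w ⟩ * t)
          row c with I c
          ... | false = ∑-nonneg {n} {λ _ → 0ℤ} (λ _ → ℤP.≤-refl)
          ... | true  = ℤP.≤-trans (ℤP.≤-reflexive (ℤP.*-identityˡ _))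
            (ℤP.≤-trans (ℤP.*-monoˡ-≤-nonNeg t {{nonNegative (0≤size T)}} (C.size-outside c))
              (ℤP.≤-reflexive (trans (ℤP.*-comm t (size (C.outside c))) (*-distribʳ-sum t (λ w → ⟨ C.outside c w ⟩)))))
          spec : ∀ c w → h c w ≡ true → I c ≡ true × S w ≡ false × Λᵇ (Y c) w ≡ true
          spec c w e with I c | S w | Λᵇ (Y c) w
          ... | true | false | true = refl , refl , refl
          column : ∀ w → sum (λ c → ⟨ h c w ⟩ * t) ≤ ⟨ not (S w) ⟩ * dT w
          column w = ℤP.≤-trans (ℤP.≤-reflexive (sym (*-distribʳ-sum t (λ c → ⟨ h c w ⟩)))) (by-count (1ℤ ℤP.≤? sum (λ c → ⟨ h c w ⟩)))
            where
            0≤rhs : 0ℤ ≤ ⟨ not (S w) ⟩ * dT w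
            0≤rhs = 0≤* (⟨⟩-nonneg (not (S w))) (0≤nbrs T w)
            by-count : Dec (1ℤ ≤ sum (λ c → ⟨ h c w ⟩)) → sum (λ c → ⟨ h c w ⟩) * t ≤ ⟨ not (S w) ⟩ * dT w
            by-count (no ≰) = ℤP.≤-trans (ℤP.*-monoʳ-≤-nonNeg t {{nonNegative (0≤size T)}} (ℤP.i<j⇒i≤pred[j] (ℤP.≰⇒> ≰)))
              (ℤP.≤-trans (ℤP.≤-reflexive (ℤP.*-zeroˡ t)) 0≤rhs)
            -- A vertex counted for some `c` is counted for no other, and being adjacent to all of
            -- `T` it has `dT w` equal to `t`.
            by-count (yes 1≤) with c , 1≤h ← ∑-pos (λ c → ⟨ h c w ⟩) 1≤ with Ic , Sw , Λw ← spec c w (1≤⟨⟩ 1≤h) =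
              ℤP.≤-trans (ℤP.*-monoʳ-≤-nonNeg t {{nonNegative (0≤size T)}} (∑-at-most-one (λ c → h c w) λ i j ei ej →
                  let Ii , _ , Λi = spec i w ei ; Ij , _ , Λj = spec j w ej in unique w i j Sw Ii Ij Λi Λj))
                (ℤP.≤-reflexive (trans (cong (1ℤ *_) (sym (C.dT-common c w Λw))) (cong (λ b → ⟨ not b ⟩ * dT w) (sym Sw))))

        module SmallX (small : size X + 1ℤ ≤ + k) where

          t+q₂<k : t + q₂ + 1ℤ ≤ + k
          t+q₂<k = ≤-by (ℤP.+-mono-≤ small (ℤP.+-mono-≤ (ℤP.≤-reflexive (sym size-X)) q₂≤Z))
            (solve 5 (λ k x z t q → (k :+ (x :+ z)) :- ((x :+ con 1ℤ) :+ ((t :+ z) :+ q)) := k :- ((t :+ q) :+ con 1ℤ)) refl (+ k) (size X) (size Z) t q₂)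

          t<k : t + 1ℤ ≤ + k
          t<k = ≤-by (ℤP.+-mono-≤ t+q₂<k (0≤size exactᵇ)) (solve 3 (λ k t q → (k :+ q) :- (((t :+ q) :+ con 1ℤ) :+ con 0ℤ) := k :- (t :+ con 1ℤ)) refl (+ k) t q₂)

          family : ∀ c → ∃ λ Y → (∀ v → insert T c v ≡ true → Y v ≡ true) × size Y ≡ + k
          family c = extend (insert T c) k (ℤP.≤-trans (size-insert T c) t<k) k≤n

          Y : Fin n → Fin n → Bool
          Y c = proj₁ (family c)
          T⊆Y : ∀ c v → T v ≡ true → Y c v ≡ true
          T⊆Y c v e = proj₁ (proj₂ (family c)) v (insert-old T c v e)
          size-Y : ∀ c → size (Y c) ≡ + k
          size-Y c = proj₂ (proj₂ (family c))

          P : ℤ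
          P = t * (+ k - s)

          -- The common neighbours of `Y c` outside `S` lie in the block of `c`, so different
          -- defective blocks give disjoint sets.
          Q-count : q * P ≤ E
          Q-count = disjoint-families Q Y T⊆Y size-Y unique
            where
            member : ∀ c w → S w ≡ false → Q c ≡ true → Λᵇ (Y c) w ≡ true → Block w × R w c
            member c w Sw Qc Λw = Common.in-block (Y c) (T⊆Y c) (size-Y c) Qc (proj₁ (proj₂ (family c)) c (insert-new T c)) w Λw Sw
            unique : ∀ w c c′ → S w ≡ false → Q c ≡ true → Q c′ ≡ true → Λᵇ (Y c) w ≡ true → Λᵇ (Y c′) w ≡ true → c ≡ c′
            unique w c c′ Sw Qc Qc′ Λw Λw′ = let block , rc = member c w Sw Qc Λw ; _ , rc′ = member c′ w Sw Qc′ Λw′ in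
              same-block block Qc Qc′ rc rc′

          single-count : Fin n → P ≤ E
          single-count c₀ = subst (_≤ E) (trans (cong (_* P) (∑-δ c₀)) (ℤP.*-identityˡ P))
            (disjoint-families (λ c → ⌊ c₀ ≟ c ⌋) Y T⊆Y size-Y λ w c c′ _ e e′ _ _ → trans (sym (equal e)) (equal e′))
            where
            equal : ∀ {c} → ⌊ c₀ ≟ c ⌋ ≡ true → c₀ ≡ c
            equal {c} e with c₀ ≟ c
            ... | yes p = p

          -- Refutes `s < t`. A single family already gives `q ≥ m + s (k - t) ≥ 2`. Then `q P ≤ E`
          -- turns `balance` into `(q - 1)(P - 1) ≤ 1 - m`, where the left side is nonnegative and
          -- the right side negative.
          s<t : ¬ (1ℤ + s ≤ t)
          s<t lt = 1≰0 (≤-by (ℤP.+-mono-≤ (ℤP.+-mono-≤ (ℤP.≤-reflexive balance) (ℤP.+-mono-≤ 2≤m Q-count))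
                                (ℤP.+-mono-≤ (ℤP.+-mono-≤ 0≤s[k-t] 1≤P) (0≤* (ℤP.i≤j⇒0≤j-i 2≤q) (ℤP.i≤j⇒0≤j-i 1≤P))))
              (solve 6 (λ m k s t q e → let p = t :* (k :- s) in
                  ((k :* t :+ q) :+ (m :+ e) :+ ((s :* (k :- t) :+ p) :+ (q :- con (+ 2)) :* (p :- con 1ℤ)))
                  :- (((m :+ k :* s :+ e) :+ (con (+ 2) :+ q :* p)) :+ ((con 0ℤ :+ con 1ℤ) :+ con 0ℤ)) := con 0ℤ :- con 1ℤ)
                refl m (+ k) s t q E))
            where
            0≤s = 0≤size S
            1≤t : 1ℤ ≤ t
            1≤t = ≤-by (ℤP.+-mono-≤ lt 0≤s) (solve 2 (λ s t → (t :+ s) :- ((con 1ℤ :+ s) :+ con 0ℤ) := t :- con 1ℤ) refl s t)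
            0≤k-t : 0ℤ ≤ + k - t
            0≤k-t = ≤-by (ℤP.+-mono-≤ t<k 0≤1) (solve 2 (λ k t → (k :+ con 1ℤ) :- ((t :+ con 1ℤ) :+ con 0ℤ) := (k :- t) :- con 0ℤ) refl (+ k) t)
            0≤s[k-t] : 0ℤ ≤ s * (+ k - t)
            0≤s[k-t] = 0≤* 0≤s 0≤k-t
            1≤k-s : 1ℤ ≤ + k - s
            1≤k-s = ≤-by (ℤP.+-mono-≤ lt 0≤k-t) (solve 3 (λ k s t → (t :+ (k :- t)) :- ((con 1ℤ :+ s) :+ con 0ℤ) := (k :- s) :- con 1ℤ) refl (+ k) s t)
            1≤P : 1ℤ ≤ P
            1≤P = ≤-by (ℤP.+-mono-≤ (0≤* (ℤP.i≤j⇒0≤j-i 1≤t) (ℤP.≤-trans 0≤1 1≤k-s)) 1≤k-s)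
              (solve 3 (λ k s t → ((t :- con 1ℤ) :* (k :- s) :+ (k :- s)) :- (con 0ℤ :+ con 1ℤ) := t :* (k :- s) :- con 1ℤ) refl (+ k) s t)
            2≤q : + 2 ≤ q
            2≤q = ≤-by (ℤP.+-mono-≤ (ℤP.+-mono-≤ (ℤP.≤-reflexive balance) 2≤m) (ℤP.+-mono-≤ 0≤s[k-t] (single-count (proj₁ (∑-pos (λ v → ⟨ T v ⟩) 1≤t)))))
              (solve 6 (λ m k s t q e → (((k :* t :+ q) :+ m) :+ (s :* (k :- t) :+ e)) :- (((m :+ k :* s :+ e) :+ con (+ 2)) :+ (con 0ℤ :+ t :* (k :- s))) := q :- con (+ 2))
                refl m (+ k) s t q E)

          -- `E-bound` cancels `q₁` in `balance`, so the exact blocks alone must make up the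
          -- difference.
          q₂-large : + k * (s - t) + m ≤ q₂
          q₂-large = ≤-by (ℤP.+-mono-≤ (ℤP.≤-reflexive balance) (ℤP.+-mono-≤ E-bound (k*-mono (0≤size rich))))
            (trans (cong (λ q → ((+ k * t + q) + (E + + k * size rich)) - ((m + + k * s + E) + ((+ k * size rich + q₁) + + k * 0ℤ))) q-split)
              (solve 8 (λ m k s t q₁ q₂ e ρ → ((k :* t :+ (q₁ :+ q₂)) :+ (e :+ k :* ρ)) :- ((m :+ k :* s :+ e) :+ ((k :* ρ :+ q₁) :+ k :* con 0ℤ)) := q₂ :- (k :* (s :- t) :+ m))
                refl m (+ k) s t q₁ q₂ E (size rich)))

          t≤s : t ≤ s
          t≤s = ℤP.≮⇒≥ (λ lt → s<t (ℤP.i<j⇒suc[i]≤j lt))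

          -- Otherwise `q₂` would be at least `k + m`, against `t + q₂ < k`.
          s≤t : s ≤ t
          s≤t = ℤP.≮⇒≥ λ lt → 1≰0 (≤-by (ℤP.+-mono-≤ (ℤP.+-mono-≤ (k*-mono (ℤP.i<j⇒suc[i]≤j lt)) q₂-large)
                                                         (ℤP.+-mono-≤ (ℤP.+-mono-≤ t+q₂<k (0≤size T)) (ℤP.≤-trans (+≤+ (ℕ.z≤n {2})) 2≤m)))
            (solve 5 (λ m k s t q₂ → ((k :* s :+ q₂) :+ ((k :+ t) :+ m)) :- ((k :* (con 1ℤ :+ t) :+ (k :* (s :- t) :+ m)) :+ (((t :+ q₂ :+ con 1ℤ) :+ con 0ℤ) :+ con 0ℤ)) := con 0ℤ :- con 1ℤ)
              refl m (+ k) s t q₂))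

          2≤q₂ : + 2 ≤ q₂
          2≤q₂ = ≤-by (ℤP.+-mono-≤ (ℤP.+-mono-≤ q₂-large 2≤m) (0≤* (ℤP.≤-trans 0≤1 1≤k) (ℤP.i≤j⇒0≤j-i t≤s)))
            (solve 5 (λ m k s t q₂ → ((q₂ :+ m) :+ k :* (s :- t)) :- (((k :* (s :- t) :+ m) :+ con (+ 2)) :+ con 0ℤ) := q₂ :- con (+ 2))
              refl m (+ k) s t q₂)

          -- As `s ≤ t < k`, some common neighbour of a `k`-set containing `T`, `c` and `c′` lies
          -- outside `S`; it would belong to the blocks of both `c` and `c′`.
          two : ∀ {c c′} → c ≢ c′ → exactᵇ c ≡ true → exactᵇ c′ ≡ true →
            (∃ λ Y → (∀ v → insert (insert T c) c′ v ≡ true → Y v ≡ true) × size Y ≡ + k) → ⊥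
          two {c} {c′} c≢c′ e e′ (Y₂ , Y₀⊆Y₂ , size-Y₂) = 1≰0 (≤-by (ℤP.+-mono-≤ (ℤP.+-mono-≤ size-outside none-outside) (ℤP.+-mono-≤ s≤t t<k))
              (solve 4 (λ k s t o → ((o :+ con 0ℤ) :+ (t :+ k)) :- (((k :- s) :+ o) :+ (s :+ (t :+ con 1ℤ))) := con 0ℤ :- con 1ℤ)
                refl (+ k) s t (size outside)))
            where
            open Common Y₂ (λ v Tv → Y₀⊆Y₂ v (insert-old (insert T c) c′ v (insert-old T c v Tv))) size-Y₂
            absurd : ∀ w → S w ≡ false → Λᵇ Y₂ w ≡ true → ⊥
            absurd w Sw Λw =
              let Qc = proj₁ (exact-spec c e)
                  Qc′ = proj₁ (exact-spec c′ e′)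
                  block , rc = in-block Qc (Y₀⊆Y₂ c (insert-old (insert T c) c′ c (insert-new T c))) w Λw Sw
                  _ , rc′ = in-block Qc′ (Y₀⊆Y₂ c′ (insert-new (insert T c) c′)) w Λw Sw
              in c≢c′ (same-block block Qc Qc′ rc rc′)
            none-outside : size outside ≤ 0ℤ
            none-outside = ℤP.≤-reflexive (∑-zero entry)
              where
              entry : ∀ w → ⟨ outside w ⟩ ≡ 0ℤ
              entry w with S w in Sw | Λᵇ Y₂ w in Λw
              ... | true  | _     = refl
              ... | false | false = refl
              ... | false | true  = ⊥-elim (absurd w Sw Λw)

          impossible : ⊥
          impossible =
            let c , c′ , c≢c′ , e , e′ = ∑-two exactᵇ 2≤q₂
            -- Two more vertices fit beside `T` into a set of size `k`, because `q₂ ≥ 2` and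
            -- `t + q₂ < k`.
            in two c≢c′ e e′ (extend (insert (insert T c) c′) k
              (≤-by (ℤP.+-mono-≤ (ℤP.+-mono-≤ (size-insert (insert T c) c′) (size-insert T c)) (ℤP.+-mono-≤ (ℤP.+-mono-≤ 2≤q₂ t+q₂<k) 0≤1))
                (solve 5 (λ y z t q k → (((z :+ con 1ℤ) :+ (t :+ con 1ℤ)) :+ ((q :+ k) :+ con 1ℤ)) :- ((y :+ z) :+ ((con (+ 2) :+ ((t :+ q) :+ con 1ℤ)) :+ con 0ℤ)) := k :- y)
                  refl (size (insert (insert T c) c′)) (size (insert T c)) t q₂ (+ k))) k≤n)

-- From subsets and rationals to indicator functions and integers.

module Bridge where

  open import Defs renaming (sym to adj-sym)
  open import Data.Bool using (Bool; true; false; _∧_; T)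
  import Data.Bool as Bool
  open import Data.Nat as ℕ using (ℕ; zero; suc)
  import Data.Nat.Properties as ℕP
  open import Data.Fin using (Fin; zero; suc)
  open import Data.Fin.Subset using (Subset; ∣_∣; _∩_; ⊤)
  open import Data.Vec using ([]; _∷_; lookup; tabulate)
  open import Data.Vec.Properties using (lookup∘tabulate)
  import Data.Vec.Properties as VP
  open import Data.List using (List; []; _∷_; map; filter)
  open import Data.List.Membership.Propositional using (_∈_)
  open import Data.List.Membership.Propositional.Properties using (∈-map⁺; ∈-map⁻; ∈-++⁺ˡ; ∈-++⁺ʳ; ∈-filter⁺; ∈-filter⁻)
  open import Data.List.Relation.Unary.Any using (here; there)
  open import Data.Maybe using (just; nothing)
  open import Data.Integer using (ℤ; +_; +≤+)
  import Data.Integer as ℤ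
  import Data.Integer.Properties as ℤP
  open import Data.Rational using (ℚ; 0ℚ; _≤_)
  import Data.Rational.Properties as ℚP
  open import Data.Product using (∃; _×_; _,_; proj₂)
  open import Data.Sum using (_⊎_; inj₁; inj₂)
  open import Data.Empty using (⊥-elim)
  open import Relation.Nullary using (¬_; yes; no)
  open import Relation.Nullary.Decidable using (⌊_⌋)
  open import Relation.Binary.PropositionalEquality hiding ([_])
  open Sums
  open Counting using (size; ∧-true; module Neighbours)

  card-lookup : ∀ {n} (S : Subset n) → + ∣ S ∣ ≡ size (lookup S)
  card-lookup [] = refl
  card-lookup (true  ∷ S) = cong (ℤ._+_ (+ 1)) (card-lookup S)
  card-lookup (false ∷ S) = trans (card-lookup S) (sym (ℤP.+-identityˡ _))

  card-tabulate : ∀ {n} (X : Fin n → Bool) → + ∣ tabulate X ∣ ≡ size X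
  card-tabulate X = trans (card-lookup (tabulate X)) (sum-cong-≗ (λ v → cong ⟨_⟩ (lookup∘tabulate X v)))

  module _ {n : ℕ} (k : ℕ) (G : Graph n) where
    open Neighbours G k

    card-∩ : ∀ S v → + ∣ S ∩ N G v ∣ ≡ nbrs (lookup S) v
    card-∩ S v = trans (card-lookup (S ∩ N G v))
      (sum-cong-≗ (λ w → cong ⟨_⟩ (trans (VP.lookup-zipWith _∧_ w S (N G v)) (cong (lookup S w ∧_) (lookup∘tabulate (adj G v) w)))))

    ≤ᵇ-≤? : ∀ a b → (a ℕ.≤ᵇ b) ≡ ⌊ + a ℤP.≤? + b ⌋
    ≤ᵇ-≤? a b with a ℕ.≤ᵇ b in e | + a ℤP.≤? + b
    ... | true  | yes _ = refl
    ... | true  | no ≰  = ⊥-elim (≰ (+≤+ (ℕP.≤ᵇ⇒≤ a b (subst T (sym e) _))))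
    ... | false | no _  = refl
    ... | false | yes (+≤+ a≤b) = ⊥-elim (subst T e (ℕP.≤⇒≤ᵇ a≤b))

    Λ-lookup : ∀ S v → lookup (Λ k G S) v ≡ Λᵇ (lookup S) v
    Λ-lookup S v = trans (lookup∘tabulate _ v)
      (trans (≤ᵇ-≤? k ∣ S ∩ N G v ∣) (cong (λ c → ⌊ + k ℤP.≤? c ⌋) (card-∩ S v)))

    card-Λ : ∀ S → + ∣ Λ k G S ∣ ≡ size (Λᵇ (lookup S))
    card-Λ S = trans (card-lookup (Λ k G S)) (sum-cong-≗ (λ v → cong ⟨_⟩ (Λ-lookup S v)))

    admissible-intro : ∀ S → k ℕ.≤ ∣ S ∣ → Λ k G S ≢ ⊤ → admissible k G S ≡ true
    admissible-intro S k≤S ≢⊤ with k ℕ.≤ᵇ ∣ S ∣ in e | VP.≡-dec Bool._≟_ (Λ k G S) ⊤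
    ... | _     | yes ≡⊤ = ⊥-elim (≢⊤ ≡⊤)
    ... | true  | no _ = refl
    ... | false | no _ = ⊥-elim (subst T e (ℕP.≤⇒≤ᵇ k≤S))

    admissible-elim : ∀ S → admissible k G S ≡ true → k ℕ.≤ ∣ S ∣ × Λ k G S ≢ ⊤
    admissible-elim S e with k ℕ.≤ᵇ ∣ S ∣ in k≤ᵇ | VP.≡-dec Bool._≟_ (Λ k G S) ⊤
    ... | true | no ≢⊤ = ℕP.≤ᵇ⇒≤ k ∣ S ∣ (subst T (sym k≤ᵇ) _) , ≢⊤

    minimum-just : ∀ xs {m} → minimum xs ≡ just m → m ∈ xs × (∀ {x} → x ∈ xs → m ≤ x)
    minimum-just (x ∷ xs) e with minimum xs in e′
    minimum-just (x ∷ xs) refl | nothing = here refl , λ { (here refl) → ℚP.≤-refl ; (there x∈) → ⊥-elim (nothing-empty xs e′ x∈) }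
      where
      nothing-empty : ∀ xs → minimum xs ≡ nothing → ∀ {x} → ¬ x ∈ xs
      nothing-empty (x ∷ xs) e with minimum xs
      nothing-empty (x ∷ xs) () | nothing
      nothing-empty (x ∷ xs) () | just _
    minimum-just (x ∷ xs) refl | just m with m∈ , least ← minimum-just xs e′ =
        member (ℚP.⊓-sel x m) , λ { (here refl) → ℚP.p⊓q≤p x m ; (there x∈) → ℚP.≤-trans (ℚP.p⊓q≤q x m) (least x∈) }
      where
      member : ∀ {y} → y ≡ x ⊎ y ≡ m → y ∈ x ∷ xs
      member (inj₁ refl) = here refl
      member (inj₂ refl) = there m∈

    minimum-nothing : ∀ xs → minimum xs ≡ nothing → xs ≡ []
    minimum-nothing [] _ = refl
    minimum-nothing (x ∷ xs) e with minimum xs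
    minimum-nothing (x ∷ xs) () | nothing
    minimum-nothing (x ∷ xs) () | just _

  allSubsets-complete : ∀ {n} (S : Subset n) → S ∈ allSubsets n
  allSubsets-complete []          = here refl
  allSubsets-complete (true ∷ S)  = ∈-++⁺ˡ (∈-map⁺ (true ∷_) (allSubsets-complete S))
  allSubsets-complete {suc n} (false ∷ S) = ∈-++⁺ʳ (map (true ∷_) (allSubsets n)) (∈-map⁺ (false ∷_) (allSubsets-complete S))

  module _ {n : ℕ} (k : ℕ) (G : Graph n) where

    quotient : Subset n → ℚ
    quotient S = ratio ∣ Λ k G S ∣ ∣ S ∣

    quotients : List ℚ
    quotients = map quotient (filter (λ S → admissible k G S Bool.≟ true) (allSubsets n))

    -- Separates the conventional value 0, taken when no set is admissible, from a genuine minimum,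
    -- which is attained.
    β-cases : (β k G ≡ 0ℚ × ∀ S → admissible k G S ≢ true)
      ⊎ ((∃ λ S → admissible k G S ≡ true × β k G ≡ quotient S) × (∀ S → admissible k G S ≡ true → β k G ≤ quotient S))
    β-cases with minimum quotients in e
    ... | nothing = inj₁ (refl , λ S adm → empty (subst (quotient S ∈_) (minimum-nothing k G quotients e) (listed S adm)))
      where
      empty : ∀ {x : ℚ} → ¬ x ∈ []
      empty ()
      listed : ∀ S → admissible k G S ≡ true → quotient S ∈ quotients
      listed S adm = ∈-map⁺ quotient (∈-filter⁺ (λ S → admissible k G S Bool.≟ true) (allSubsets-complete S) adm)
    ... | just m with m∈ , least ← minimum-just k G quotients e with S , S∈ , m≡ ← ∈-map⁻ quotient m∈ =
      inj₂ ((S , proj₂ (∈-filter⁻ (λ S → admissible k G S Bool.≟ true) {xs = allSubsets n} S∈) , m≡) , λ S adm → least (listed S adm))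
      where
      listed : ∀ S → admissible k G S ≡ true → quotient S ∈ quotients
      listed S adm = ∈-map⁺ quotient (∈-filter⁺ (λ S → admissible k G S Bool.≟ true) (allSubsets-complete S) adm)

-- Existence of the factor.

module Factors where

  open import Defs renaming (sym to adj-sym)
  open import Data.Bool using (Bool; true; false; _∧_)
  import Data.Bool as Bool
  open import Data.Nat as ℕ using (ℕ; zero; suc)
  import Data.Nat.Properties as ℕP
  open import Data.Nat.Divisibility using (_∣_; divides)
  open import Data.Fin using (Fin; zero; suc)
  open import Data.Fin.Properties using (all?)
  open import Data.Fin.Subset using (Subset; ∣_∣; ⊤)
  open import Data.Fin.Subset.Properties using (anySubset?; ∣p∣≤n; ∣⊤∣≡n)
  open import Data.Vec using (Vec; []; _∷_; lookup; tabulate)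
  open import Data.Vec.Properties using (lookup∘tabulate; tabulate-cong)
  import Data.Vec.Properties as VP
  open import Data.Integer as ℤ using (ℤ; +_; 0ℤ; 1ℤ; +≤+)
  import Data.Integer.Properties as ℤP
  open import Data.Rational using (1ℚ) renaming (_≤_ to _≤ℚ_)
  import Data.Rational.Properties as ℚP
  open import Data.Rational.Unnormalised using (mkℚᵘ)
  import Data.Rational.Unnormalised.Properties as ℚᵘP
  open import Data.Product using (Σ; ∃; _×_; _,_; proj₁; proj₂)
  open import Data.Sum using (inj₁; inj₂)
  open import Data.Empty using (⊥-elim)
  open import Relation.Nullary using (¬_; Dec; yes; no)
  open import Relation.Nullary.Decidable using (⌊_⌋; map′; _×-dec_; _→-dec_)
  open import Relation.Binary.PropositionalEquality
  open Sums
  open Costs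
  open Linearisation using (minimise; module Settle)
  open Saturation using (saturate)
  open Counting
  open Bridge

  Searchable : Set → Set₁
  Searchable A = ∀ {P : A → Set} → (∀ a → Dec (P a)) → Dec (∃ P)

  vec-search : ∀ {A} → Searchable A → ∀ m → Searchable (Vec A m)
  vec-search s zero    P? = map′ (λ p → [] , p) (λ { ([] , p) → p }) (P? [])
  vec-search s (suc m) P? = map′ (λ { (a , v , p) → a ∷ v , p }) (λ { (a ∷ v , p) → a , v , p })
    (s (λ a → vec-search s m (λ v → P? (a ∷ v))))

  module _ {n : ℕ} (k : ℕ) (G : Graph n) where

    entry : Vec (Subset n) n → Fin n → Fin n → Bool
    entry M u v = lookup (lookup M u) v

    IsFactor : Vec (Subset n) n → Set
    IsFactor M = (∀ u v → entry M u v ≡ entry M v u) × (∀ u v → entry M u v ≡ true → adj G u v ≡ true)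
      × (∀ v → ∣ tabulate (entry M v) ∣ ≡ k)

    isFactor? : ∀ M → Dec (IsFactor M)
    isFactor? M = all? (λ u → all? (λ v → entry M u v Bool.≟ entry M v u))
      ×-dec all? (λ u → all? (λ v → (entry M u v Bool.≟ true) →-dec (adj G u v Bool.≟ true)))
      ×-dec all? (λ v → ∣ tabulate (entry M v) ∣ ℕP.≟ k)

    -- Adjacency matrices are finite data and can be searched exhaustively; this decision turns the
    -- doubly negated argument into an actual factor.
    hasFactor? : Dec (HasFactor k G)
    hasFactor? = map′ to from (vec-search anySubset? n isFactor?)
      where
      to : ∃ IsFactor → HasFactor k G
      to (M , M-sym , M⊆G , M-deg) = record { adj = entry M ; sym = M-sym ; loopless = M-loopless } , M⊆G , M-deg
        where
        M-loopless : ∀ v → entry M v v ≡ false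
        M-loopless v with entry M v v in e
        ... | false = refl
        ... | true with () ← trans (sym (M⊆G v v e)) (loopless G v)
      from : HasFactor k G → ∃ IsFactor
      from (H , H⊆G , H-deg) = M
          , (λ u v → trans (at u v) (trans (adj-sym H u v) (sym (at v u))))
          , (λ u v e → H⊆G u v (trans (sym (at u v)) e))
          , (λ v → trans (cong ∣_∣ (tabulate-cong (at v))) (H-deg v))
        where
        M : Vec (Subset n) n
        M = tabulate (λ u → tabulate (adj H u))
        at : ∀ u v → entry M u v ≡ adj H u v
        at u v = trans (cong (λ r → lookup r v) (lookup∘tabulate (λ u → tabulate (adj H u)) u)) (lookup∘tabulate (adj H u) v)

  1≤ratio : ∀ a b → 1ℚ ≤ℚ ratio a b → b ℕ.≤ a
  1≤ratio a zero    _ = ℕ.z≤n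
  1≤ratio a (suc b) 1≤ with ℚᵘP.≤-respʳ-≃ (ℚP.toℚᵘ-fromℚᵘ (mkℚᵘ (+ a) b)) (ℚP.toℚᵘ-mono-≤ 1≤)
  ... | Data.Rational.Unnormalised.*≤* le = ℤP.drop‿+≤+ (subst₂ ℤ._≤_ (ℤP.*-identityˡ (+ suc b)) (ℤP.*-identityʳ (+ a)) le)

  module _ {n : ℕ} (k : ℕ) (G : Graph n) (1≤β : 1ℚ ≤ℚ β k G) where
    open Neighbours G k

    1≤quotient : (∃ λ S → admissible k G S ≡ true) × (∀ S → admissible k G S ≡ true → ∣ S ∣ ℕ.≤ ∣ Λ k G S ∣)
    1≤quotient with β-cases k G
    ... | inj₁ (β≡0 , _) = ⊥-elim (1≰ℚ0 (subst (1ℚ ≤ℚ_) β≡0 1≤β))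
      where
      1≰ℚ0 : ¬ (1ℚ ≤ℚ Data.Rational.0ℚ)
      1≰ℚ0 (Data.Rational.*≤* (+≤+ ()))
    ... | inj₂ ((S , adm , _) , least) = (S , adm) , λ S adm → 1≤ratio ∣ Λ k G S ∣ ∣ S ∣ (ℚP.≤-trans 1≤β (least S adm))

    -- If no set were admissible, `β k G` would be 0.
    k≤n : + k ℤ.≤ + n
    k≤n with (S , adm) , _ ← 1≤quotient = +≤+ (ℕP.≤-trans (proj₁ (admissible-elim k G S adm)) (∣p∣≤n S))

    -- Sets whose neighbourhood is everything are excluded from the minimum, but for them the
    -- inequality is trivial.
    expands-subset : ∀ S → k ℕ.≤ ∣ S ∣ → ∣ S ∣ ℕ.≤ ∣ Λ k G S ∣
    expands-subset S k≤S with VP.≡-dec Bool._≟_ (Λ k G S) ⊤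
    ... | yes ≡⊤ = subst (λ p → ∣ S ∣ ℕ.≤ ∣ p ∣) (sym ≡⊤) (subst (∣ S ∣ ℕ.≤_) (sym (∣⊤∣≡n n)) (∣p∣≤n S))
    ... | no ≢⊤  = proj₂ 1≤quotient S (admissible-intro k G S k≤S ≢⊤)

    expands : ∀ X → + k ℤ.≤ size X → size X ℤ.≤ size (Λᵇ X)
    expands X k≤X = subst₂ ℤ._≤_ (card-tabulate X) (trans (card-Λ k G S) (sum-cong-≗ (λ v → cong (λ c → ⟨ ⌊ + k ℤP.≤? c ⌋ ⟩) (same v))))
        (+≤+ (expands-subset S (ℤP.drop‿+≤+ (subst (+ k ℤ.≤_) (sym (card-tabulate X)) k≤X))))
      where
      S : Subset n
      S = tabulate X
      same : ∀ v → nbrs (lookup S) v ≡ nbrs X v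
      same v = sum-cong-≗ (λ w → cong (λ b → ⟨ b ∧ adj G v w ⟩) (lookup∘tabulate X w))

  factor-exists : ∀ k n → 2 ℕ.≤ k → (G : Graph n) → 2 ∣ n ℕ.* k → 1ℚ ≤ℚ β k G → HasFactor k G
  factor-exists k n 2≤k G (divides h nk≡h*2) 1≤β = decide (hasFactor? k G)
    where
    open Subgraphs.InGraph G
    open Excess k
    even-nk : Even (+ n ℤ.* + k)
    even-nk = + h , trans (sym (ℤP.pos-* n k)) (cong +_ (trans nk≡h*2 (trans (ℕP.*-comm h 2) (cong (h ℕ.+_) (ℕP.+-identityʳ h)))))
    κ₀ : Fin n → Kind
    κ₀ _ = abs′
    0≤Φ : ∀ F → 0ℤ ℤ.≤ Φ κ₀ F
    0≤Φ F = ∑-nonneg {f = λ v → abs (excess F v)} (λ v → +≤+ ℕ.z≤n)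
    perfect : ∀ F → Φ κ₀ F ℤ.≤ 0ℤ → HasFactor k G
    perfect F Φ≤0 = record { adj = mat F ; sym = msym F ; loopless = irreflexive F } , m⊆G F , λ v → regular v
      where
      regular : ∀ v → ∣ tabulate (mat F v) ∣ ≡ k
      regular v = ℤP.+-injective (trans (card-tabulate (mat F v)) (ℤP.i-j≡0⇒i≡j (deg F v) (+ k)
        (ℤP.∣i∣≡0⇒i≡0 (ℕP.n≤0⇒n≡0 (ℤP.drop‿+≤+ (ℤP.≤-trans (term≤∑ {f = λ v → abs (excess F v)} (λ _ → +≤+ ℕ.z≤n) v) Φ≤0))))))
    decide : Dec (HasFactor k G) → HasFactor k G
    decide (yes h)  = h
    decide (no none) = ⊥-elim (minimise (Φ κ₀) 0ℤ 0≤Φ empty from-minimum)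
      where
      from-minimum : ¬ (∃ λ F → ∀ F′ → Φ κ₀ F ℤ.≤ Φ κ₀ F′)
      from-minimum (F₀ , least) = settle m even-m κ₀ least (F₀ , ℤP.≤-refl) from-settled
        where
        open Settle excess exch (even even-nk)
        m : ℤ
        m = Φ κ₀ F₀
        even-m : Even m
        even-m = even even-nk κ₀ F₀
        -- Cost 0 would give a factor, and the minimum is even.
        2≤m : + 2 ℤ.≤ m
        2≤m = even-gap {0ℤ} (0ℤ , refl) even-m (0≤Φ F₀) (λ m≤0 → none (perfect F₀ m≤0))
        from-settled : ¬ (∃ λ κ → Σ (∀ F → m ℤ.≤ Φ κ F) λ minimal → (∃ λ F → Φ κ F ℤ.≤ m) × Settled κ m minimal)
        from-settled (κ , minimal , attained , settled) = saturate G k κ m minimal attained λ { (F , oF , sat) →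
          let module B = Barrier.At G k (+≤+ 2≤k) (k≤n k G 1≤β) even-nk (expands k G 1≤β) κ m minimal settled 2≤m F oF sat
          in B.reps λ rep → B.WithReps.large-X rep (ℤP.≮⇒≥ λ lt → B.WithReps.SmallX.impossible rep
               (subst (ℤ._≤ + k) (ℤP.+-comm 1ℤ (size (B.WithReps.X rep))) (ℤP.i<j⇒suc[i]≤j lt))) }

-- Sharpness of the bound.

module Sharpness where

  open import Defs renaming (sym to adj-sym)
  open import Data.Bool using (Bool; true; false; not; _∧_; _∨_)
  import Data.Bool.Properties as BP
  open import Data.Nat as ℕ using (ℕ; zero; suc; _<ᵇ_)
  import Data.Nat.Properties as ℕP
  open import Data.Nat.Divisibility using (_∣_; divides; ∣m⇒∣m*n)
  open import Data.Fin using (Fin; zero; suc; toℕ; _≟_)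
  open import Data.Fin.Subset using (Subset; ∣_∣; ⊤)
  open import Data.Vec using (lookup; tabulate)
  open import Data.Vec.Properties using (lookup∘tabulate; tabulate∘lookup; tabulate-cong; lookup-replicate)
  open import Data.Integer as ℤ using (ℤ; +_; -[1+_]; 0ℤ; 1ℤ; _+_; _-_; _*_; _≤_; +≤+)
  import Data.Integer.Properties as ℤP
  open import Data.Integer.Solver using (module +-*-Solver)
  open +-*-Solver using (solve; con; _:+_; _:*_; _:-_; :-_; _:=_)
  open import Data.Rational as ℚ using (ℚ; mkℚ; 1ℚ; Positive)
  import Data.Rational.Properties as ℚP
  open import Data.Rational.Unnormalised as ℚᵘ using (mkℚᵘ)
  import Data.Rational.Unnormalised.Properties as ℚᵘP
  open import Data.Product using (Σ; _×_; _,_; proj₁; proj₂)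
  open import Data.Sum using (_⊎_; inj₁; inj₂)
  open import Data.Empty using (⊥-elim)
  open import Relation.Nullary using (¬_; Dec; yes; no)
  open import Relation.Nullary.Decidable using (⌊_⌋)
  open import Relation.Binary.PropositionalEquality
  open Sums
  open Counting using (size; 0≤size; module Neighbours)
  open Bridge

  -- If `D` is the denominator of `ε`, then `ε ≥ 1/D`, so it suffices that `1 - 1/D < a/b`, which is
  -- the hypothesis cleared of fractions.
  1-ε<ratio : ∀ ε → Positive ε → ∀ a b → 0 ℕ.< b → b ℕ.* ℚ.↧ₙ ε ℕ.< a ℕ.* ℚ.↧ₙ ε ℕ.+ b → (1ℚ ℚ.- ε) ℚ.< ratio a b
  1-ε<ratio (mkℚ (+ suc p) d c) _ a (suc b) _ lt = ℚP.toℚᵘ-cancel-<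
      (ℚᵘP.<-respʳ-≃ (ℚᵘP.≃-sym (ℚP.toℚᵘ-fromℚᵘ (mkℚᵘ (+ a) b)))
        (ℚᵘP.<-respˡ-≃ (ℚᵘP.≃-sym (ℚP.toℚᵘ-homo-+ 1ℚ (ℚ.- mkℚ (+ suc p) d c)))
          (ℚᵘ.*<* (ℤP.suc[i]≤j⇒i<j (≤-by (ℤP.+-mono-≤ lt′ 0≤pB)
            (trans (solve 4 (λ D p B A → ((A :* D :+ B) :+ p :* B) :- ((con 1ℤ :+ B :* D) :+ con 0ℤ)
                     := A :* D :- (con 1ℤ :+ (con 1ℤ :* D :+ (:- (con 1ℤ :+ p)) :* con 1ℤ) :* B)) refl (+ suc d) (+ p) (+ suc b) (+ a))
              (cong (λ e → + a * (+ e) - (1ℤ + (1ℤ * + suc d + -[1+ p ] * 1ℤ) * + suc b)) (sym (ℕP.+-identityʳ (suc d))))))))))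
    where
    lt′ : 1ℤ + + suc b * + suc d ≤ + a * + suc d + + suc b
    lt′ = subst₂ _≤_ (cong (_+_ 1ℤ) (ℤP.pos-* (suc b) (suc d))) (cong (_+ + suc b) (ℤP.pos-* a (suc d))) (+≤+ lt)
    0≤pB : 0ℤ ≤ + p * + suc b
    0≤pB = subst (0ℤ ≤_) (ℤP.pos-* p (suc b)) (+≤+ ℕ.z≤n)

  ratio<1 : ∀ {a b} → a ℕ.< b → ratio a b ℚ.< 1ℚ
  ratio<1 {a} {suc b} a<b = ℚP.toℚᵘ-cancel-< (ℚᵘP.<-respˡ-≃ (ℚᵘP.≃-sym (ℚP.toℚᵘ-fromℚᵘ (mkℚᵘ (+ a) b)))
    (ℚᵘ.*<* (subst₂ ℤ._<_ (sym (ℤP.*-identityʳ (+ a))) (sym (ℤP.*-identityˡ (+ suc b))) (ℤ.+<+ a<b))))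

  size-initial : ∀ s t → size {s ℕ.+ t} (λ v → toℕ v <ᵇ s) ≡ + s
  size-initial zero    t = ∑-zero {t} (λ _ → refl)
  size-initial (suc s) t = cong (_+_ 1ℤ) (size-initial s t)

  size-not : ∀ {n} (X : Fin n → Bool) → size (λ v → not (X v)) ≡ + n - size X
  size-not {n} X = trans (sum-cong-≗ (λ v → flip (X v))) (trans (∑-distrib-- (λ _ → 1ℤ) (λ v → ⟨ X v ⟩))
      (cong (_- size X) (trans (∑-const n 1ℤ) (ℤP.*-identityʳ (+ n)))))
    where
    flip : ∀ b → ⟨ not b ⟩ ≡ 1ℤ - ⟨ b ⟩
    flip true  = refl
    flip false = refl

  module Join (s k : ℕ) (1≤k : 1 ℕ.≤ k) (2k≤s : k ℕ.+ k ℕ.≤ s) where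

    -- With `s + 2` rather than `s + 1` independent vertices the order is even, so `n k` is even for
    -- odd `k` too.
    n : ℕ
    n = s ℕ.+ (s ℕ.+ 2)

    I : Fin n → Bool
    I v = toℕ v <ᵇ s

    G : Graph n
    G = record { adj = λ u v → not ⌊ u ≟ v ⌋ ∧ (I u ∨ I v)
               ; sym = λ u v → cong₂ (λ a b → not a ∧ b) (≟-sym u v) (BP.∨-comm (I u) (I v))
               ; loopless = loop }
      where
      ≟-sym : ∀ (u v : Fin n) → ⌊ u ≟ v ⌋ ≡ ⌊ v ≟ u ⌋
      ≟-sym u v with u ≟ v | v ≟ u
      ... | yes _ | yes _ = refl
      ... | no _  | no _  = refl
      ... | yes p | no q  = ⊥-elim (q (sym p))
      ... | no p  | yes q = ⊥-elim (p (sym q))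
      loop : ∀ v → not ⌊ v ≟ v ⌋ ∧ (I v ∨ I v) ≡ false
      loop v with v ≟ v
      ... | yes _   = refl
      ... | no  v≢v = ⊥-elim (v≢v refl)

    open Neighbours G k

    size-I : size I ≡ + s
    size-I = size-initial s (s ℕ.+ 2)

    size-notI : size (λ v → not (I v)) ≡ + s + + 2
    size-notI = trans (size-not I) (trans (cong (λ c → (+ s + (+ s + + 2)) - c) size-I)
      (solve 1 (λ s → (s :+ (s :+ con (+ 2))) :- s := s :+ con (+ 2)) refl (+ s)))

    nbrs-in : ∀ X v → I v ≡ true → nbrs X v ≡ size X - ⟨ X v ⟩
    nbrs-in X v Iv = trans (sum-cong-≗ entry) (trans (∑-distrib-- (λ w → ⟨ X w ⟩) (λ w → δ v w * ⟨ X w ⟩))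
        (cong (λ c → size X - c) (∑-δ* v (λ w → ⟨ X w ⟩))))
      where
      entry : ∀ w → ⟨ X w ∧ (not ⌊ v ≟ w ⌋ ∧ (I v ∨ I w)) ⟩ ≡ ⟨ X w ⟩ - δ v w * ⟨ X w ⟩
      entry w rewrite Iv with X w | v ≟ w
      ... | true  | yes _ = refl
      ... | true  | no _  = refl
      ... | false | yes _ = refl
      ... | false | no _  = refl

    inner outer : (Fin n → Bool) → Fin n → Bool
    inner X w = X w ∧ I w
    outer X w = X w ∧ not (I w)

    nbrs-out : ∀ X v → I v ≡ false → nbrs X v ≡ size (inner X)
    nbrs-out X v Iv = sum-cong-≗ entry
      where
      entry : ∀ w → ⟨ X w ∧ (not ⌊ v ≟ w ⌋ ∧ (I v ∨ I w)) ⟩ ≡ ⟨ X w ∧ I w ⟩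
      entry w with v ≟ w
      ... | yes refl rewrite Iv = refl
      ... | no _ rewrite Iv = refl

    Λᵇ-intro : ∀ X v → + k ≤ nbrs X v → Λᵇ X v ≡ true
    Λᵇ-intro X v k≤ with + k ℤP.≤? nbrs X v
    ... | yes _ = refl
    ... | no ≰ = ⊥-elim (≰ k≤)

    size-split : ∀ X → size X ≤ size (inner X) + (+ s + + 2)
    size-split X = ℤP.≤-trans (∑-mono {g = λ w → ⟨ inner X w ⟩ + ⟨ not (I w) ⟩} entry)
        (ℤP.≤-reflexive (trans (∑-distrib-+ (λ w → ⟨ inner X w ⟩) (λ w → ⟨ not (I w) ⟩)) (cong (_+_ (size (inner X))) size-notI)))
      where
      entry : ∀ w → ⟨ X w ⟩ ≤ ⟨ X w ∧ I w ⟩ + ⟨ not (I w) ⟩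
      entry w with X w | I w
      ... | true  | true  = ℤP.≤-refl
      ... | true  | false = ℤP.≤-refl
      ... | false | true  = ℤP.≤-refl
      ... | false | false = +≤+ ℕ.z≤n

    Expanding : ℤ → ℤ → Set
    Expanding a c = c ≤ a ⊎ (+ s ≤ a × c ≤ a + (+ k + 1ℤ))

    -- If `X` has `k` vertices, `Λᵇ X` still contains `I` minus `X`, at least `s - k ≥ k` vertices.
    -- If `X` is larger, `Λᵇ X` contains `I`; as it is not everything, `X` has at most `k - 1`
    -- vertices in `I`, hence at most `(k - 1) + (s + 2)` in all.
    expanding : ∀ X → + k ≤ size X → ¬ (∀ v → Λᵇ X v ≡ true) → Expanding (size (Λᵇ X)) (size X)
    expanding X k≤X not-all = by-size (size X ℤP.≟ + k)
      where
      by-size : Dec (size X ≡ + k) → Expanding (size (Λᵇ X)) (size X)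
      by-size (yes X≡k) = inj₁ (≤-by (ℤP.+-mono-≤ (ℤP.+-mono-≤ (+≤+ 2k≤s) (ℤP.≤-reflexive (sym size-I)))
              (ℤP.+-mono-≤ I≤ (ℤP.+-mono-≤ (ℤP.≤-reflexive X≡k) (ℤP.≤-reflexive X≡k))))
          (solve 5 (λ s i l k x → ((s :+ i) :+ ((l :+ x) :+ (k :+ k))) :- (((k :+ k) :+ s) :+ (i :+ (x :+ x))) := l :- x)
            refl (+ s) (size I) (size (Λᵇ X)) (+ k) (size X)))
        where
        I≤ : size I ≤ size (Λᵇ X) + size X
        I≤ = ℤP.≤-trans (∑-mono {g = λ w → ⟨ Λᵇ X w ⟩ + ⟨ X w ⟩} entry) (ℤP.≤-reflexive (∑-distrib-+ (λ w → ⟨ Λᵇ X w ⟩) (λ w → ⟨ X w ⟩)))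
          where
          entry : ∀ w → ⟨ I w ⟩ ≤ ⟨ Λᵇ X w ⟩ + ⟨ X w ⟩
          entry w = go (I w) (X w) refl refl
            where
            go : ∀ a b → I w ≡ a → X w ≡ b → ⟨ a ⟩ ≤ ⟨ Λᵇ X w ⟩ + ⟨ b ⟩
            go false b _ _ = ℤP.+-mono-≤ (⟨⟩-nonneg (Λᵇ X w)) (⟨⟩-nonneg b)
            go true true _ _ = ℤP.+-monoˡ-≤ 1ℤ (⟨⟩-nonneg (Λᵇ X w))
            go true false Iw Xw = ℤP.≤-reflexive (cong (λ b → ⟨ b ⟩ + 0ℤ) (sym (Λᵇ-intro X w
              (ℤP.≤-trans k≤X (ℤP.≤-reflexive (sym (trans (nbrs-in X w Iw) (trans (cong (λ b → size X - ⟨ b ⟩) Xw) (ℤP.+-identityʳ (size X))))))))))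
      by-size (no X≢k) = by-inner (+ k ℤP.≤? size (inner X))
        where
        k<X : 1ℤ + + k ≤ size X
        k<X = ℤP.i<j⇒suc[i]≤j (ℤP.≤∧≢⇒< k≤X (λ e → X≢k (sym e)))
        I⊆Λ : ∀ v → I v ≡ true → Λᵇ X v ≡ true
        I⊆Λ v Iv = Λᵇ-intro X v (≤-by (ℤP.+-mono-≤ k<X (⟨⟩≤1 (X v)))
          (trans (solve 3 (λ k x b → (x :+ con 1ℤ) :- ((con 1ℤ :+ k) :+ b) := (x :- b) :- k) refl (+ k) (size X) ⟨ X v ⟩) (cong (_- + k) (sym (nbrs-in X v Iv)))))
        by-inner : Dec (+ k ≤ size (inner X)) → Expanding (size (Λᵇ X)) (size X)
        by-inner (yes k≤) = ⊥-elim (not-all λ v → go v (I v) refl)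
          where
          go : ∀ v b → I v ≡ b → Λᵇ X v ≡ true
          go v true  Iv = I⊆Λ v Iv
          go v false Iv = Λᵇ-intro X v (ℤP.≤-trans k≤ (ℤP.≤-reflexive (sym (nbrs-out X v Iv))))
        by-inner (no k≰) = inj₂ (s≤Λ , ≤-by (ℤP.+-mono-≤ (ℤP.+-mono-≤ (size-split X) (ℤP.i<j⇒suc[i]≤j (ℤP.≰⇒> k≰))) s≤Λ)
            (solve 5 (λ x i s k l → (((i :+ (s :+ con (+ 2))) :+ k) :+ l) :- ((x :+ (con 1ℤ :+ i)) :+ s) := (l :+ (k :+ con 1ℤ)) :- x)
              refl (size X) (size (inner X)) (+ s) (+ k) (size (Λᵇ X))))
          where
          s≤Λ : + s ≤ size (Λᵇ X)
          s≤Λ = ℤP.≤-trans (ℤP.≤-reflexive (sym size-I)) (∑-mono entry)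
            where
            entry : ∀ v → ⟨ I v ⟩ ≤ ⟨ Λᵇ X v ⟩
            entry v = go (I v) refl
              where
              go : ∀ b → I v ≡ b → ⟨ b ⟩ ≤ ⟨ Λᵇ X v ⟩
              go false _  = ⟨⟩-nonneg (Λᵇ X v)
              go true  Iv = ℤP.≤-reflexive (cong ⟨_⟩ (sym (I⊆Λ v Iv)))

    expanding-subset : ∀ S → admissible k G S ≡ true →
      ∣ S ∣ ℕ.≤ ∣ Λ k G S ∣ ⊎ (s ℕ.≤ ∣ Λ k G S ∣ × ∣ S ∣ ℕ.≤ ∣ Λ k G S ∣ ℕ.+ (k ℕ.+ 1))
    expanding-subset S adm = convert (subst₂ Expanding (sym (card-Λ k G S)) (sym (card-lookup S))
        (expanding (lookup S) (subst (+ k ≤_) (card-lookup S) (+≤+ (proj₁ spec))) (λ all → proj₂ spec (full all))))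
      where
      spec : k ℕ.≤ ∣ S ∣ × Λ k G S ≢ ⊤
      spec = admissible-elim k G S adm
      full : (∀ v → Λᵇ (lookup S) v ≡ true) → Λ k G S ≡ ⊤
      full all = trans (sym (tabulate∘lookup (Λ k G S)))
        (trans (tabulate-cong (λ v → trans (Λ-lookup k G S v) (trans (all v) (sym (lookup-replicate v true))))) (tabulate∘lookup ⊤))
      convert : Expanding (+ ∣ Λ k G S ∣) (+ ∣ S ∣) → _
      convert (inj₁ (+≤+ le)) = inj₁ le
      convert (inj₂ (+≤+ le , +≤+ le′)) = inj₂ (le , le′)

    S₀ : Subset n
    S₀ = tabulate (λ v → not (I v))

    card-S₀ : ∣ S₀ ∣ ≡ s ℕ.+ 2
    card-S₀ = ℤP.+-injective (trans (card-tabulate (λ v → not (I v))) size-notI)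

    Λ-S₀ : ∀ v → lookup (Λ k G S₀) v ≡ true → I v ≡ true
    Λ-S₀ v e = go (I v) refl
      where
      no-inner : size (inner (lookup S₀)) ≡ 0ℤ
      no-inner = ∑-zero λ w → trans (cong (λ b → ⟨ b ∧ I w ⟩) (lookup∘tabulate (λ v → not (I v)) w)) (both (I w))
        where
        both : ∀ b → ⟨ not b ∧ b ⟩ ≡ 0ℤ
        both true  = refl
        both false = refl
      go : ∀ b → I v ≡ b → b ≡ true
      go true  _  = refl
      go false Iv = ⊥-elim (1≰0 (ℤP.≤-trans (+≤+ 1≤k) (ℤP.≤-trans
        (Λᵇ-sound (lookup S₀) v (trans (sym (Λ-lookup k G S₀ v)) e)) (ℤP.≤-reflexive (trans (nbrs-out (lookup S₀) v Iv) no-inner)))))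

    card-Λ-S₀ : ∣ Λ k G S₀ ∣ ℕ.≤ s
    card-Λ-S₀ = ℤP.drop‿+≤+ (ℤP.≤-trans (ℤP.≤-reflexive (card-lookup (Λ k G S₀))) (ℤP.≤-trans (∑-mono entry) (ℤP.≤-reflexive size-I)))
      where
      entry : ∀ v → ⟨ lookup (Λ k G S₀) v ⟩ ≤ ⟨ I v ⟩
      entry v = go (lookup (Λ k G S₀) v) refl
        where
        go : ∀ b → lookup (Λ k G S₀) v ≡ b → ⟨ b ⟩ ≤ ⟨ I v ⟩
        go false _ = ⟨⟩-nonneg (I v)
        go true  e = ℤP.≤-reflexive (cong ⟨_⟩ (sym (Λ-S₀ v e)))

    k≤s : k ℕ.≤ s
    k≤s = ℕP.≤-trans (ℕP.m≤m+n k k) 2k≤s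

    S₀-admissible : admissible k G S₀ ≡ true
    S₀-admissible = admissible-intro k G S₀ (subst (k ℕ.≤_) (sym card-S₀) (ℕP.≤-trans k≤s (ℕP.m≤m+n s 2)))
      (λ e → ℕP.<-irrefl refl (ℕP.≤-trans (ℕP.m≤m+n (suc s) (s ℕ.+ 1)) (ℕP.≤-trans (ℕP.≤-reflexive shift)
        (subst (ℕ._≤ s) (trans (cong ∣_∣ e) (∣⊤∣≡n n)) card-Λ-S₀))))
      where
      open import Data.Fin.Subset.Properties using (∣⊤∣≡n)
      shift : suc s ℕ.+ (s ℕ.+ 1) ≡ n
      shift = trans (sym (ℕP.+-suc s (s ℕ.+ 1))) (cong (s ℕ.+_) (sym (ℕP.+-suc s 1)))

    β<1 : β k G ℚ.< 1ℚ
    β<1 with β-cases k G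
    ... | inj₁ (_ , none)  = ⊥-elim (none S₀ S₀-admissible)
    ... | inj₂ (_ , least) = ℚP.≤-<-trans (least S₀ S₀-admissible)
      (ratio<1 (ℕP.≤-<-trans card-Λ-S₀ (subst (s ℕ.<_) (sym card-S₀) (ℕP.≤-trans (ℕP.≤-reflexive (sym (ℕP.+-comm s 1))) (ℕP.+-monoʳ-≤ s (ℕ.s≤s ℕ.z≤n))))))

    1-ε<β : ∀ ε → Positive ε → (k ℕ.+ 1) ℕ.* ℚ.↧ₙ ε ℕ.≤ s → (1ℚ ℚ.- ε) ℚ.< β k G
    1-ε<β ε ε>0 large with β-cases k G
    ... | inj₁ (_ , none) = ⊥-elim (none S₀ S₀-admissible)
    ... | inj₂ ((S , adm , β≡) , _) = subst ((1ℚ ℚ.- ε) ℚ.<_) (sym β≡) (1-ε<ratio ε ε>0 a c 0<c bound)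
      where
      a c D : ℕ
      a = ∣ Λ k G S ∣
      c = ∣ S ∣
      D = ℚ.↧ₙ ε
      0<c : 0 ℕ.< c
      0<c = ℕP.≤-trans 1≤k (proj₁ (admissible-elim k G S adm))
      small : c ℕ.≤ a → c ℕ.* D ℕ.< a ℕ.* D ℕ.+ c
      small c≤a = ℕP.≤-<-trans (ℕP.*-monoˡ-≤ D c≤a) (ℕP.m<m+n (a ℕ.* D) 0<c)
      bound : c ℕ.* D ℕ.< a ℕ.* D ℕ.+ c
      bound with expanding-subset S adm
      ... | inj₁ c≤a = small c≤a
      ... | inj₂ (s≤a , c≤) with c ℕP.≤? a
      ...   | yes c≤a = small c≤a
      -- Here `c D ≤ a D + (k + 1) D ≤ a D + s`, and `s ≤ a < c`.
      ...   | no c≰a = ℕP.≤-<-trans (ℕP.*-monoˡ-≤ D c≤) (ℕP.≤-<-trans (ℕP.≤-reflexive (ℕP.*-distribʳ-+ D a (k ℕ.+ 1)))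
                (ℕP.+-monoʳ-< (a ℕ.* D) (ℕP.≤-<-trans (ℕP.≤-trans large s≤a) (ℕP.≰⇒> c≰a))))

    -- The edges of a factor at the `s + 2` independent vertices all end in `I`, where the degrees
    -- sum to only `s k`.
    no-factor : ¬ HasFactor k G
    no-factor (H , H⊆G , regular) = ℕP.<-irrefl refl (ℕP.≤-trans 1≤k (ℤP.drop‿+≤+ (≤-by (ℤP.+-mono-≤ crossing (+≤+ (ℕ.z≤n {k})))
        (solve 2 (λ k s → (s :* k :+ k) :- ((s :+ con (+ 2)) :* k :+ con 0ℤ) := con 0ℤ :- k) refl (+ k) (+ s)))))
      where
      deg : Fin n → ℤ
      deg v = sum (λ w → ⟨ adj H v w ⟩)
      deg≡k : ∀ v → deg v ≡ + k
      deg≡k v = trans (sym (card-tabulate (adj H v))) (cong +_ (regular v))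
      weigh : ∀ (X : Fin n → Bool) {c} → size X ≡ c → sum (λ v → ⟨ X v ⟩ * deg v) ≡ c * + k
      weigh X size≡ = trans (sum-cong-≗ (λ v → cong (⟨ X v ⟩ *_) (deg≡k v))) (trans (sym (*-distribʳ-sum (+ k) (λ v → ⟨ X v ⟩))) (cong (_* + k) size≡))
      crossing : (+ s + + 2) * + k ≤ + s * + k
      crossing = ℤP.≤-trans (ℤP.≤-reflexive (trans (sym (weigh (λ v → not (I v)) size-notI))
            (trans (sum-cong-≗ (λ v → *-distribˡ-sum ⟨ not (I v) ⟩ (λ w → ⟨ adj H v w ⟩))) (∑-comm (λ v w → ⟨ not (I v) ⟩ * ⟨ adj H v w ⟩)))))
          (ℤP.≤-trans (∑-mono column) (ℤP.≤-reflexive (weigh I size-I)))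
        where
        column : ∀ w → sum (λ v → ⟨ not (I v) ⟩ * ⟨ adj H v w ⟩) ≤ ⟨ I w ⟩ * deg w
        column w = ℤP.≤-trans (∑-mono entry) (ℤP.≤-reflexive (sym (*-distribˡ-sum ⟨ I w ⟩ (λ v → ⟨ adj H w v ⟩))))
          where
          cases : ∀ a b h → (h ≡ true → a ∨ b ≡ true) → ⟨ not a ⟩ * ⟨ h ⟩ ≤ ⟨ b ⟩ * ⟨ h ⟩
          cases true  true  true  _ = +≤+ ℕ.z≤n
          cases true  false true  _ = ℤP.≤-refl
          cases false true  true  _ = ℤP.≤-refl
          cases false false true  f with () ← f refl
          cases true  true  false _ = ℤP.≤-refl
          cases true  false false _ = ℤP.≤-refl
          cases false true  false _ = ℤP.≤-refl
          cases false false false _ = ℤP.≤-refl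
          entry : ∀ v → ⟨ not (I v) ⟩ * ⟨ adj H v w ⟩ ≤ ⟨ I w ⟩ * ⟨ adj H w v ⟩
          entry v = subst (λ h → ⟨ not (I v) ⟩ * ⟨ adj H v w ⟩ ≤ ⟨ I w ⟩ * ⟨ h ⟩) (adj-sym H v w)
            (cases (I v) (I w) (adj H v w) (λ e → proj₂ (Counting.∧-true {not ⌊ v ≟ w ⌋} (H⊆G v w e))))

  sharp : ∀ k → 2 ℕ.≤ k → ∀ ε → Positive ε → Σ ℕ λ n → Σ (Graph n) λ G →
    (2 ∣ n ℕ.* k) × ((1ℚ ℚ.- ε) ℚ.< β k G) × (β k G ℚ.< 1ℚ) × ¬ HasFactor k G
  sharp k 2≤k ε ε>0 = n , G , ∣m⇒∣m*n k (divides (s ℕ.+ 1) even) , 1-ε<β ε ε>0 (ℕP.m≤m+n ((k ℕ.+ 1) ℕ.* ℚ.↧ₙ ε) (k ℕ.+ k)) , β<1 , no-factor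
    where
    -- The summand `(k + 1) D`, with `D` the denominator of `ε`, keeps the relative loss below `ε`;
    -- the summand `2 k` lets `k`-sets expand.
    s : ℕ
    s = (k ℕ.+ 1) ℕ.* ℚ.↧ₙ ε ℕ.+ (k ℕ.+ k)
    open Join s k (ℕP.≤-trans (ℕ.s≤s ℕ.z≤n) 2≤k) (ℕP.m≤n+m (k ℕ.+ k) ((k ℕ.+ 1) ℕ.* ℚ.↧ₙ ε))
    even : n ≡ (s ℕ.+ 1) ℕ.* 2
    even = solveℕ 1 (λ s → s :+ℕ (s :+ℕ conℕ 2) :=ℕ (s :+ℕ conℕ 1) :*ℕ conℕ 2) refl s
      where
      open import Data.Nat.Solver using () renaming (module +-*-Solver to ℕ-Solver)
      open ℕ-Solver using () renaming (solve to solveℕ; con to conℕ; _:+_ to _:+ℕ_; _:*_ to _:*ℕ_; _:=_ to _:=ℕ_)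

open import Defs
open import Data.Nat using (ℕ; _≤_; _*_)
open import Data.Nat.Divisibility using (_∣_)
open import Data.Rational using (ℚ; Positive; 1ℚ; _-_; _<_) renaming (_≤_ to _≤ℚ_)
open import Data.Product using (_×_; Σ; _,_)
open import Relation.Nullary using (¬_)

theorem1p1 : ((k n : ℕ) → 2 ≤ k → (G : Graph n) → 2 ∣ n * k → 1ℚ ≤ℚ β k G → HasFactor k G)
    × ((k : ℕ) → 2 ≤ k → (ε : ℚ) → Positive ε →
    Σ ℕ (λ n → Σ (Graph n) (λ G →
    (2 ∣ n * k) × (1ℚ - ε < β k G) × (β k G < 1ℚ) × ¬ HasFactor k G)))
theorem1p1 = Factors.factor-exists , Sharpness.sharp
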